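{- Every maximum affine equiangular set in $L$ with norm $3$ with respect to the switching root $\rho$ is maximal in $\mathbb{R}L$; that is, there is no affine equiangular set in $\mathbb{R}L$ with norm $3$ with respect to $\rho$ properly containing it.
   Context: Lattices. $A_n=\{x\in\mathbb{Z}^{n+1}: x_1+\cdots+x_{n+1}=0\}$ and $\alpha_n=(\frac1{n+1},\dots,\frac1{n+1},-\frac n{n+1})\in\mathbb{R}^{n+1}$ (so $\alpha_1=(\frac12,-\frac12)$). Let $\Lambda=A_5^3\oplus A_1^4\subset\mathbb{R}^{26}$; vectors of $\mathbb{R}^{26}$ are written $(v_1,\dots,v_7)$ with $v_1,v_2,v_3\in\mathbb{R}^6$ and $v_4,\dots,v_7\in\mathbb{R}^2$. Let $\beta_0=(\alpha_5,\alpha_5,\alpha_5,0,0,0,\alpha_1)$, $\beta_1=(3\alpha_5,0,0,0,\alpha_1,\alpha_1,\alpha_1)$, $\beta_2=(0,3\alpha_5,0,\alpha_1,0,\alpha_1,\alpha_1)$, $\beta_3=(0,0,3\alpha_5,\alpha_1,\alpha_1,0,\alpha_1)$. $L$ is the lattice generated by $\Lambda$ and $\beta_0,\beta_1,\beta_2,\beta_3$ (an integral lattice), and $\mathbb{R}L$ is its real span (of dimension $19$). Let $\rho=(0,0,0,0,0,0,2\alpha_1)$. Affine equiangular sets. A set $\omega$ of vectors is an affine equiangular set with norm $3$ with respect to the switching root $\rho$ if $(u,\rho)=1$ and $(u,u)=3$ for all $u\in\omega$, and $(u,v)\in\{0,1\}$ for all distinct $u,v\in\omega$, where $(\cdot,\cdot)$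 is the standard inner product. It is in a set $V$ if $\omega\subset V$. It is maximum in $L$ if no such set in $L$ has larger cardinality. -}

module Defs where

open import Algebra.Bundles using (CommutativeMonoid)
open import Data.Fin.Base using (Fin)
open import Data.Fin.Patterns using (0F; 1F; 2F; 3F)
open import Data.Integer.Base as ℤ using (ℤ; +_; 0ℤ)
open import Data.Nat.Base as ℕ using (ℕ; suc)
import Data.Nat.Properties as ℕ
open import Data.Product.Base using (Σ; ∃-syntax; _×_; _,_; proj₁; proj₂)
open import Data.Rational.Base as ℚ using (ℚ; 0ℚ; 1ℚ; ½)
import Data.Rational.Properties as ℚ
open import Data.Sum.Base using (_⊎_)
open import Data.Vec.Functional
  using (Vector; []; _∷_; _++_; replicate; map; zipWith; foldr)
import Data.Vec.Functional.Relation.Binary.Equality.Setoid as VecEq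
open import Function.Base using (id)
open import Function.Bundles using (Injection)
open import Level using (0ℓ)
open import Relation.Binary.Bundles using (Setoid)
open import Relation.Binary.Definitions using (_Respects_)
import Relation.Binary.Construct.On as On
open import Relation.Binary.PropositionalEquality
  using (_≡_; refl; sym; trans; cong; cong₂; subst)
open import Relation.Nullary.Negation using (¬_)
open import Relation.Unary using (Pred; _∈_; _∉_; _⊆_; _∪_)

------------------------------------------------------------------------
-- Real numbers, as Cauchy sequences of rationals

Eventually : Pred ℕ 0ℓ → Set
Eventually P = ∃[ N ] (∀ n → N ℕ.≤ n → P n)

IsCauchy : (ℕ → ℚ) → Set
IsCauchy x = ∀ ε → 0ℚ ℚ.< ε →
  ∃[ N ] (∀ m n → N ℕ.≤ m → N ℕ.≤ n → ℚ.∣ x m ℚ.- x n ∣ ℚ.≤ ε)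

record ℝ : Set where
  constructor mkℝ
  field
    seq    : ℕ → ℚ
    cauchy : IsCauchy seq

open ℝ public

infix 4 _≈_

-- Equality of reals: the difference of the sequences tends to 0.
_≈_ : ℝ → ℝ → Set
x ≈ y = ∀ ε → 0ℚ ℚ.< ε →
  Eventually (λ n → ℚ.∣ seq x n ℚ.- seq y n ∣ ℚ.≤ ε)

private
  -+-cancel : ∀ p q → (p ℚ.- q) ℚ.+ q ≡ p
  -+-cancel p q = begin
    (p ℚ.- q) ℚ.+ q       ≡⟨ ℚ.+-assoc p (ℚ.- q) q ⟩
    p ℚ.+ (ℚ.- q ℚ.+ q)   ≡⟨ cong (p ℚ.+_) (ℚ.+-inverseˡ q) ⟩
    p ℚ.+ 0ℚ              ≡⟨ ℚ.+-identityʳ p ⟩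
    p                     ∎
    where open Relation.Binary.PropositionalEquality.≡-Reasoning

  telescope : ∀ p q r → (p ℚ.- q) ℚ.+ (q ℚ.- r) ≡ p ℚ.- r
  telescope p q r = trans (sym (ℚ.+-assoc (p ℚ.- q) q (ℚ.- r)))
                          (cong (ℚ._- r) (-+-cancel p q))

  triangle : ∀ p q r → ℚ.∣ p ℚ.- r ∣ ℚ.≤ ℚ.∣ p ℚ.- q ∣ ℚ.+ ℚ.∣ q ℚ.- r ∣
  triangle p q r = subst (λ t → ℚ.∣ t ∣ ℚ.≤ ℚ.∣ p ℚ.- q ∣ ℚ.+ ℚ.∣ q ℚ.- r ∣)
    (telescope p q r) (ℚ.∣p+q∣≤∣p∣+∣q∣ (p ℚ.- q) (q ℚ.- r))

  neg-flip : ∀ p q → p ℚ.- q ≡ ℚ.- (q ℚ.- p)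
  neg-flip p q = sym (begin
    ℚ.- (q ℚ.- p)           ≡⟨ ℚ.neg-distrib-+ q (ℚ.- p) ⟩
    ℚ.- q ℚ.+ ℚ.- (ℚ.- p)   ≡⟨ cong (ℚ.- q ℚ.+_) (⁻¹-involutive p) ⟩
    ℚ.- q ℚ.+ p             ≡⟨ ℚ.+-comm (ℚ.- q) p ⟩
    p ℚ.- q                 ∎)
    where
      open Relation.Binary.PropositionalEquality.≡-Reasoning
      open import Algebra.Properties.Group ℚ.+-0-group using (⁻¹-involutive)

  ∣p-q∣≡∣q-p∣ : ∀ p q → ℚ.∣ p ℚ.- q ∣ ≡ ℚ.∣ q ℚ.- p ∣
  ∣p-q∣≡∣q-p∣ p q = trans (cong ℚ.∣_∣ (neg-flip p q)) (ℚ.∣-p∣≡∣p∣ (q ℚ.- p))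

  ∣p-p∣≤ε : ∀ p {ε} → 0ℚ ℚ.< ε → ℚ.∣ p ℚ.- p ∣ ℚ.≤ ε
  ∣p-p∣≤ε p 0<ε rewrite ℚ.+-inverseʳ p = ℚ.<⇒≤ 0<ε

  half-positive : ∀ {ε} → 0ℚ ℚ.< ε → 0ℚ ℚ.< ½ ℚ.* ε
  half-positive {ε} 0<ε =
    ℚ.positive⁻¹ (½ ℚ.* ε) {{ℚ.pos*pos⇒pos ½ ε {{ℚ.positive 0<ε}}}}

  halves : ∀ ε → ½ ℚ.* ε ℚ.+ ½ ℚ.* ε ≡ ε
  halves ε = begin
    ½ ℚ.* ε ℚ.+ ½ ℚ.* ε   ≡⟨ sym (ℚ.*-distribʳ-+ ε ½ ½) ⟩
    (½ ℚ.+ ½) ℚ.* ε       ≡⟨ ℚ.*-identityˡ ε ⟩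
    ε                     ∎
    where open Relation.Binary.PropositionalEquality.≡-Reasoning

  *-mono-≤ : ∀ {p q r s} → 0ℚ ℚ.≤ r → 0ℚ ℚ.≤ q →
             p ℚ.≤ q → r ℚ.≤ s → p ℚ.* r ℚ.≤ q ℚ.* s
  *-mono-≤ {p} {q} {r} {s} 0≤r 0≤q p≤q r≤s = ℚ.≤-trans
    (ℚ.*-monoʳ-≤-nonNeg r {{ℚ.nonNegative 0≤r}} p≤q)
    (ℚ.*-monoˡ-≤-nonNeg q {{ℚ.nonNegative 0≤q}} r≤s)

  open import Algebra.Properties.CommutativeSemigroup
    (CommutativeMonoid.commutativeSemigroup ℚ.+-0-commutativeMonoid)
    using (interchange)

  sum-difference : ∀ a b c d →
    (a ℚ.- c) ℚ.+ (b ℚ.- d) ≡ (a ℚ.+ b) ℚ.- (c ℚ.+ d)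
  sum-difference a b c d = trans (interchange a (ℚ.- c) b (ℚ.- d))
    (cong ((a ℚ.+ b) ℚ.+_) (sym (ℚ.neg-distrib-+ c d)))

  sum-bound : ∀ a b c d {δ} → ℚ.∣ a ℚ.- c ∣ ℚ.≤ δ → ℚ.∣ b ℚ.- d ∣ ℚ.≤ δ →
              ℚ.∣ (a ℚ.+ b) ℚ.- (c ℚ.+ d) ∣ ℚ.≤ δ ℚ.+ δ
  sum-bound a b c d {δ} p q =
    subst (λ t → ℚ.∣ t ∣ ℚ.≤ δ ℚ.+ δ) (sum-difference a b c d)
      (ℚ.≤-trans (ℚ.∣p+q∣≤∣p∣+∣q∣ (a ℚ.- c) (b ℚ.- d)) (ℚ.+-mono-≤ p q))

  *-distribˡ-- : ∀ a b d → a ℚ.* (b ℚ.- d) ≡ a ℚ.* b ℚ.- a ℚ.* d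
  *-distribˡ-- a b d = trans (ℚ.*-distribˡ-+ a b (ℚ.- d))
    (cong (a ℚ.* b ℚ.+_) (sym (ℚ.neg-distribʳ-* a d)))

  *-distribʳ-- : ∀ a c d → (a ℚ.- c) ℚ.* d ≡ a ℚ.* d ℚ.- c ℚ.* d
  *-distribʳ-- a c d = trans (ℚ.*-distribʳ-+ d a (ℚ.- c))
    (cong (a ℚ.* d ℚ.+_) (sym (ℚ.neg-distribˡ-* c d)))

  product-difference : ∀ a b c d →
    a ℚ.* (b ℚ.- d) ℚ.+ (a ℚ.- c) ℚ.* d ≡ a ℚ.* b ℚ.- c ℚ.* d
  product-difference a b c d =
    trans (cong₂ ℚ._+_ (*-distribˡ-- a b d) (*-distribʳ-- a c d))
          (telescope (a ℚ.* b) (a ℚ.* d) (c ℚ.* d))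

  ∣*∣-bound : ∀ p q {B δ} → 0ℚ ℚ.< B → ℚ.∣ p ∣ ℚ.≤ B → ℚ.∣ q ∣ ℚ.≤ δ →
              ℚ.∣ p ℚ.* q ∣ ℚ.≤ B ℚ.* δ
  ∣*∣-bound p q {B} {δ} 0<B p≤B q≤δ =
    subst (ℚ._≤ B ℚ.* δ) (sym (ℚ.∣p*q∣≡∣p∣*∣q∣ p q))
      (*-mono-≤ (ℚ.0≤∣p∣ q) (ℚ.<⇒≤ 0<B) p≤B q≤δ)

  product-bound : ∀ a b c d {B C δ} → 0ℚ ℚ.< B → 0ℚ ℚ.< C →
    ℚ.∣ a ∣ ℚ.≤ B → ℚ.∣ d ∣ ℚ.≤ C →
    ℚ.∣ a ℚ.- c ∣ ℚ.≤ δ → ℚ.∣ b ℚ.- d ∣ ℚ.≤ δ →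
    ℚ.∣ a ℚ.* b ℚ.- c ℚ.* d ∣ ℚ.≤ B ℚ.* δ ℚ.+ C ℚ.* δ
  product-bound a b c d {B} {C} {δ} 0<B 0<C a≤B d≤C p q =
    subst (λ t → ℚ.∣ t ∣ ℚ.≤ B ℚ.* δ ℚ.+ C ℚ.* δ) (product-difference a b c d)
      (ℚ.≤-trans (ℚ.∣p+q∣≤∣p∣+∣q∣ (a ℚ.* (b ℚ.- d)) ((a ℚ.- c) ℚ.* d))
        (ℚ.+-mono-≤ (∣*∣-bound a (b ℚ.- d) 0<B a≤B q)
          (subst (λ t → ℚ.∣ t ∣ ℚ.≤ C ℚ.* δ) (ℚ.*-comm d (a ℚ.- c))
            (∣*∣-bound d (a ℚ.- c) 0<C d≤C p))))

  divide : ∀ D ε → 0ℚ ℚ.< D → 0ℚ ℚ.< ε → ∃[ δ ] (0ℚ ℚ.< δ × D ℚ.* δ ≡ ε)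
  divide D ε 0<D 0<ε = D⁻¹ ℚ.* ε
    , ℚ.positive⁻¹ (D⁻¹ ℚ.* ε)
        {{ℚ.pos*pos⇒pos D⁻¹ {{ℚ.1/pos⇒pos D {{D⁺}}}} ε {{ℚ.positive 0<ε}}}}
    , (begin
        D ℚ.* (D⁻¹ ℚ.* ε)   ≡⟨ sym (ℚ.*-assoc D D⁻¹ ε) ⟩
        D ℚ.* D⁻¹ ℚ.* ε     ≡⟨ cong (ℚ._* ε) (ℚ.*-inverseʳ D {{D≢0}}) ⟩
        1ℚ ℚ.* ε            ≡⟨ ℚ.*-identityˡ ε ⟩
        ε                   ∎)
    where
      open Relation.Binary.PropositionalEquality.≡-Reasoning
      D⁺ : ℚ.Positive D
      D⁺ = ℚ.positive 0<D
      D≢0 : ℚ.NonZero D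
      D≢0 = ℚ.pos⇒nonZero D {{D⁺}}
      D⁻¹ : ℚ
      D⁻¹ = (ℚ.1/ D) {{D≢0}}

-- Opaque, so that normalising the arithmetic of ℝ does not unfold proofs.
opaque
  bounded : ∀ x → ∃[ B ] (0ℚ ℚ.< B × Eventually (λ n → ℚ.∣ seq x n ∣ ℚ.≤ B))
  bounded x with cauchy x 1ℚ (ℚ.positive⁻¹ 1ℚ)
  ... | N , f = 1ℚ ℚ.+ ℚ.∣ seq x N ∣
    , ℚ.+-mono-<-≤ (ℚ.positive⁻¹ 1ℚ) (ℚ.0≤∣p∣ (seq x N))
    , N , λ n n≥ → near (seq x n) (seq x N) (f n N n≥ ℕ.≤-refl)
    where
      near : ∀ p q → ℚ.∣ p ℚ.- q ∣ ℚ.≤ 1ℚ → ℚ.∣ p ∣ ℚ.≤ 1ℚ ℚ.+ ℚ.∣ q ∣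
      near p q p-q≤1 = subst (λ t → ℚ.∣ t ∣ ℚ.≤ 1ℚ ℚ.+ ℚ.∣ q ∣) (-+-cancel p q)
        (ℚ.≤-trans (ℚ.∣p+q∣≤∣p∣+∣q∣ (p ℚ.- q) q)
                   (ℚ.+-monoˡ-≤ ℚ.∣ q ∣ p-q≤1))

  +-cauchy : ∀ x y → IsCauchy (λ n → seq x n ℚ.+ seq y n)
  +-cauchy x y ε 0<ε
    with cauchy x (½ ℚ.* ε) (half-positive 0<ε)
       | cauchy y (½ ℚ.* ε) (half-positive 0<ε)
  ... | M , f | N , g = M ℕ.⊔ N , λ m n m≥ n≥ →
    subst (ℚ.∣ (seq x m ℚ.+ seq y m) ℚ.- (seq x n ℚ.+ seq y n) ∣ ℚ.≤_) (halves ε)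
      (sum-bound (seq x m) (seq y m) (seq x n) (seq y n)
        (f m n (ℕ.m⊔n≤o⇒m≤o M N m≥) (ℕ.m⊔n≤o⇒m≤o M N n≥))
        (g m n (ℕ.m⊔n≤o⇒n≤o M N m≥) (ℕ.m⊔n≤o⇒n≤o M N n≥)))

  *-cauchy : ∀ x y → IsCauchy (λ n → seq x n ℚ.* seq y n)
  *-cauchy x y ε 0<ε with bounded x | bounded y
  ... | B , 0<B , K , p | C , 0<C , K′ , q
    with divide (B ℚ.+ C) ε (ℚ.+-mono-< 0<B 0<C) 0<ε
  ... | δ , 0<δ , Dδ≡ε with cauchy x δ 0<δ | cauchy y δ 0<δ
  ... | M , f | N , g = (K ℕ.⊔ K′) ℕ.⊔ (M ℕ.⊔ N) , λ m n m≥ n≥ →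
    subst (ℚ.∣ seq x m ℚ.* seq y m ℚ.- seq x n ℚ.* seq y n ∣ ℚ.≤_)
      (trans (sym (ℚ.*-distribʳ-+ δ B C)) Dδ≡ε)
      (product-bound (seq x m) (seq y m) (seq x n) (seq y n) 0<B 0<C
        (p m (ℕ.≤-trans K≤ m≥))
        (q n (ℕ.≤-trans K′≤ n≥))
        (f m n (ℕ.≤-trans M≤ m≥) (ℕ.≤-trans M≤ n≥))
        (g m n (ℕ.≤-trans N≤ m≥) (ℕ.≤-trans N≤ n≥)))
    where
      K≤ : K ℕ.≤ (K ℕ.⊔ K′) ℕ.⊔ (M ℕ.⊔ N)
      K≤ = ℕ.≤-trans (ℕ.m≤m⊔n K K′) (ℕ.m≤m⊔n (K ℕ.⊔ K′) (M ℕ.⊔ N))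
      K′≤ : K′ ℕ.≤ (K ℕ.⊔ K′) ℕ.⊔ (M ℕ.⊔ N)
      K′≤ = ℕ.≤-trans (ℕ.m≤n⊔m K K′) (ℕ.m≤m⊔n (K ℕ.⊔ K′) (M ℕ.⊔ N))
      M≤ : M ℕ.≤ (K ℕ.⊔ K′) ℕ.⊔ (M ℕ.⊔ N)
      M≤ = ℕ.≤-trans (ℕ.m≤m⊔n M N) (ℕ.m≤n⊔m (K ℕ.⊔ K′) (M ℕ.⊔ N))
      N≤ : N ℕ.≤ (K ℕ.⊔ K′) ℕ.⊔ (M ℕ.⊔ N)
      N≤ = ℕ.≤-trans (ℕ.m≤n⊔m M N) (ℕ.m≤n⊔m (K ℕ.⊔ K′) (M ℕ.⊔ N))

  constant-cauchy : ∀ q → IsCauchy (λ _ → q)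
  constant-cauchy q ε 0<ε = 0 , λ _ _ _ _ → ∣p-p∣≤ε q 0<ε

fromℚ : ℚ → ℝ
fromℚ q = mkℝ (λ _ → q) (constant-cauchy q)

fromℤ : ℤ → ℝ
fromℤ z = fromℚ (z ℚ./ 1)

0ℝ 1ℝ 3ℝ : ℝ
0ℝ = fromℤ (+ 0)
1ℝ = fromℤ (+ 1)
3ℝ = fromℤ (+ 3)

infixl 6 _+_
infixl 7 _*_

_+_ : ℝ → ℝ → ℝ
x + y = mkℝ (λ n → seq x n ℚ.+ seq y n) (+-cauchy x y)

_*_ : ℝ → ℝ → ℝ
x * y = mkℝ (λ n → seq x n ℚ.* seq y n) (*-cauchy x y)

≈-refl : ∀ {x} → x ≈ x
≈-refl {x} ε 0<ε = 0 , λ n _ → ∣p-p∣≤ε (seq x n) 0<ε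

≈-sym : ∀ {x y} → x ≈ y → y ≈ x
≈-sym {x} {y} x≈y ε 0<ε with N , f ← x≈y ε 0<ε
  = N , λ n n≥ → subst (ℚ._≤ ε) (∣p-q∣≡∣q-p∣ (seq x n) (seq y n)) (f n n≥)

≈-trans : ∀ {x y z} → x ≈ y → y ≈ z → x ≈ z
≈-trans {x} {y} {z} x≈y y≈z ε 0<ε
  with M , f ← x≈y (½ ℚ.* ε) (half-positive 0<ε)
     | N , g ← y≈z (½ ℚ.* ε) (half-positive 0<ε)
  = M ℕ.⊔ N , λ n n≥ → ℚ.≤-trans (triangle (seq x n) (seq y n) (seq z n))
      (subst (_ ℚ.≤_) (halves ε) (ℚ.+-mono-≤
        (f n (ℕ.≤-trans (ℕ.m≤m⊔n M N) n≥))
        (g n (ℕ.≤-trans (ℕ.m≤n⊔m M N) n≥))))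

ℝ-setoid : Setoid 0ℓ 0ℓ
ℝ-setoid = record
  { Carrier       = ℝ
  ; _≈_           = _≈_
  ; isEquivalence = record
    { refl  = λ {x} → ≈-refl {x}
    ; sym   = λ {x} {y} → ≈-sym {x} {y}
    ; trans = λ {x} {y} {z} → ≈-trans {x} {y} {z}
    }
  }

------------------------------------------------------------------------
-- Euclidean space

open VecEq ℝ-setoid public using (_≋_; ≋-setoid)

infixl 6 _+ᵛ_
infixl 7 _*ᵛ_

0ᵛ : ∀ {n} → Vector ℝ n
0ᵛ = replicate _ 0ℝ

_+ᵛ_ : ∀ {n} → Vector ℝ n → Vector ℝ n → Vector ℝ n
_+ᵛ_ = zipWith _+_

_*ᵛ_ : ∀ {n} → ℝ → Vector ℝ n → Vector ℝ n
c *ᵛ v = map (c *_) v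

⟨_,_⟩ : ∀ {n} → Vector ℝ n → Vector ℝ n → ℝ
⟨ u , v ⟩ = foldr _+_ 0ℝ (zipWith _*_ u v)

-- The linear span of S with scalars drawn from the image of ι: the subgroup
-- generated by S when ι embeds ℤ in ℝ, the real span when ι is the identity.
data Span {K : Set} (ι : K → ℝ) {n} (S : Pred (Vector ℝ n) 0ℓ) :
          Pred (Vector ℝ n) 0ℓ where
  generator : ∀ {v} → v ∈ S → v ∈ Span ι S
  zeroᵛ     : 0ᵛ ∈ Span ι S
  add       : ∀ {u v} → u ∈ Span ι S → v ∈ Span ι S → u +ᵛ v ∈ Span ι S
  scale     : ∀ k {v} → v ∈ Span ι S → ι k *ᵛ v ∈ Span ι S
  resp      : ∀ {u v} → u ≋ v → u ∈ Span ι S → v ∈ Span ι S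

-- Subsets of ℝⁿ, where vectors are identified up to _≋_.
record Subset (n : ℕ) : Set₁ where
  field
    member   : Pred (Vector ℝ n) 0ℓ
    respects : member Respects _≋_

open Subset public

elements : ∀ {n} → Subset n → Setoid 0ℓ 0ℓ
elements {n} ω = record
  { Carrier       = Σ (Vector ℝ n) (member ω)
  ; _≈_           = λ u v → proj₁ u ≋ proj₁ v
  ; isEquivalence = On.isEquivalence proj₁ (Setoid.isEquivalence (≋-setoid n))
  }

infix 4 _≺_ _⊊_

-- ω has strictly smaller cardinality than ω′; neither is assumed finite.
_≺_ : ∀ {n} → Subset n → Subset n → Set
ω ≺ ω′ = Injection (elements ω) (elements ω′)
       × ¬ Injection (elements ω′) (elements ω)

_⊊_ : ∀ {n} → Subset n → Subset n → Set
ω ⊊ ω′ = (member ω ⊆ member ω′) × (∃[ v ] (v ∈ member ω′ × v ∉ member ω))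

------------------------------------------------------------------------
-- Affine equiangular sets with norm 3 with respect to ρ

record IsAffineEquiangular {n} (ρ : Vector ℝ n) (ω : Subset n) : Set where
  field
    root  : ∀ {u} → u ∈ member ω → ⟨ u , ρ ⟩ ≈ 1ℝ
    norm  : ∀ {u} → u ∈ member ω → ⟨ u , u ⟩ ≈ 3ℝ
    inner : ∀ {u v} → u ∈ member ω → v ∈ member ω → ¬ (u ≋ v) →
            ⟨ u , v ⟩ ≈ 0ℝ ⊎ ⟨ u , v ⟩ ≈ 1ℝ

record IsAffineEquiangularIn {n} (ρ : Vector ℝ n) (V : Pred (Vector ℝ n) 0ℓ)
                             (ω : Subset n) : Set where
  field
    isAffineEquiangular : IsAffineEquiangular ρ ω
    contained           : member ω ⊆ V

IsMaximumIn : ∀ {n} → Vector ℝ n → Pred (Vector ℝ n) 0ℓ → Subset n → Set₁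
IsMaximumIn ρ V ω = IsAffineEquiangularIn ρ V ω
                  × (∀ ω′ → IsAffineEquiangularIn ρ V ω′ → ¬ (ω ≺ ω′))

IsMaximalIn : ∀ {n} → Vector ℝ n → Pred (Vector ℝ n) 0ℓ → Subset n → Set₁
IsMaximalIn ρ V ω = IsAffineEquiangularIn ρ V ω
                  × (∀ ω′ → IsAffineEquiangularIn ρ V ω′ → ¬ (ω ⊊ ω′))

------------------------------------------------------------------------
-- The lattice

A : ∀ n → Pred (Vector ℤ (n ℕ.+ 1)) 0ℓ
A n x = foldr ℤ._+_ 0ℤ x ≡ 0ℤ

α : ∀ n → Vector ℚ (n ℕ.+ 1)
α n = replicate n (+ 1 ℚ./ suc n) ++ (ℚ.- (+ n ℚ./ suc n) ∷ [])

-- The orthogonal direct sum A₅³ ⊕ A₁⁴ inside ℝ²⁶.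
Λ : Pred (Vector ℝ 26) 0ℓ
Λ v = ∃[ x₁ ] ∃[ x₂ ] ∃[ x₃ ] ∃[ y₁ ] ∃[ y₂ ] ∃[ y₃ ] ∃[ y₄ ]
      (x₁ ∈ A 5 × x₂ ∈ A 5 × x₃ ∈ A 5 ×
       y₁ ∈ A 1 × y₂ ∈ A 1 × y₃ ∈ A 1 × y₄ ∈ A 1 ×
       v ≋ map fromℤ (x₁ ++ x₂ ++ x₃ ++ y₁ ++ y₂ ++ y₃ ++ y₄))

α₅ 3α₅ 0₅ : Vector ℚ 6
α₅  = α 5
3α₅ = map (+ 3 ℚ./ 1 ℚ.*_) α₅
0₅  = replicate 6 0ℚ

α₁ 2α₁ 0₁ : Vector ℚ 2
α₁  = α 1
2α₁ = map (+ 2 ℚ./ 1 ℚ.*_) α₁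
0₁  = replicate 2 0ℚ

β : Fin 4 → Vector ℚ 26
β 0F = α₅  ++ α₅  ++ α₅  ++ 0₁ ++ 0₁ ++ 0₁ ++ α₁
β 1F = 3α₅ ++ 0₅  ++ 0₅  ++ 0₁ ++ α₁ ++ α₁ ++ α₁
β 2F = 0₅  ++ 3α₅ ++ 0₅  ++ α₁ ++ 0₁ ++ α₁ ++ α₁
β 3F = 0₅  ++ 0₅  ++ 3α₅ ++ α₁ ++ α₁ ++ 0₁ ++ α₁

ρ : Vector ℝ 26
ρ = map fromℚ (0₅ ++ 0₅ ++ 0₅ ++ 0₁ ++ 0₁ ++ 0₁ ++ 2α₁)

L : Pred (Vector ℝ 26) 0ℓ
L = Span fromℤ (Λ ∪ (λ v → ∃[ j ] v ≋ map fromℚ (β j)))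

ℝL : Pred (Vector ℝ 26) 0ℓ
ℝL = Span id L

module Submission where

-- Scale by 6. The vectors of L of norm 3 with (u, ρ) = 1 are "triples" (three positions in Fin 6 and
-- a sign) and, for each j, "cuts" (a balanced ±1 vector x in block j and two signs). Triples are
-- compatible when they agree in at most one position, and vectors of different kinds always are. So
-- a maximum set contains 36 triples, which form a Latin square, and 7 cuts for each j.
--
-- Let v in ℝL be admissible, with blocks M and pair entries C (suitably scaled). Along the Latin
-- square M₀ i + M₁ j + M₂ l = ±3, so summing over rows and columns makes M integral and gives
-- Σ M² = 54; then Σ C² = 72. Seven cuts of one type fall, after normalising signs, into two classes of
-- vectors with pairwise products ≤ -2: four with sum 0 and at least three more. The four give
-- Y ∈ {0, ±6} for one of C ± C′; the three, completed to four with sum 0 by a balanced s, give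
-- s · M = 6 ε for an integer ε depending on the other one. By Cauchy-Schwarz Σ ε² ≤ 9, while a
-- finite search shows Σ ε² ≥ 9; hence M = ε s blockwise, and v is itself a cut, that is, v lies in
-- L, contradicting maximality of the cardinality.

open import Algebra.Bundles using (CommutativeRing)
import Algebra.Properties.AbelianGroup
import Algebra.Properties.Ring
import Algebra.Properties.Semiring.Sum
import Algebra.Solver.Ring
import Algebra.Solver.Ring.AlmostCommutativeRing as ACR
open import Data.Bool.Base using (Bool; true; false; if_then_else_; not)
import Data.Bool.Properties as Bool
open import Data.Empty using (⊥)
open import Data.Fin.Base as Fin
  using (Fin; zero; suc; punchIn; punchOut; combine; toℕ; fromℕ<; inject≤; _↑ˡ_; _↑ʳ_; splitAt; join)
open import Data.Fin.Patterns using (0F; 1F; 2F; 3F; 4F; 5F; 6F; 7F; 8F)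
import Data.Fin.Permutation as Perm
open import Data.Fin.Properties as Fin using (all?)
open import Data.Integer.Base as ℤ using (ℤ; +_; -[1+_]; 0ℤ)
import Data.Integer.Properties as ℤ
open import Data.Integer.Tactic.RingSolver using (solve-∀)
open import Data.List.Base as List using (List; length; []; _∷_)
open import Data.List.Membership.Propositional using () renaming (_∈_ to _∈ˡ_)
open import Data.List.Membership.Propositional.Properties
  using (∈-lookup; ∈-filter⁻; ∈-allFin; ∈-cartesianProductWith⁺; ∈-++⁺ˡ; ∈-++⁺ʳ)
import Data.List.Properties as List
open import Data.List.Relation.Unary.All as All using (All; []; _∷_)
import Data.List.Relation.Unary.All.Properties as All
open import Data.List.Relation.Unary.AllPairs as AllPairs using (AllPairs; []; _∷_)
import Data.List.Relation.Unary.AllPairs.Properties as AllPairs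
open import Data.List.Relation.Unary.Any using (here; there)
open import Data.Maybe.Base as Maybe using ()
open import Data.Nat.Base as ℕ using (ℕ; zero; suc; s≤s; z≤n)
open import Data.Nat.Divisibility using (_∣?_; divides) renaming (_∣_ to _∣ℕ_)
open import Data.Nat.DivMod using (_mod_)
import Data.Nat.Properties as ℕ
open import Data.Product.Base using (Σ; ∃-syntax; _×_; _,_; proj₁; proj₂)
open import Data.Rational.Base as ℚ using (ℚ; 0ℚ; 1ℚ; ½)
import Data.Rational.Properties as ℚ
open import Data.Rational.Solver using (module +-*-Solver)
import Data.Rational.Unnormalised.Base as ℚᵘ
import Data.Rational.Unnormalised.Properties as ℚᵘ
open import Data.Sum.Base as Sum using (_⊎_; inj₁; inj₂)
open import Data.Unit.Base using (⊤; tt)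
open import Data.Vec.Base as Vec using (Vec)
open import Data.Vec.Functional as F using (Vector)
import Data.Vec.Functional.Properties as F
import Data.Vec.Properties as Vec
open import Function.Base using (id; _∘_)
open import Function.Bundles using (Injection)
open import Level using (0ℓ)
open import Relation.Binary.PropositionalEquality
  using (_≡_; _≢_; refl; sym; trans; cong; cong₂; subst; module ≡-Reasoning)
open import Relation.Nullary.Decidable
  using (Dec; yes; no; map′; from-yes; from-no; dec⇒maybe; ¬?; _→-dec_; _⊎-dec_; _×-dec_; ¬¬-excluded-middle)
open import Relation.Nullary.Negation using (¬_; contradiction)
open import Relation.Unary using (Pred; Decidable; _∈_)

-- The cardinality of a maximum set enters through one inequality: no list of pairwise compatible
-- indices is longer than a listing of the set. Indices of different kinds are always compatible, so
-- the members of one kind can be traded for an explicit clique of that kind; 36 and 7 are the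
-- lengths of such cliques and enter as lower bounds. The obstacle is that `v` is only a real vector
-- in the span: its arithmetic has to be extracted from inner products. The triples yield
-- divisibility by 6, the balanced vectors parity, and only after both is the question one about
-- integers, and finite. Maximality does not determine the seven cuts, so only what any seven of
-- them reveal is kept, in `Shadow`. Scaling makes the conditions integral: an inner product in {0,
-- 1} becomes a pairing equal to ±18, and the norm 3 becomes 2 Σ M² + Σ C² = 72 · 3 - 36 = 180,
-- whence 72 from 54. Membership in the given set is undecidable, but what has to be shown ends in a
-- negation, so listing the set under a double negation is enough.

module Indices where

  -- Indices and their integer coordinates

  sgn : Bool → ℤ
  sgn true  = + 1
  sgn false = ℤ.- + 1

  -- The vectors u of L with (u, u) = 3 and (u, ρ) = 1, scaled by 6: a triple is
  -- ±(1 - 6 eᵢ, 1 - 6 eⱼ, 1 - 6 eₗ; 0, 0, 0), a cut has a balanced sign vector times 3 in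
  -- block j and ±(3, -3) in the two of v₄, v₅, v₆ other than the j-th; v₇ is (3, -3) throughout.
  data Index : Set where
    triple : Bool → (row column symbol : Fin 6) → Index
    cut    : Fin 3 → Vec Bool 6 → (y z : Bool) → Index

  unit : ∀ {n} → Fin n → Fin n → ℤ
  unit zero    zero    = + 1
  unit zero    (suc _) = 0ℤ
  unit (suc _) zero    = 0ℤ
  unit (suc i) (suc k) = unit i k

  signs : Vec Bool 6 → Vector ℤ 6
  signs x k = sgn (Vec.lookup x k)

  blocks : Index → Fin 3 → Vector ℤ 6
  blocks (triple σ i j l) h k = sgn σ ℤ.* (+ 1 ℤ.+ ℤ.- (+ 6) ℤ.* unit ((i F.∷ j F.∷ l F.∷ F.[]) h) k)
  blocks (cut j x y z)        = F.insertAt {n = 2} (λ _ _ → 0ℤ) j (λ k → + 3 ℤ.* signs x k)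

  pairs : Index → Fin 3 → ℤ
  pairs (triple _ _ _ _) _ = 0ℤ
  pairs (cut j _ y z)      = F.insertAt (sgn y F.∷ sgn z F.∷ F.[]) j 0ℤ

  -- To be instantiated with ℝ and with ℤ itself.
  record ℤ-Algebra : Set₁ where
    field
      commutativeRing : CommutativeRing 0ℓ 0ℓ
    open CommutativeRing commutativeRing public hiding (zero)
    field
      ι      : ℤ → Carrier
      ι-+    : ∀ a b → ι (a ℤ.+ b) ≈ ι a + ι b
      ι-*    : ∀ a b → ι (a ℤ.* b) ≈ ι a * ι b
      ι-neg  : ∀ a → ι (ℤ.- a) ≈ CommutativeRing.-_ commutativeRing (ι a)
      ι-0    : ι 0ℤ ≈ 0#
      ι-1    : ι (+ 1) ≈ 1#
      ι-injective : ∀ {a b} → ι a ≈ ι b → a ≡ b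
      -- The shift by one excludes the factor 0: `ι-cancel 5` cancels 6, `ι-cancel 35` cancels 36.
      ι-cancel    : ∀ n {x y} → ι (+ suc n) * x ≈ ι (+ suc n) * y → x ≈ y

  module Notation (𝔸 : ℤ-Algebra) where
    open ℤ-Algebra 𝔸 public
      using (Carrier; _≈_; ι; ι-+; ι-*; ι-neg; ι-0; ι-injective; ι-cancel; 0#)
      renaming ( _+_ to _⊕_; _*_ to _⊗_; refl to ≈-refl; sym to ≈-sym; trans to ≈-trans; reflexive to ≈-reflexive
               ; +-cong to ⊕-cong; +-congˡ to ⊕-congˡ; +-congʳ to ⊕-congʳ; +-assoc to ⊕-assoc
               ; +-identityˡ to ⊕-identityˡ; +-identityʳ to ⊕-identityʳ; *-cong to ⊗-cong; *-congˡ to ⊗-congˡ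
               ; *-congʳ to ⊗-congʳ; zeroʳ to ⊗-zeroʳ; distribˡ to ⊗-distribˡ )

  ℤ-algebra : ℤ-Algebra
  ℤ-algebra = record
    { commutativeRing = ℤ.+-*-commutativeRing
    ; ι = id
    ; ι-+ = λ _ _ → refl
    ; ι-* = λ _ _ → refl
    ; ι-neg = λ _ → refl
    ; ι-0 = refl
    ; ι-1 = refl
    ; ι-injective = id
    ; ι-cancel = λ n → ℤ.*-cancelˡ-≡ (+ suc n) _ _
    }

  -- The scaled inner product with an index, over any ℤ-algebra

  module Pairing (𝔸 : ℤ-Algebra) where
    open ℤ-Algebra 𝔸 renaming (refl to ≈-refl; sym to ≈-sym; trans to ≈-trans; reflexive to ≈-reflexive)
    open Algebra.Properties.Semiring.Sum semiring public
    open import Relation.Binary.Reasoning.Setoid setoid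

    private
      -- Integer literals in solver equations are read as images under `ι`; a bare `0#` is therefore
      -- rewritten as `ι 0ℤ` wherever the solver has to see it.
      ι-morphism : CommutativeRing.rawRing ℤ.+-*-commutativeRing ACR.-Raw-AlmostCommutative⟶ ACR.fromCommutativeRing commutativeRing
      ι-morphism = record { ⟦_⟧ = ι ; +-homo = ι-+ ; *-homo = ι-* ; -‿homo = ι-neg ; 0-homo = ι-0 ; 1-homo = ι-1 }

      ι-decide : ∀ a b → Maybe.Maybe (ι a ≈ ι b)
      ι-decide a b = Maybe.map (λ a≡b → ≈-reflexive (cong ι a≡b)) (dec⇒maybe (a ℤ.≟ b))

    module Solver = Algebra.Solver.Ring (CommutativeRing.rawRing ℤ.+-*-commutativeRing)
      (ACR.fromCommutativeRing commutativeRing) ι-morphism ι-decide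
    open Solver using (solve; con; _:=_; _:+_; _:*_)

    dotι : ∀ {n} → Vector Carrier n → Vector ℤ n → Carrier
    dotι P u = sum (λ k → P k * ι (u k))

    -- For `P` six times the blocks of v and `g` twelve times the first entries of its pairs, this
    -- is 36 times the inner product with the indexed vector, less the 18 that v₇ contributes
    -- (`inner-index`). A pair 3 (a, -a) against 6 (v₀, -v₀) gives 36 a v₀ = 3 · (12 v₀) a, hence
    -- the factor 3.
    pairing : (Fin 3 → Vector Carrier 6) → Vector Carrier 3 → Index → Carrier
    pairing P g i = sum (λ j → dotι (P j) (blocks i j)) + ι (+ 3) * dotι g (pairs i)

    dotι-0 : ∀ {n} (P : Vector Carrier n) → dotι P (λ _ → 0ℤ) ≈ 0#
    dotι-0 {n} P = ≈-trans (sum-cong-≋ {n} (λ k → ≈-trans (*-congˡ ι-0) (zeroʳ (P k)))) (sum-replicate-zero n)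

    dotι-scale : ∀ {n} c (P : Vector Carrier n) u → dotι P (λ k → c ℤ.* u k) ≈ ι c * dotι P u
    dotι-scale {n} c P u = ≈-trans
      (sum-cong-≋ {n} (λ k → ≈-trans (*-congˡ (ι-* c (u k)))
        (solve 3 (λ c p u → p :* (c :* u) := c :* (p :* u)) ≈-refl (ι c) (P k) (ι (u k)))))
      (≈-sym (*-distribˡ-sum (ι c) (λ k → P k * ι (u k))))

    dotι-unit : ∀ {n} (P : Vector Carrier n) i → dotι P (unit i) ≈ P i
    dotι-unit {suc n} P zero = begin
      P zero * ι (+ 1) + dotι (P ∘ suc) (λ _ → 0ℤ) ≈⟨ +-cong (*-congˡ ι-1) (dotι-0 (P ∘ suc)) ⟩
      P zero * 1# + 0#                             ≈⟨ +-identityʳ _ ⟩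
      P zero * 1#                                  ≈⟨ *-identityʳ _ ⟩
      P zero                                       ∎
    dotι-unit {suc n} P (suc i) = begin
      P zero * ι 0ℤ + dotι (P ∘ suc) (unit i) ≈⟨ +-cong (*-congˡ ι-0) (dotι-unit (P ∘ suc) i) ⟩
      P zero * 0# + P (suc i)                 ≈⟨ +-congʳ (zeroʳ (P zero)) ⟩
      0# + P (suc i)                          ≈⟨ +-identityˡ _ ⟩
      P (suc i)                               ∎

    -- The constant part of 1 - 6 eᵢ pairs to 0 because `P` sums to 0; only the entry at i survives.
    dotι-corner : ∀ {n} σ (P : Vector Carrier n) i → sum P ≈ 0# →
      dotι P (λ k → sgn σ ℤ.* (+ 1 ℤ.+ ℤ.- (+ 6) ℤ.* unit i k)) ≈ ι (ℤ.- (+ 6) ℤ.* sgn σ) * P i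
    dotι-corner {n} σ P i ΣP≈0 = begin
      dotι P (λ k → sgn σ ℤ.* (+ 1 ℤ.+ ℤ.- (+ 6) ℤ.* unit i k))
        ≈⟨ sum-cong-≋ {n} (λ k → term (P k) (unit i k)) ⟩
      sum (λ k → ι (sgn σ) * P k + c * (P k * ι (unit i k)))
        ≈⟨ ∑-distrib-+ (λ k → ι (sgn σ) * P k) (λ k → c * (P k * ι (unit i k))) ⟩
      sum (λ k → ι (sgn σ) * P k) + sum (λ k → c * (P k * ι (unit i k)))
        ≈⟨ +-cong (*-distribˡ-sum (ι (sgn σ)) P) (*-distribˡ-sum c (λ k → P k * ι (unit i k))) ⟨
      ι (sgn σ) * sum P + c * dotι P (unit i)
        ≈⟨ +-cong (≈-trans (*-congˡ ΣP≈0) (zeroʳ _)) (*-congˡ (dotι-unit P i)) ⟩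
      0# + c * P i
        ≈⟨ +-identityˡ _ ⟩
      c * P i ∎
      where
      c = ι (ℤ.- (+ 6) ℤ.* sgn σ)
      term : ∀ p u → p * ι (sgn σ ℤ.* (+ 1 ℤ.+ ℤ.- (+ 6) ℤ.* u)) ≈ ι (sgn σ) * p + c * (p * ι u)
      term p u = begin
        p * ι (sgn σ ℤ.* (+ 1 ℤ.+ ℤ.- (+ 6) ℤ.* u))
          ≈⟨ *-congˡ (≈-trans (ι-* _ _) (*-congˡ (≈-trans (ι-+ _ _) (+-congˡ (ι-* _ _))))) ⟩
        p * (ι (sgn σ) * (ι (+ 1) + ι (ℤ.- (+ 6)) * ι u))
          ≈⟨ solve 3 (λ p s u → p :* (s :* (con (+ 1) :+ con (ℤ.- (+ 6)) :* u)) := s :* p :+ con (ℤ.- (+ 6)) :* s :* (p :* u)) ≈-refl p (ι (sgn σ)) (ι u) ⟩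
        ι (sgn σ) * p + ι (ℤ.- (+ 6)) * ι (sgn σ) * (p * ι u)
          ≈⟨ +-congˡ (*-congʳ (ι-* (ℤ.- (+ 6)) (sgn σ))) ⟨
        ι (sgn σ) * p + c * (p * ι u) ∎

    pairing-triple : ∀ P g σ i j l → (∀ h → sum (P h) ≈ 0#) →
      pairing P g (triple σ i j l) ≈ ι (ℤ.- (+ 6) ℤ.* sgn σ) * (P 0F i + (P 1F j + P 2F l))
    pairing-triple P g σ i j l ΣP≈0 = begin
      pairing P g (triple σ i j l)
        ≈⟨ +-cong (+-cong (dotι-corner σ (P 0F) i (ΣP≈0 0F)) (+-cong (dotι-corner σ (P 1F) j (ΣP≈0 1F))
           (+-congʳ (dotι-corner σ (P 2F) l (ΣP≈0 2F))))) (*-congˡ (dotι-0 g)) ⟩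
      (c * P 0F i + (c * P 1F j + (c * P 2F l + 0#))) + ι (+ 3) * 0#
        ≈⟨ +-congˡ (zeroʳ _) ⟩
      (c * P 0F i + (c * P 1F j + (c * P 2F l + 0#))) + 0#
        ≈⟨ +-identityʳ _ ⟩
      c * P 0F i + (c * P 1F j + (c * P 2F l + 0#))
        ≈⟨ +-congˡ (+-congˡ (+-identityʳ _)) ⟩
      c * P 0F i + (c * P 1F j + c * P 2F l)
        ≈⟨ +-congˡ (distribˡ c _ _) ⟨
      c * P 0F i + c * (P 1F j + P 2F l)
        ≈⟨ distribˡ c _ _ ⟨
      c * (P 0F i + (P 1F j + P 2F l)) ∎
      where c = ι (ℤ.- (+ 6) ℤ.* sgn σ)

    -- Stated for an arbitrary `f`, since in `pairing-cut` the inserted value is once a block vector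
    -- and once a pair entry. The case split on `j` makes `F.insertAt` compute.
    sum-insert : ∀ {a} {A : Set a} (f : Fin 3 → A → Carrier) (o : Fin 2 → A) j (x : A) →
      sum (λ h → f h (F.insertAt o j x h)) ≈ f j x + (f (punchIn j 0F) (o 0F) + f (punchIn j 1F) (o 1F))
    sum-insert f o 0F x = +-congˡ (+-congˡ (+-identityʳ _))
    sum-insert f o 1F x = begin
      a + (b + (c + 0#)) ≈⟨ +-congˡ (+-congˡ (+-identityʳ c)) ⟩
      a + (b + c)        ≈⟨ solve 3 (λ a b c → a :+ (b :+ c) := b :+ (a :+ c)) ≈-refl a b c ⟩
      b + (a + c)        ∎
      where a = f 0F (o 0F) ; b = f 1F x ; c = f 2F (o 1F)
    sum-insert f o 2F x = begin
      a + (b + (c + 0#)) ≈⟨ +-congˡ (+-congˡ (+-identityʳ c)) ⟩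
      a + (b + c)        ≈⟨ solve 3 (λ a b c → a :+ (b :+ c) := c :+ (a :+ b)) ≈-refl a b c ⟩
      c + (a + b)        ∎
      where a = f 0F (o 0F) ; b = f 1F (o 1F) ; c = f 2F x

    pairing-cut : ∀ P g j x y z → pairing P g (cut j x y z) ≈
      ι (+ 3) * (dotι (P j) (signs x) + (g (punchIn j 0F) * ι (sgn y) + g (punchIn j 1F) * ι (sgn z)))
    pairing-cut P g j x y z = begin
      pairing P g (cut j x y z)
        ≈⟨ +-cong (sum-insert (λ h u → dotι (P h) u) (λ _ _ → 0ℤ) j (λ k → + 3 ℤ.* signs x k))
             (*-congˡ (sum-insert (λ h u → g h * ι u) (sgn y F.∷ sgn z F.∷ F.[]) j 0ℤ)) ⟩
      (dotι (P j) (λ k → + 3 ℤ.* signs x k) + (dotι (P h) (λ _ → 0ℤ) + dotι (P h′) (λ _ → 0ℤ)))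
        + ι (+ 3) * (g j * ι 0ℤ + w)
        ≈⟨ +-cong (+-cong (dotι-scale (+ 3) (P j) (signs x)) (+-cong (dotι-0 (P h)) (dotι-0 (P h′)))) ≈-refl ⟩
      (ι (+ 3) * d + (0# + 0#)) + ι (+ 3) * (g j * ι 0ℤ + w)
        ≈⟨ +-congʳ (+-congˡ (+-cong (≈-sym ι-0) (≈-sym ι-0))) ⟩
      (ι (+ 3) * d + (ι 0ℤ + ι 0ℤ)) + ι (+ 3) * (g j * ι 0ℤ + w)
        ≈⟨ solve 3 (λ d w g → (con (+ 3) :* d :+ (con 0ℤ :+ con 0ℤ)) :+ con (+ 3) :* (g :* con 0ℤ :+ w)
             := con (+ 3) :* (d :+ w)) ≈-refl d w (g j) ⟩
      ι (+ 3) * (d + w) ∎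
      where
      h = punchIn j 0F ; h′ = punchIn j 1F
      d = dotι (P j) (signs x)
      w = g h * ι (sgn y) + g h′ * ι (sgn z)

module Integral where

  open Indices
  open import Data.Integer.Base hiding (suc; _⊖_)
  open import Data.Integer.Properties
  open import Data.Integer.DivMod using (a≡a%ℕn+[a/ℕn]*n; n%ℕd<d; _%ℕ_; _/ℕ_)
  open import Algebra.Properties.Semiring.Sum +-*-semiring
    using (sum; sum-cong-≗; ∑-distrib-+; ∑-comm; *-distribˡ-sum; sum-replicate-zero)
  open import Algebra.Properties.AbelianGroup +-0-abelianGroup using () renaming (∙-cancelˡ to +-cancelˡ)

  -- Integer dot products and sums of nonnegative terms

  dot : ∀ {n} → Vector ℤ n → Vector ℤ n → ℤ
  dot u v = sum (λ k → u k * v k)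

  dot-comm : ∀ {n} (u v : Vector ℤ n) → dot u v ≡ dot v u
  dot-comm u v = sum-cong-≗ (λ k → *-comm (u k) (v k))

  dot-+ˡ : ∀ {n} (u v w : Vector ℤ n) → dot (λ k → u k + v k) w ≡ dot u w + dot v w
  dot-+ˡ u v w = trans (sum-cong-≗ (λ k → *-distribʳ-+ (w k) (u k) (v k)))
    (∑-distrib-+ (λ k → u k * w k) (λ k → v k * w k))

  dot-*ˡ : ∀ {n} c (u w : Vector ℤ n) → dot (λ k → c * u k) w ≡ c * dot u w
  dot-*ˡ c u w = trans (sum-cong-≗ (λ k → *-assoc c (u k) (w k)))
    (sym (*-distribˡ-sum c (λ k → u k * w k)))

  dot-congˡ : ∀ {n} {u v : Vector ℤ n} w → (∀ k → u k ≡ v k) → dot u w ≡ dot v w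
  dot-congˡ w u≗v = sum-cong-≗ (λ k → cong (_* w k) (u≗v k))

  dot-0ˡ : ∀ {n} (w : Vector ℤ n) → dot (λ _ → 0ℤ) w ≡ 0ℤ
  dot-0ˡ {n} w = sum-replicate-zero n

  square-+ : ∀ {n} (u v : Vector ℤ n) →
    dot (λ k → u k + v k) (λ k → u k + v k) ≡ dot u u + + 2 * dot u v + dot v v
  square-+ u v = begin
    dot (λ k → u k + v k) (λ k → u k + v k)
      ≡⟨ dot-+ˡ u v _ ⟩
    dot u (λ k → u k + v k) + dot v (λ k → u k + v k)
      ≡⟨ cong₂ _+_ (trans (dot-comm u _) (dot-+ˡ u v u)) (trans (dot-comm v _) (dot-+ˡ u v v)) ⟩
    (dot u u + dot v u) + (dot u v + dot v v)
      ≡⟨ cong (λ t → (dot u u + t) + (dot u v + dot v v)) (dot-comm v u) ⟩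
    (dot u u + dot u v) + (dot u v + dot v v)
      ≡⟨ regroup (dot u u) (dot u v) (dot v v) ⟩
    dot u u + + 2 * dot u v + dot v v ∎
    where
    open ≡-Reasoning
    regroup : ∀ a b c → (a + b) + (b + c) ≡ a + + 2 * b + c
    regroup = solve-∀

  0≤i*i : ∀ i → 0ℤ ≤ i * i
  0≤i*i (+ n)      = subst (0ℤ ≤_) (pos-* n n) (+≤+ z≤n)
  0≤i*i (-[1+ n ]) = +≤+ z≤n

  sum-nonneg : ∀ {n} (f : Vector ℤ n) → (∀ k → 0ℤ ≤ f k) → 0ℤ ≤ sum f
  sum-nonneg {zero}  f 0≤f = ≤-refl
  sum-nonneg {suc n} f 0≤f = +-mono-≤ (0≤f zero) (sum-nonneg (f ∘ suc) (0≤f ∘ suc))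

  +-nonneg-zero : ∀ {a b} → 0ℤ ≤ a → 0ℤ ≤ b → a + b ≤ 0ℤ → a ≡ 0ℤ × b ≡ 0ℤ
  +-nonneg-zero {a} {b} 0≤a 0≤b a+b≤0 =
      ≤-antisym (≤-trans (subst (_≤ a + b) (+-identityʳ a) (+-monoʳ-≤ a 0≤b)) a+b≤0) 0≤a
    , ≤-antisym (≤-trans (subst (_≤ a + b) (+-identityˡ b) (+-monoˡ-≤ b 0≤a)) a+b≤0) 0≤b

  sum-nonneg-zero : ∀ {n} (f : Vector ℤ n) → (∀ k → 0ℤ ≤ f k) → sum f ≤ 0ℤ → ∀ k → f k ≡ 0ℤ
  sum-nonneg-zero {suc n} f 0≤f ≤0 k
    with +-nonneg-zero (0≤f zero) (sum-nonneg (f ∘ suc) (0≤f ∘ suc)) ≤0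
  sum-nonneg-zero {suc n} f 0≤f ≤0 zero    | f₀≡0 , _ = f₀≡0
  sum-nonneg-zero {suc n} f 0≤f ≤0 (suc k) | _ , rest≡0 =
    sum-nonneg-zero (f ∘ suc) (0≤f ∘ suc) (≤-reflexive rest≡0) k

  i*i≡0⇒i≡0 : ∀ i → i * i ≡ 0ℤ → i ≡ 0ℤ
  i*i≡0⇒i≡0 i i*i≡0 with i*j≡0⇒i≡0∨j≡0 i i*i≡0
  ... | inj₁ i≡0 = i≡0
  ... | inj₂ i≡0 = i≡0

  square-zero : ∀ {n} (u : Vector ℤ n) → dot u u ≤ 0ℤ → ∀ k → u k ≡ 0ℤ
  square-zero u ≤0 k = i*i≡0⇒i≡0 (u k) (sum-nonneg-zero (λ k → u k * u k) (λ k → 0≤i*i (u k)) ≤0 k)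

  -- Signs and balanced vectors

  IsSign : ℤ → Set
  IsSign i = i ≡ + 1 ⊎ i ≡ - + 1

  sgn-isSign : ∀ b → IsSign (sgn b)
  sgn-isSign true  = inj₁ refl
  sgn-isSign false = inj₂ refl

  IsSign⇒square : ∀ {i} → IsSign i → i * i ≡ + 1
  IsSign⇒square (inj₁ refl) = refl
  IsSign⇒square (inj₂ refl) = refl

  record Balanced (s : Vector ℤ 6) : Set where
    field
      isSign   : ∀ k → IsSign (s k)
      sum-zero : sum s ≡ 0ℤ
  open Balanced

  balanced-square : ∀ {s} → Balanced s → dot s s ≡ + 6
  balanced-square {s} s-bal = sum-cong-≗ {6} {λ k → s k * s k} {λ _ → + 1} (λ k → IsSign⇒square (isSign s-bal k))

  neg-balanced : ∀ {s} → Balanced s → Balanced (λ k → - + 1 * s k)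
  neg-balanced {s} s-bal .isSign k with isSign s-bal k
  ... | inj₁ eq = inj₂ (cong (- + 1 *_) eq)
  ... | inj₂ eq = inj₁ (cong (- + 1 *_) eq)
  neg-balanced {s} s-bal .sum-zero =
    trans (sym (*-distribˡ-sum (- + 1) s)) (cong (- + 1 *_) (sum-zero s-bal))

  half : ∀ {i} → IsSign i → ℤ
  half (inj₁ _) = 0ℤ
  half (inj₂ _) = - + 1

  IsSign⇒odd : ∀ {i} (i-sign : IsSign i) → i ≡ + 2 * half i-sign + + 1
  IsSign⇒odd (inj₁ eq) = eq
  IsSign⇒odd (inj₂ eq) = eq

  halves : ∀ {s} → Balanced s → Vector ℤ 6
  halves s-bal k = half (isSign s-bal k)

  -- Writing s = 2 h + 1 with entries of h in {0, -1} shows that s · M is even once M sums to 0.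
  -- This parity excludes Y = ±3 in `four-hits` and makes the pair entries integral in `cut-even`.
  balanced-dot : ∀ {s} (s-bal : Balanced s) M → dot s M ≡ + 2 * dot (halves s-bal) M + sum M
  balanced-dot {s} s-bal M = begin
    dot s M
      ≡⟨ sum-cong-≗ (λ k → trans (cong (_* M k) (IsSign⇒odd (isSign s-bal k))) (ring (h k) (M k))) ⟩
    sum (λ k → + 2 * (h k * M k) + M k)
      ≡⟨ ∑-distrib-+ (λ k → + 2 * (h k * M k)) M ⟩
    sum (λ k → + 2 * (h k * M k)) + sum M
      ≡⟨ cong (_+ sum M) (sym (*-distribˡ-sum (+ 2) (λ k → h k * M k))) ⟩
    + 2 * dot h M + sum M ∎
    where
    open ≡-Reasoning
    h = halves s-bal
    ring : ∀ h m → (+ 2 * h + + 1) * m ≡ + 2 * (h * m) + m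
    ring = solve-∀

  balanced-dot-zero-sum : ∀ {s} (s-bal : Balanced s) M → sum M ≡ 0ℤ →
    dot s M ≡ + 2 * dot (halves s-bal) M
  balanced-dot-zero-sum s-bal M ΣM≡0 =
    trans (balanced-dot s-bal M) (trans (cong (λ z → + 2 * dot (halves s-bal) M + z) ΣM≡0) (+-identityʳ _))

  sum-halves : ∀ {s} (s-bal : Balanced s) → sum (halves s-bal) ≡ - + 3
  sum-halves {s} s-bal = *-cancelˡ-≡ (+ 2) _ _ (begin
    + 2 * sum h                            ≡⟨ ring (+ 2 * sum h) ⟩
    (+ 2 * sum h + + 6) - + 6              ≡⟨ cong (λ z → (z + + 6) - + 6) (*-distribˡ-sum (+ 2) h) ⟩
    (sum (λ k → + 2 * h k) + + 6) - + 6    ≡⟨ cong (_- + 6) (sym (∑-distrib-+ (λ k → + 2 * h k) (λ _ → + 1))) ⟩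
    sum (λ k → + 2 * h k + + 1) - + 6      ≡⟨ cong (_- + 6) (sym (sum-cong-≗ (λ k → IsSign⇒odd (isSign s-bal k)))) ⟩
    sum s - + 6                            ≡⟨ cong (_- + 6) (sum-zero s-bal) ⟩
    - + 6                                  ∎)
    where
    open ≡-Reasoning
    h = halves s-bal
    ring : ∀ a → a ≡ (a + + 6) - + 6
    ring = solve-∀

  -- For balanced s and t the product is ≡ 2 modulo 4.
  balanced-dot-≢0 : ∀ {s t} → Balanced s → Balanced t → dot s t ≢ 0ℤ
  balanced-dot-≢0 {s} {t} s-bal t-bal s·t≡0 = 6≢4q (dot (halves t-bal) h) (begin
    + 4 * q                          ≡⟨ ring q ⟩
    + 2 * (+ 2 * q + - + 3) + + 6    ≡⟨ cong (λ z → + 2 * (+ 2 * q + z) + + 6) (sym (sum-halves s-bal)) ⟩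
    + 2 * (+ 2 * q + sum h) + + 6    ≡⟨ cong (λ z → + 2 * z + + 6) (sym (balanced-dot t-bal h)) ⟩
    + 2 * dot t h + + 6              ≡⟨ cong (λ z → + 2 * z + + 6) (dot-comm t h) ⟩
    + 2 * dot h t + + 6              ≡⟨ cong (_+ + 6) (sym (balanced-dot-zero-sum s-bal t (sum-zero t-bal))) ⟩
    dot s t + + 6                    ≡⟨ cong (_+ + 6) s·t≡0 ⟩
    + 6                              ∎)
    where
    open ≡-Reasoning
    h = halves s-bal
    q = dot (halves t-bal) h
    ring : ∀ q → + 4 * q ≡ + 2 * (+ 2 * q + - + 3) + + 6
    ring = solve-∀
    6≢4q : ∀ q → + 4 * q ≢ + 6
    6≢4q q eq = from-no (4 ∣? 6) (divides ∣ q ∣ (trans (sym (cong ∣_∣ eq)) (trans (abs-* (+ 4) q) (ℕ.*-comm 4 ∣ q ∣))))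

  -- Obtuse families of balanced sign vectors

  vsum : List (Vector ℤ 6) → Vector ℤ 6
  vsum []       _ = 0ℤ
  vsum (s ∷ ss) k = s k + vsum ss k

  -- Balanced vectors have squared norm 6, so this says that the cosine is at most -1/3, the value
  -- between vertices of a regular tetrahedron seen from its centre. Hence at most four such
  -- vectors, and sum 0 if there are four.
  Obtuse : Vector ℤ 6 → Vector ℤ 6 → Set
  Obtuse s t = dot s t ≤ - + 2

  dot-vsum : ∀ {s} ss → All (Obtuse s) ss → dot s (vsum ss) ≤ - + 2 * + length ss
  dot-vsum {s} []       []       = ≤-reflexive (trans (dot-comm s (vsum [])) (dot-0ˡ s))
  dot-vsum {s} (t ∷ ts) (p ∷ ps) = begin
    dot s (vsum (t ∷ ts))          ≡⟨ dot-comm s (vsum (t ∷ ts)) ⟩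
    dot (vsum (t ∷ ts)) s          ≡⟨ dot-+ˡ t (vsum ts) s ⟩
    dot t s + dot (vsum ts) s      ≡⟨ cong₂ _+_ (dot-comm t s) (dot-comm (vsum ts) s) ⟩
    dot s t + dot s (vsum ts)      ≤⟨ +-mono-≤ p (dot-vsum {s} ts ps) ⟩
    - + 2 + - + 2 * + length ts    ≡⟨ ring (+ length ts) ⟩
    - + 2 * (+ 1 + + length ts)    ∎
    where
    open ≤-Reasoning
    ring : ∀ n → - + 2 + - + 2 * n ≡ - + 2 * (+ 1 + n)
    ring = solve-∀

  -- In closed form 2 n (4 - n), that is 0, 6, 8, 6, 0, -10, bounding the squared norm of a sum of n
  -- pairwise obtuse vectors. The value 6 at three makes the sum a sign vector, 0 at four makes it
  -- vanish, and -10 rules out five.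
  obtuse-bound : ℕ → ℤ
  obtuse-bound zero    = 0ℤ
  obtuse-bound (suc n) = + 6 + + 2 * (- + 2 * + n) + obtuse-bound n

  square-vsum : ∀ ss → All Balanced ss → AllPairs Obtuse ss →
    dot (vsum ss) (vsum ss) ≤ obtuse-bound (length ss)
  square-vsum []       []       []       = ≤-refl
  square-vsum (s ∷ ss) (b ∷ bs) (o ∷ os) = begin
    dot (vsum (s ∷ ss)) (vsum (s ∷ ss))
      ≡⟨ square-+ s (vsum ss) ⟩
    dot s s + + 2 * dot s (vsum ss) + dot (vsum ss) (vsum ss)
      ≡⟨ cong (λ z → z + + 2 * dot s (vsum ss) + dot (vsum ss) (vsum ss)) (balanced-square b) ⟩
    + 6 + + 2 * dot s (vsum ss) + dot (vsum ss) (vsum ss)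
      ≤⟨ +-mono-≤ (+-monoʳ-≤ (+ 6) (*-monoˡ-≤-nonNeg (+ 2) (dot-vsum {s} ss o))) (square-vsum ss bs os) ⟩
    + 6 + + 2 * (- + 2 * + length ss) + obtuse-bound (length ss) ∎
    where open ≤-Reasoning

  no-five : ∀ {a b c d e} ss → All Balanced (a ∷ b ∷ c ∷ d ∷ e ∷ ss) →
    ¬ AllPairs Obtuse (a ∷ b ∷ c ∷ d ∷ e ∷ ss)
  no-five {a} {b} {c} {d} {e} ss (A ∷ B ∷ C ∷ D ∷ E ∷ _)
    ((ab ∷ ac ∷ ad ∷ ae ∷ _) ∷ (bc ∷ bd ∷ be ∷ _) ∷ (cd ∷ ce ∷ _) ∷ (de ∷ _) ∷ _) =
    0≰-10 (≤-trans (sum-nonneg _ (λ k → 0≤i*i (vsum five k)))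
      (square-vsum five (A ∷ B ∷ C ∷ D ∷ E ∷ [])
        ((ab ∷ ac ∷ ad ∷ ae ∷ []) ∷ (bc ∷ bd ∷ be ∷ []) ∷ (cd ∷ ce ∷ []) ∷ (de ∷ []) ∷ [] ∷ [])))
    where
    five = a ∷ b ∷ c ∷ d ∷ e ∷ []
    0≰-10 : ¬ (0ℤ ≤ - + 10)
    0≰-10 ()

  -- What an inner product in {0, 1} with a cut says about block `M`, after the cut is normalised;
  -- `G` is the sum or the difference of the two pair entries involved.
  Hits : Vector ℤ 6 → ℤ → Vector ℤ 6 → Set
  Hits M G s = ∃[ σ ] dot s M + G ≡ + 6 * sgn σ

  infix 4 _∈0,±6
  _∈0,±6 : ℤ → Set
  Y ∈0,±6 = Y ≡ 0ℤ ⊎ Y ≡ + 6 ⊎ Y ≡ - + 6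

  -- Adding the four equations gives 4 Y = 6 (α + β + γ + δ), so Y is 0, ±3 or ±6. With Y = ±3 the
  -- even number a would be odd; Y = ±6 requires four equal signs, and then a = 0.
  four-hits : ∀ {a b c d Y t} α β γ δ → a ≡ + 2 * t → a + (b + (c + (d + 0ℤ))) ≡ 0ℤ →
    a + Y ≡ + 6 * sgn α → b + Y ≡ + 6 * sgn β → c + Y ≡ + 6 * sgn γ → d + Y ≡ + 6 * sgn δ →
    Y ∈0,±6 × (Y ≢ 0ℤ → a ≡ 0ℤ)
  four-hits {a} {b} {c} {d} {Y} {t} α β γ δ a≡2t Σ≡0 pa pb pc pd =
    conclude α β γ δ pa (begin
      + 4 * Y
        ≡⟨ sym (+-identityˡ (+ 4 * Y)) ⟩
      0ℤ + + 4 * Y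
        ≡⟨ cong (_+ + 4 * Y) (sym Σ≡0) ⟩
      (a + (b + (c + (d + 0ℤ)))) + + 4 * Y
        ≡⟨ ring a b c d Y ⟩
      (a + Y) + ((b + Y) + ((c + Y) + (d + Y)))
        ≡⟨ cong₂ _+_ pa (cong₂ _+_ pb (cong₂ _+_ pc pd)) ⟩
      + 6 * sgn α + (+ 6 * sgn β + (+ 6 * sgn γ + + 6 * sgn δ)) ∎)
    where
    open ≡-Reasoning
    ring : ∀ a b c d Y → (a + (b + (c + (d + 0ℤ)))) + + 4 * Y ≡ (a + Y) + ((b + Y) + ((c + Y) + (d + Y)))
    ring = solve-∀
    back : ∀ {z} → a + Y ≡ z → a ≡ z - Y
    back refl = cancel a Y
      where
      cancel : ∀ a Y → a ≡ (a + Y) - Y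
      cancel = solve-∀
    odd : ∀ {A : Set} z → a + Y ≡ z → (y : ℤ) → Y ≡ y → ¬ (2 ∣ℕ ∣ z - y ∣) → A
    odd z p y q ¬2∣ = contradiction
      (divides ∣ t ∣ (trans (cong ∣_∣ (trans (sym (trans (back p) (cong (λ w → z - w) q))) a≡2t))
        (trans (abs-* (+ 2) t) (ℕ.*-comm 2 ∣ t ∣)))) ¬2∣
    zero′ : Y ≡ 0ℤ → Y ∈0,±6 × (Y ≢ 0ℤ → a ≡ 0ℤ)
    zero′ q = inj₁ q , λ Y≢0 → contradiction q Y≢0
    conclude : ∀ α β γ δ → a + Y ≡ + 6 * sgn α →
      + 4 * Y ≡ + 6 * sgn α + (+ 6 * sgn β + (+ 6 * sgn γ + + 6 * sgn δ)) →
      Y ∈0,±6 × (Y ≢ 0ℤ → a ≡ 0ℤ)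
    4Y : ∀ y → + 4 * Y ≡ + 4 * y → Y ≡ y
    4Y y = *-cancelˡ-≡ (+ 4) Y y
    conclude true true true true p q with 4Y (+ 6) q
    ... | refl = inj₂ (inj₁ refl) , λ _ → back p
    conclude false false false false p q with 4Y (- + 6) q
    ... | refl = inj₂ (inj₂ refl) , λ _ → back p
    conclude true  true  true  false p q = odd _ p (+ 3) (4Y (+ 3) q) (from-no (2 ∣? 3))
    conclude true  true  false true  p q = odd _ p (+ 3) (4Y (+ 3) q) (from-no (2 ∣? 3))
    conclude true  false true  true  p q = odd _ p (+ 3) (4Y (+ 3) q) (from-no (2 ∣? 3))
    conclude false true  true  true  p q = odd _ p (+ 3) (4Y (+ 3) q) (from-no (2 ∣? 9))
    conclude false false false true  p q = odd _ p (- + 3) (4Y (- + 3) q) (from-no (2 ∣? 3))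
    conclude false false true  false p q = odd _ p (- + 3) (4Y (- + 3) q) (from-no (2 ∣? 3))
    conclude false true  false false p q = odd _ p (- + 3) (4Y (- + 3) q) (from-no (2 ∣? 3))
    conclude true  false false false p q = odd _ p (- + 3) (4Y (- + 3) q) (from-no (2 ∣? 9))
    conclude true  true  false false p q = zero′ (4Y 0ℤ q)
    conclude true  false true  false p q = zero′ (4Y 0ℤ q)
    conclude true  false false true  p q = zero′ (4Y 0ℤ q)
    conclude false true  true  false p q = zero′ (4Y 0ℤ q)
    conclude false true  false true  p q = zero′ (4Y 0ℤ q)
    conclude false false true  true  p q = zero′ (4Y 0ℤ q)

  dot-vsum-sum : ∀ ss M → dot (vsum ss) M ≡ List.foldr (λ s t → dot s M + t) 0ℤ ss
  dot-vsum-sum []       M = dot-0ˡ M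
  dot-vsum-sum (s ∷ ss) M =
    trans (dot-+ˡ s (vsum ss) M) (cong (λ z → dot s M + z) (dot-vsum-sum ss M))

  -- Four pairwise obtuse balanced vectors add up to 0.
  four-obtuse : ∀ {ss M Y} → sum M ≡ 0ℤ → length ss ≡ 4 →
    All Balanced ss → AllPairs Obtuse ss → All (Hits M Y) ss →
    Y ∈0,±6 × (Y ≢ 0ℤ → ∃[ s ] Balanced s × dot s M ≡ 0ℤ)
  four-obtuse {ss@(a ∷ b ∷ c ∷ d ∷ [])} {M} {Y} ΣM≡0 refl bs@(A ∷ _) os
    ((α , pα) ∷ (β , pβ) ∷ (γ , pγ) ∷ (δ , pδ) ∷ []) =
    proj₁ r , λ Y≢0 → a , A , proj₂ r Y≢0
    where
    vsum≡0 : ∀ k → vsum ss k ≡ 0ℤ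
    vsum≡0 = square-zero (vsum ss) (square-vsum ss bs os)
    Σ≡0 : List.foldr (λ s t → dot s M + t) 0ℤ ss ≡ 0ℤ
    Σ≡0 = trans (sym (dot-vsum-sum ss M)) (trans (dot-congˡ {v = λ _ → 0ℤ} M vsum≡0) (dot-0ˡ M))
    r = four-hits {dot a M} {dot b M} {dot c M} {dot d M} {Y} α β γ δ
      (balanced-dot-zero-sum A M ΣM≡0) Σ≡0 pα pβ pγ pδ

  -- The possible sums of three signs, numbered so that the finite search can range over them.
  odds : Fin 4 → ℤ
  odds 0F = + 1
  odds 1F = - + 1
  odds 2F = + 3
  odds 3F = - + 3

  odd-sum : ∀ α β γ → ∃[ i ] sgn α + (sgn β + (sgn γ + 0ℤ)) ≡ odds i
  odd-sum true  true  true  = 2F , refl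
  odd-sum true  true  false = 0F , refl
  odd-sum true  false true  = 0F , refl
  odd-sum true  false false = 1F , refl
  odd-sum false true  true  = 0F , refl
  odd-sum false true  false = 1F , refl
  odd-sum false false true  = 1F , refl
  odd-sum false false false = 3F , refl

  IsSign⇒sgn : ∀ {i} → IsSign i → ∃[ b ] i ≡ sgn b
  IsSign⇒sgn (inj₁ eq) = true , eq
  IsSign⇒sgn (inj₂ eq) = false , eq

  sum-of-three : ∀ {a b c} → IsSign a → IsSign b → IsSign c → ∃[ i ] a + (b + (c + 0ℤ)) ≡ odds i
  sum-of-three a-sign b-sign c-sign
    with IsSign⇒sgn a-sign | IsSign⇒sgn b-sign | IsSign⇒sgn c-sign
  ... | α , refl | β , refl | γ , refl = odd-sum α β γ

  odds-square : ∀ i → 0ℤ ≤ odds i * odds i + - + 1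
  odds-square 0F = +≤+ z≤n
  odds-square 1F = +≤+ z≤n
  odds-square 2F = +≤+ z≤n
  odds-square 3F = +≤+ z≤n

  odds-sign : ∀ i → odds i * odds i + - + 1 ≡ 0ℤ → IsSign (odds i)
  odds-sign 0F _ = inj₁ refl
  odds-sign 1F _ = inj₂ refl
  odds-sign 2F ()
  odds-sign 3F ()

  -- An odd square is at least 1, so a squared norm of at most n leaves no room for an entry ±3.
  odd-unit : ∀ {n} (f : Vector ℤ n) → (∀ k → ∃[ i ] f k ≡ odds i) → dot f f ≤ sum {n} (λ _ → + 1) →
    ∀ k → IsSign (f k)
  odd-unit {n} f f-odd f²≤n k with f-odd k in eq
  ... | i , fk≡ = subst IsSign (sym fk≡) (odds-sign i
      (trans (cong (λ z → z * z + - + 1) (sym fk≡)) (sum-nonneg-zero g 0≤g Σg≤0 k)))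
    where
    g : Vector ℤ n
    g k = f k * f k + - + 1
    0≤g : ∀ k → 0ℤ ≤ g k
    0≤g k = subst (λ z → 0ℤ ≤ z * z + - + 1) (sym (proj₂ (f-odd k))) (odds-square (proj₁ (f-odd k)))
    Σg≤0 : sum g ≤ 0ℤ
    Σg≤0 = begin
      sum g
        ≡⟨ ∑-distrib-+ (λ k → f k * f k) (λ _ → - + 1) ⟩
      dot f f + sum {n} (λ _ → - + 1)
        ≤⟨ +-monoˡ-≤ _ f²≤n ⟩
      sum {n} (λ _ → + 1) + sum {n} (λ _ → - + 1)
        ≡⟨ sym (∑-distrib-+ {n} (λ _ → + 1) (λ _ → - + 1)) ⟩
      sum {n} (λ _ → 0ℤ)
        ≡⟨ sum-replicate-zero n ⟩
      0ℤ ∎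
      where open ≤-Reasoning

  -- The negated sum of three pairwise obtuse balanced vectors is the balanced
  -- vector completing them to four vectors with sum 0.
  three-obtuse : ∀ {ts M Z} → 3 ℕ.≤ length ts →
    All Balanced ts → AllPairs Obtuse ts → All (Hits M Z) ts →
    ∃[ s ] Balanced s × ∃[ i ] dot s M ≡ + 3 * Z - + 6 * odds i
  three-obtuse {_ ∷ []} (s≤s ())
  three-obtuse {_ ∷ _ ∷ []} (s≤s (s≤s ()))
  three-obtuse {a ∷ b ∷ c ∷ _} {M} {Z} _ (A ∷ B ∷ C ∷ _)
    ((ab ∷ ac ∷ _) ∷ (bc ∷ _) ∷ _) ((α , pα) ∷ (β , pβ) ∷ (γ , pγ) ∷ _) =
    (λ k → - + 1 * vsum ss k) , neg-balanced (record
      { isSign = odd-unit (vsum ss) (λ k → sum-of-three (isSign A k) (isSign B k) (isSign C k))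
          (square-vsum ss (A ∷ B ∷ C ∷ []) ((ab ∷ ac ∷ []) ∷ (bc ∷ []) ∷ [] ∷ []))
      ; sum-zero = trans (∑-distrib-+ a (vsum (b ∷ c ∷ [])))
          (cong₂ _+_ (sum-zero A) (trans (∑-distrib-+ b (vsum (c ∷ [])))
            (cong₂ _+_ (sum-zero B) (trans (∑-distrib-+ c (vsum []))
              (cong₂ _+_ (sum-zero C) (sum-replicate-zero 6)))))) })
    , proj₁ e , (begin
      dot (λ k → - + 1 * vsum ss k) M
        ≡⟨ dot-*ˡ (- + 1) (vsum ss) M ⟩
      - + 1 * dot (vsum ss) M
        ≡⟨ cong (- + 1 *_) (dot-vsum-sum ss M) ⟩
      - + 1 * (dot a M + (dot b M + (dot c M + 0ℤ)))
        ≡⟨ ring (dot a M) (dot b M) (dot c M) Z ⟩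
      + 3 * Z - ((dot a M + Z) + ((dot b M + Z) + (dot c M + Z)))
        ≡⟨ cong (λ z → + 3 * Z - z) (cong₂ _+_ pα (cong₂ _+_ pβ pγ)) ⟩
      + 3 * Z - (+ 6 * sgn α + (+ 6 * sgn β + + 6 * sgn γ))
        ≡⟨ ring′ (+ 3 * Z) (sgn α) (sgn β) (sgn γ) ⟩
      + 3 * Z - + 6 * (sgn α + (sgn β + (sgn γ + 0ℤ)))
        ≡⟨ cong (λ z → + 3 * Z - + 6 * z) (proj₂ e) ⟩
      + 3 * Z - + 6 * odds (proj₁ e) ∎)
    where
    open ≡-Reasoning
    ss = a ∷ b ∷ c ∷ []
    e = odd-sum α β γ
    ring : ∀ a b c Z → - + 1 * (a + (b + (c + 0ℤ))) ≡ + 3 * Z - ((a + Z) + ((b + Z) + (c + Z)))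
    ring = solve-∀
    ring′ : ∀ z α β γ → z - (+ 6 * α + (+ 6 * β + + 6 * γ)) ≡ z - + 6 * (α + (β + (γ + 0ℤ)))
    ring′ = solve-∀

  -- What the inner products with seven pairwise compatible cuts reveal about a vector
  -- with block M and pair entries g, h: Y and Z are g ± h in some order.
  record Shadow (M : Vector ℤ 6) (Y Z : ℤ) : Set where
    constructor mkShadow
    field
      Y-value : Y ∈0,±6
      witness    : Y ≢ 0ℤ → ∃[ s ] Balanced s × dot s M ≡ 0ℤ
      axis       : Vector ℤ 6
      axis-bal   : Balanced axis
      index      : Fin 4
      axis-dot   : dot axis M ≡ + 3 * Z - + 6 * odds index

  Class : Vector ℤ 6 → ℤ → List (Vector ℤ 6) → Set
  Class M G ss = All Balanced ss × AllPairs Obtuse ss × All (Hits M G) ss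

  at-most-four : ∀ {ss} → All Balanced ss → AllPairs Obtuse ss → length ss ℕ.≤ 4
  at-most-four {[]}                     _ _ = z≤n
  at-most-four {_ ∷ []}                 _ _ = s≤s z≤n
  at-most-four {_ ∷ _ ∷ []}             _ _ = s≤s (s≤s z≤n)
  at-most-four {_ ∷ _ ∷ _ ∷ []}         _ _ = s≤s (s≤s (s≤s z≤n))
  at-most-four {_ ∷ _ ∷ _ ∷ _ ∷ []}     _ _ = s≤s (s≤s (s≤s (s≤s z≤n)))
  at-most-four {_ ∷ _ ∷ _ ∷ _ ∷ _ ∷ ss} b o = contradiction o (no-five ss b)

  shadow : ∀ {M Y Z} → Y ∈0,±6 × (Y ≢ 0ℤ → ∃[ s ] Balanced s × dot s M ≡ 0ℤ) →
    (∃[ s ] Balanced s × ∃[ i ] dot s M ≡ + 3 * Z - + 6 * odds i) → Shadow M Y Z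
  shadow (value , witness) (s , s-bal , i , s·M) = mkShadow value witness s s-bal i s·M

  -- Neither class has more than four members, so seven in total means four in one and at least
  -- three in the other. Which class has the four decides whether `G` or `H` plays the part of Y.
  profile : ∀ {M G H} → sum M ≡ 0ℤ → ∀ ss ts → Class M G ss → Class M H ts →
    7 ℕ.≤ length ss ℕ.+ length ts → Shadow M G H ⊎ Shadow M H G
  profile {M} ΣM ss ts (b , o , h) (b′ , o′ , h′) 7≤ with length ss ℕ.≟ 4
  ... | yes |ss|≡4 = inj₁ (shadow (four-obtuse {M = M} ΣM |ss|≡4 b o h) (three-obtuse {M = M}
    (ℕ.+-cancelˡ-≤ 4 3 (length ts) (subst (λ n → 7 ℕ.≤ n ℕ.+ length ts) |ss|≡4 7≤)) b′ o′ h′))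
  ... | no |ss|≢4 = inj₂ (shadow
    (four-obtuse {M = M} ΣM (ℕ.≤-antisym |ts|≤4 (ℕ.+-cancelˡ-≤ 3 4 (length ts)
      (ℕ.≤-trans 7≤ (ℕ.+-monoˡ-≤ (length ts) |ss|≤3)))) b′ o′ h′)
    (three-obtuse {M = M} (ℕ.+-cancelʳ-≤ 4 3 (length ss)
      (ℕ.≤-trans 7≤ (ℕ.+-monoʳ-≤ (length ss) |ts|≤4))) b o h))
    where
    |ts|≤4 = at-most-four b′ o′
    |ss|≤3 = ℕ.≤-pred (ℕ.≤∧≢⇒< (at-most-four b o) |ss|≢4)

  -- The finite search

  -- The integers -4, ..., 4, which are those of square at most 18; see `small-square`.
  grid : Fin 9 → ℤ
  grid i = + toℕ i - + 4

  sq : ℤ → ℤ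
  sq z = z * z

  infix 4 _∈0,±3 _∈0,±3?
  _∈0,±3 : ℤ → Set
  y ∈0,±3 = y ≡ 0ℤ ⊎ y ≡ + 3 ⊎ y ≡ - + 3

  _∈0,±3? : ∀ y → Dec (y ∈0,±3)
  y ∈0,±3? = (y ≟ 0ℤ) ⊎-dec (y ≟ + 3) ⊎-dec (y ≟ - + 3)

  combine± : (Fin 3 → ℤ) → Fin 3 → Bool → ℤ
  combine± D j κ = D (punchIn j 0F) + sgn κ * D (punchIn j 1F)

  tri : ∀ {A : Set} → A → A → A → Fin 3 → A
  tri a b c = a F.∷ b F.∷ c F.∷ F.[]

  -- The ε of s · M = 6 ε: with C = 2 D, the value 3 Z - 6 o recorded in `axis-dot` becomes 6 (Z -
  -- o), where Z on the right is formed from D.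
  coeff : (Fin 3 → ℤ) → (Fin 3 → Bool) → (Fin 3 → Fin 4) → Fin 3 → ℤ
  coeff D κ e j = combine± D j (not (κ j)) - odds (e j)

  allBool? : ∀ {P : Bool → Set} → (∀ b → Dec (P b)) → Dec (∀ b → P b)
  allBool? P? with P? true | P? false
  ... | yes p | yes q = yes λ { true → p ; false → q }
  ... | no ¬p | _     = no λ p → ¬p (p true)
  ... | yes _ | no ¬q = no λ q → ¬q (q false)

  -- The data of a cut of type `j` after halving: ε is ±3 in its own block and 0 elsewhere, and the
  -- two pair entries ±6 of C have become ±3.
  IsCut : (D ε : Fin 3 → ℤ) → Fin 3 → Set
  IsCut D ε j = D j ≡ 0ℤ × (D (punchIn j 0F) ≡ + 3 ⊎ D (punchIn j 0F) ≡ - + 3)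
    × (D (punchIn j 1F) ≡ + 3 ⊎ D (punchIn j 1F) ≡ - + 3)
    × (ε j ≡ + 3 ⊎ ε j ≡ - + 3) × ε (punchIn j 0F) ≡ 0ℤ × ε (punchIn j 1F) ≡ 0ℤ

  isCut? : ∀ D ε j → Dec (IsCut D ε j)
  isCut? D ε j = D j ≟ 0ℤ ×-dec (D (punchIn j 0F) ≟ + 3 ⊎-dec D (punchIn j 0F) ≟ - + 3)
    ×-dec (D (punchIn j 1F) ≟ + 3 ⊎-dec D (punchIn j 1F) ≟ - + 3)
    ×-dec (ε j ≟ + 3 ⊎-dec ε j ≟ - + 3) ×-dec ε (punchIn j 0F) ≟ 0ℤ ×-dec ε (punchIn j 1F) ≟ 0ℤ

  -- Here 9 = 54 / 6 is the Cauchy-Schwarz bound on Σ ε² for axes of squared norm 6 and Σ M² = 54.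
  -- The first half therefore forces equality, and the second identifies the equality cases in which
  -- every block has Y = 0 or ε = 0.
  Search : (D : Fin 3 → ℤ) (κ : Fin 3 → Bool) (e : Fin 3 → Fin 4) → Set
  Search D κ e = let ε = coeff D κ e in
      + 9 ≤ sum (sq ∘ ε)
    × (sum (sq ∘ ε) ≤ + 9 → (∀ j → combine± D j (κ j) ≡ 0ℤ ⊎ ε j ≡ 0ℤ) → ∃[ j ] IsCut D ε j)

  search? : ∀ D κ e → Dec (Search D κ e)
  search? D κ e = let ε = coeff D κ e in
    (+ 9 ≤? sum (sq ∘ ε)) ×-dec ((sum (sq ∘ ε) ≤? + 9) →-dec
      (all? (λ j → (combine± D j (κ j) ≟ 0ℤ) ⊎-dec (ε j ≟ 0ℤ)) →-dec Fin.any? (isCut? D ε)))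

  -- Σ D² = 18 leaves only (0, ±3, ±3) and (±4, ±1, ±1) up to order. The hypotheses are interleaved
  -- with the quantifiers so that the decision procedure abandons a branch as soon as one of them
  -- fails.
  search : ∀ d₀ d₁ d₂ → let D = grid ∘ tri d₀ d₁ d₂ in sum (sq ∘ D) ≡ + 18 →
    ∀ k₀ → combine± D 0F k₀ ∈0,±3 → ∀ k₁ → combine± D 1F k₁ ∈0,±3 → ∀ k₂ → combine± D 2F k₂ ∈0,±3 →
    ∀ e₀ e₁ e₂ → Search D (tri k₀ k₁ k₂) (tri e₀ e₁ e₂)
  search = from-yes (
    all? λ d₀ → all? λ d₁ → all? λ d₂ → let D = grid ∘ tri d₀ d₁ d₂ in
    (sum (sq ∘ D) ≟ + 18) →-dec
    (allBool? λ k₀ → (combine± D 0F k₀ ∈0,±3?) →-dec (allBool? λ k₁ → (combine± D 1F k₁ ∈0,±3?) →-dec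
    (allBool? λ k₂ → (combine± D 2F k₂ ∈0,±3?) →-dec (
    all? λ e₀ → all? λ e₁ → all? λ e₂ → search? D (tri k₀ k₁ k₂) (tri e₀ e₁ e₂))))))

  bit : Bool → ℤ
  bit true  = + 1
  bit false = 0ℤ

  term≤sum : ∀ {n} (f : Vector ℤ n) → (∀ k → 0ℤ ≤ f k) → ∀ k → f k ≤ sum f
  term≤sum f 0≤f zero    = subst (_≤ sum f) (+-identityʳ (f zero)) (+-monoʳ-≤ (f zero) (sum-nonneg (f ∘ suc) (0≤f ∘ suc)))
  term≤sum f 0≤f (suc k) = ≤-trans (term≤sum (f ∘ suc) (0≤f ∘ suc) k)
    (subst (_≤ sum f) (+-identityˡ (sum (f ∘ suc))) (+-monoˡ-≤ (sum (f ∘ suc)) (0≤f zero)))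

  parity : ∀ i → ∃[ b ] ∃[ h ] i ≡ bit b + + 2 * h
  parity i with i %ℕ 2 | n%ℕd<d i 2 | a≡a%ℕn+[a/ℕn]*n i 2
  ... | 0           | _               | eq = false , i /ℕ 2 , trans eq (cong (λ z → 0ℤ + z) (*-comm (i /ℕ 2) (+ 2)))
  ... | 1           | _               | eq = true , i /ℕ 2 , trans eq (cong (λ z → + 1 + z) (*-comm (i /ℕ 2) (+ 2)))
  ... | suc (suc _) | s≤s (s≤s ())    | _

  1≢2t : ∀ {t} → + 1 ≢ + 2 * t
  1≢2t {t} eq = from-no (2 ∣? 1) (divides ∣ t ∣ (trans (cong ∣_∣ eq) (trans (abs-* (+ 2) t) (ℕ.*-comm 2 ∣ t ∣))))

  combine±-parity : ∀ {a b} p q κ {g h t} → a ≡ bit p + + 2 * g → b ≡ bit q + + 2 * h →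
    a + sgn κ * b ≡ + 2 * t → p ≡ q
  combine±-parity true  true  κ _ _ _ = refl
  combine±-parity false false κ _ _ _ = refl
  combine±-parity true  false κ {g} {h} {t} refl refl eq = contradiction (trans (ring (sgn κ) g h) (cong (_+ (- (+ 2 * g) - + 2 * (sgn κ * h))) eq))
    (λ eq′ → 1≢2t {t - g - sgn κ * h} (trans eq′ (ring′ t g (sgn κ) h)))
    where
    ring : ∀ s g h → + 1 ≡ (+ 1 + + 2 * g) + s * (0ℤ + + 2 * h) + (- (+ 2 * g) - + 2 * (s * h))
    ring = solve-∀
    ring′ : ∀ t g s h → + 2 * t + (- (+ 2 * g) - + 2 * (s * h)) ≡ + 2 * (t - g - s * h)
    ring′ = solve-∀
  combine±-parity false true  true {g} {h} {t} refl refl eq =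
    contradiction (trans (ring g h) (trans (cong (_- + 2 * (g + h)) eq) (ring′ t g h))) (1≢2t {t - (g + h)})
    where
    ring : ∀ g h → + 1 ≡ ((0ℤ + + 2 * g) + + 1 * (+ 1 + + 2 * h)) - + 2 * (g + h)
    ring = solve-∀
    ring′ : ∀ t g h → + 2 * t - + 2 * (g + h) ≡ + 2 * (t - (g + h))
    ring′ = solve-∀
  combine±-parity false true  false {g} {h} {t} refl refl eq =
    contradiction (trans (ring g h) (trans (cong (λ z → - z + + 2 * (g - h)) eq) (ring′ t g h))) (1≢2t {g - h - t})
    where
    ring : ∀ g h → + 1 ≡ - ((0ℤ + + 2 * g) + - + 1 * (+ 1 + + 2 * h)) + + 2 * (g - h)
    ring = solve-∀
    ring′ : ∀ t g h → - (+ 2 * t) + + 2 * (g - h) ≡ + 2 * (g - h - t)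
    ring′ = solve-∀

  Even : ℤ → Set
  Even i = ∃[ h ] i ≡ + 2 * h

  -- Three odd squares add up to 3 modulo 4.
  all-even : ∀ (C : Fin 3 → ℤ) → sum (sq ∘ C) ≡ + 72 → (∀ j → ∃[ κ ] Even (combine± C j κ)) → ∀ h → Even (C h)
  all-even C ΣC² pairs-even = go (parity (C 0F)) (parity (C 1F)) (parity (C 2F))
    where
    go : ∃[ p ] ∃[ h ] C 0F ≡ bit p + + 2 * h → ∃[ p ] ∃[ h ] C 1F ≡ bit p + + 2 * h →
         ∃[ p ] ∃[ h ] C 2F ≡ bit p + + 2 * h → ∀ h → Even (C h)
    go (p , a , A) (q , b , B) (r , c , C′)
      with pairs-even 2F | pairs-even 1F
    ... | κ , _ , eq | κ′ , _ , eq′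
      with combine±-parity p q κ {a} {b} A B eq | combine±-parity p r κ′ {a} {c} A C′ eq′
    go (false , a , A) (false , b , B) (false , c , C′) | _ | _ | refl | refl = λ where
      0F → a , trans A (+-identityˡ _)
      1F → b , trans B (+-identityˡ _)
      2F → c , trans C′ (+-identityˡ _)
    go (true , a , A) (true , b , B) (true , c , C′) | _ | _ | refl | refl =
      contradiction (divides ∣ t ∣ (trans (cong ∣_∣ 69≡4t) (trans (abs-* (+ 4) t) (ℕ.*-comm 4 ∣ t ∣)))) (from-no (4 ∣? 69))
      where
      t = (a + a * a) + ((b + b * b) + (c + c * c))
      ring : ∀ a b c → (+ 1 + + 2 * a) * (+ 1 + + 2 * a) + ((+ 1 + + 2 * b) * (+ 1 + + 2 * b) +
        ((+ 1 + + 2 * c) * (+ 1 + + 2 * c) + 0ℤ)) - + 3 ≡ + 4 * ((a + a * a) + ((b + b * b) + (c + c * c)))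
      ring = solve-∀
      69≡4t : + 69 ≡ + 4 * t
      69≡4t = trans (cong (_- + 3) (sym ΣC²))
        (trans (cong (_- + 3) (cong₂ (λ x y → x + y) (cong sq A) (cong₂ (λ x y → x + y) (cong sq B) (cong (_+ 0ℤ) (cong sq C′))))) (ring a b c))

  sq≡∣∣ : ∀ i → sq i ≡ + (∣ i ∣ ℕ.* ∣ i ∣)
  sq≡∣∣ (+ n)    = sym (pos-* n n)
  sq≡∣∣ -[1+ n ] = refl

  sq-large : ∀ i → 5 ℕ.≤ ∣ i ∣ → ¬ (sq i ≤ + 18)
  sq-large i 5≤ sq≤18 = from-no (25 ℕ.≤? 18)
    (ℕ.≤-trans (ℕ.*-mono-≤ 5≤ 5≤) (drop‿+≤+ (subst (_≤ + 18) (sq≡∣∣ i) sq≤18)))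

  small-square : ∀ D → sq D ≤ + 18 → ∃[ i ] D ≡ grid i
  small-square (+ 0) _ = 4F , refl
  small-square (+ 1) _ = 5F , refl
  small-square (+ 2) _ = 6F , refl
  small-square (+ 3) _ = 7F , refl
  small-square (+ 4) _ = 8F , refl
  small-square -[1+ 0 ] _ = 3F , refl
  small-square -[1+ 1 ] _ = 2F , refl
  small-square -[1+ 2 ] _ = 1F , refl
  small-square -[1+ 3 ] _ = 0F , refl
  small-square i@(+ suc (suc (suc (suc (suc n))))) i²≤18 =
    contradiction i²≤18 (sq-large i (ℕ.m≤m+n 5 n))
  small-square i@(-[1+ suc (suc (suc (suc n))) ]) i²≤18 =
    contradiction i²≤18 (sq-large i (ℕ.m≤m+n 5 n))

  tri-η : ∀ {A : Set} (f : Fin 3 → A) j → tri (f 0F) (f 1F) (f 2F) j ≡ f j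
  tri-η f 0F = refl
  tri-η f 1F = refl
  tri-η f 2F = refl

  -- Rigidity: from equality in Cauchy-Schwarz to a cut

  IsCutVector : (Fin 3 → Vector ℤ 6) → (Fin 3 → ℤ) → Set
  IsCutVector M C = ∃[ j ] ∃[ s ] Balanced s × (∀ k → M j k ≡ + 3 * s k)
    × (∀ h k → M (punchIn j h) k ≡ 0ℤ) × C j ≡ 0ℤ × (∀ h → ∃[ σ ] C (punchIn j h) ≡ + 6 * sgn σ)

  halve-combine± : ∀ {a b g h Y} κ → a ≡ + 2 * g → b ≡ + 2 * h → a + sgn κ * b ≡ Y → Y ≡ + 2 * (g + sgn κ * h)
  halve-combine± {g = g} {h} κ refl refl eq = trans (sym eq) (ring g (sgn κ) h)
    where
    ring : ∀ g s h → + 2 * g + s * (+ 2 * h) ≡ + 2 * (g + s * h)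
    ring = solve-∀

  -- M = ε s when dot s M = 6 ε and dot M M = 6 ε² (equality in Cauchy-Schwarz).
  defect : ∀ {s} → Balanced s → ∀ M ε → dot s M ≡ + 6 * ε →
    dot (λ k → M k + - ε * s k) (λ k → M k + - ε * s k) ≡ dot M M - + 6 * sq ε
  defect {s} s-bal M ε s·M≡6ε = begin
    dot (λ k → M k + - ε * s k) (λ k → M k + - ε * s k)
      ≡⟨ square-+ M (λ k → - ε * s k) ⟩
    dot M M + + 2 * dot M (λ k → - ε * s k) + dot (λ k → - ε * s k) (λ k → - ε * s k)
      ≡⟨ cong₂ (λ x y → dot M M + + 2 * x + y) M·εs εs·εs ⟩
    dot M M + + 2 * (- ε * (+ 6 * ε)) + - ε * (- ε * + 6)
      ≡⟨ ring (dot M M) ε ⟩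
    dot M M - + 6 * sq ε ∎
    where
    open ≡-Reasoning
    ring : ∀ m ε → m + + 2 * (- ε * (+ 6 * ε)) + - ε * (- ε * + 6) ≡ m - + 6 * (ε * ε)
    ring = solve-∀
    M·εs : dot M (λ k → - ε * s k) ≡ - ε * (+ 6 * ε)
    M·εs = trans (dot-comm M (λ k → - ε * s k)) (trans (dot-*ˡ (- ε) s M) (cong (- ε *_) s·M≡6ε))
    εs·εs : dot (λ k → - ε * s k) (λ k → - ε * s k) ≡ - ε * (- ε * + 6)
    εs·εs = trans (dot-*ˡ (- ε) s (λ k → - ε * s k)) (cong (- ε *_) (trans (dot-comm s (λ k → - ε * s k))
      (trans (dot-*ˡ (- ε) s s) (cong (- ε *_) (balanced-square s-bal)))))

  -- The total defect 54 - 6 Σ ε² is nonnegative, while Σ ε² ≥ 9.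
  rigid : ∀ {D ε} (M s : Fin 3 → Vector ℤ 6) (y : Fin 3 → ℤ) → (∀ j → Balanced (s j)) →
    (∀ j → dot (s j) (M j) ≡ + 6 * ε j) → sum (λ j → dot (M j) (M j)) ≡ + 54 →
    (∀ j → y j ≢ 0ℤ → ∃[ t ] Balanced t × dot t (M j) ≡ 0ℤ) →
    + 9 ≤ sum (sq ∘ ε) ×
    (sum (sq ∘ ε) ≤ + 9 → (∀ j → y j ≡ 0ℤ ⊎ ε j ≡ 0ℤ) → ∃[ j ] IsCut D ε j) →
    (∃[ j ] IsCut D ε j) × (∀ j k → M j k ≡ ε j * s j k)
  rigid {D} {ε} M s y s-bal s·M≡6ε ΣM² witness (9≤ε² , found) = found ε²≤9 y-or-ε , M≡εs
    where
    N : Fin 3 → Vector ℤ 6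
    N j k = M j k + - ε j * s j k
    0≤N² : ∀ j → 0ℤ ≤ dot (N j) (N j)
    0≤N² j = sum-nonneg _ (λ k → 0≤i*i (N j k))
    ΣN² : sum (λ j → dot (N j) (N j)) ≡ + 54 + - + 6 * sum (sq ∘ ε)
    ΣN² = begin
      sum (λ j → dot (N j) (N j))
        ≡⟨ sum-cong-≗ (λ j → trans (defect (s-bal j) (M j) (ε j) (s·M≡6ε j)) (ring (dot (M j) (M j)) (sq (ε j)))) ⟩
      sum (λ j → dot (M j) (M j) + - + 6 * sq (ε j))
        ≡⟨ ∑-distrib-+ (λ j → dot (M j) (M j)) (λ j → - + 6 * sq (ε j)) ⟩
      sum (λ j → dot (M j) (M j)) + sum (λ j → - + 6 * sq (ε j))
        ≡⟨ cong₂ (λ a b → a + b) ΣM² (sym (*-distribˡ-sum (- + 6) (sq ∘ ε))) ⟩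
      + 54 + - + 6 * sum (sq ∘ ε) ∎
      where
      open ≡-Reasoning
      ring : ∀ a b → a - + 6 * b ≡ a + - + 6 * b
      ring = solve-∀
    ΣN²≤0 : sum (λ j → dot (N j) (N j)) ≤ 0ℤ
    ΣN²≤0 = subst (_≤ 0ℤ) (sym ΣN²) (+-monoʳ-≤ (+ 54) (*-monoˡ-≤-nonPos (- + 6) 9≤ε²))
    ε²≤9 : sum (sq ∘ ε) ≤ + 9
    ε²≤9 = *-cancelˡ-≤-pos (sum (sq ∘ ε)) (+ 9) (+ 6) (≤-trans (≤-reflexive (ring (sum (sq ∘ ε))))
      (+-monoʳ-≤ (+ 54) (neg-mono-≤ (subst (0ℤ ≤_) ΣN² (sum-nonneg _ 0≤N²)))))
      where
      ring : ∀ a → + 6 * a ≡ + 54 + - (+ 54 + - + 6 * a)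
      ring = solve-∀
    M≡εs : ∀ j k → M j k ≡ ε j * s j k
    M≡εs j k = begin
      M j k                        ≡⟨ ring (M j k) (ε j) (s j k) ⟩
      N j k + ε j * s j k          ≡⟨ cong (_+ ε j * s j k) (square-zero (N j) (≤-reflexive (sum-nonneg-zero _ 0≤N² ΣN²≤0 j)) k) ⟩
      0ℤ + ε j * s j k             ≡⟨ +-identityˡ _ ⟩
      ε j * s j k                  ∎
      where
      open ≡-Reasoning
      ring : ∀ m e s → m ≡ (m + - e * s) + e * s
      ring = solve-∀
    -- `M j` is ε times the balanced `s j`, and two balanced vectors are never orthogonal, so the
    -- orthogonal witness `t` forces ε = 0.
    vanish : ∀ j → ∃[ t ] Balanced t × dot t (M j) ≡ 0ℤ → ε j ≡ 0ℤ
    vanish j (t , t-bal , t·M≡0) = Sum.[ (λ ε≡0 → ε≡0)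
        , (λ s·t≡0 → contradiction s·t≡0 (balanced-dot-≢0 (s-bal j) t-bal)) ]
      (i*j≡0⇒i≡0∨j≡0 (ε j) (begin
        ε j * dot (s j) t               ≡⟨ sym (dot-*ˡ (ε j) (s j) t) ⟩
        dot (λ k → ε j * s j k) t       ≡⟨ dot-congˡ t (λ k → sym (M≡εs j k)) ⟩
        dot (M j) t                     ≡⟨ dot-comm (M j) t ⟩
        dot t (M j)                     ≡⟨ t·M≡0 ⟩
        0ℤ                              ∎))
      where open ≡-Reasoning
    y-or-ε : ∀ j → y j ≡ 0ℤ ⊎ ε j ≡ 0ℤ
    y-or-ε j with y j ≟ 0ℤ
    ... | yes y≡0 = inj₁ y≡0
    ... | no  y≢0 = inj₂ (vanish j (witness j y≢0))

  cut-vector : ∀ {D ε} (M s : Fin 3 → Vector ℤ 6) (C : Fin 3 → ℤ) → (∀ j → Balanced (s j)) →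
    (∀ h → C h ≡ + 2 * D h) → (∀ j k → M j k ≡ ε j * s j k) → ∀ j → IsCut D ε j → IsCutVector M C
  cut-vector {D} {ε} M s C s-bal C≡2D M≡εs j (Dj≡0 , D₀ , D₁ , εj , ε₀ , ε₁) = direct εj
    where
    vanish : ∀ {h} → ε h ≡ 0ℤ → ∀ k → M h k ≡ 0ℤ
    vanish {h} ε≡0 k = trans (M≡εs h k) (trans (cong (_* s h k) ε≡0) (*-zeroˡ (s h k)))
    sixfold : ∀ {h} → D h ≡ + 3 ⊎ D h ≡ - + 3 → ∃[ σ ] C h ≡ + 6 * sgn σ
    sixfold {h} (inj₁ eq) = true  , trans (C≡2D h) (cong (+ 2 *_) eq)
    sixfold {h} (inj₂ eq) = false , trans (C≡2D h) (cong (+ 2 *_) eq)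
    others : ∀ h k → M (punchIn j h) k ≡ 0ℤ
    others 0F k = vanish ε₀ k
    others 1F k = vanish ε₁ k
    sixfolds : ∀ h → ∃[ σ ] C (punchIn j h) ≡ + 6 * sgn σ
    sixfolds 0F = sixfold D₀
    sixfolds 1F = sixfold D₁
    Cj≡0 = trans (C≡2D j) (cong (+ 2 *_) Dj≡0)
    direct : ε j ≡ + 3 ⊎ ε j ≡ - + 3 → IsCutVector M C
    direct (inj₁ eq) = j , s j , s-bal j , (λ k → trans (M≡εs j k) (cong (_* s j k) eq))
      , others , Cj≡0 , sixfolds
    direct (inj₂ eq) = j , (λ k → - + 1 * s j k) , neg-balanced (s-bal j)
      , (λ k → trans (M≡εs j k) (trans (cong (_* s j k) eq) (*-assoc (+ 3) (- + 1) (s j k))))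
      , others , Cj≡0 , sixfolds

  grid-coordinates : ∀ (H : Fin 3 → ℤ) → sum (sq ∘ H) ≡ + 18 → ∃[ d ] ∀ h → H h ≡ grid (d h)
  grid-coordinates H ΣH² = (λ h → proj₁ (coordinate h)) , (λ h → proj₂ (coordinate h))
    where
    coordinate : ∀ h → ∃[ i ] H h ≡ grid i
    coordinate h = small-square (H h)
      (≤-trans (term≤sum (sq ∘ H) (λ h → 0≤i*i (H h)) h) (≤-reflexive ΣH²))

  halve-squares : ∀ (C H : Fin 3 → ℤ) → (∀ h → C h ≡ + 2 * H h) → sum (sq ∘ C) ≡ + 72 → sum (sq ∘ H) ≡ + 18
  halve-squares C H C≡2H ΣC² = *-cancelˡ-≡ (+ 4) _ (+ 18) (begin
    + 4 * sum (sq ∘ H)           ≡⟨ *-distribˡ-sum (+ 4) (sq ∘ H) ⟩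
    sum (λ h → + 4 * sq (H h))   ≡⟨ sum-cong-≗ (λ h → trans (ring (H h)) (sym (cong sq (C≡2H h)))) ⟩
    sum (sq ∘ C)                 ≡⟨ ΣC² ⟩
    + 72                         ∎)
    where
    open ≡-Reasoning
    ring : ∀ a → + 4 * (a * a) ≡ (+ 2 * a) * (+ 2 * a)
    ring = solve-∀

  cut-vector-from-grid : ∀ (M s : Fin 3 → Vector ℤ 6) (C : Fin 3 → ℤ) (d : Fin 3 → Fin 9) (κ : Fin 3 → Bool) (e : Fin 3 → Fin 4) →
    (∀ h → C h ≡ + 2 * grid (d h)) → sum (λ j → dot (M j) (M j)) ≡ + 54 → sum (sq ∘ C) ≡ + 72 →
    (∀ j → combine± C j (κ j) ∈0,±6) →
    (∀ j → combine± C j (κ j) ≢ 0ℤ → ∃[ t ] Balanced t × dot t (M j) ≡ 0ℤ) →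
    (∀ j → Balanced (s j)) → (∀ j → dot (s j) (M j) ≡ + 3 * combine± C j (not (κ j)) - + 6 * odds (e j)) →
    IsCutVector M C
  cut-vector-from-grid M s C d κ e C≡2grid ΣM² ΣC² Y-C witness s-bal s·M =
    cut-vector {D} {ε} M s C s-bal C≡2D (proj₂ result) (proj₁ (proj₁ result)) (proj₂ (proj₁ result))
    where
    -- The search ranges over functions given by their three values; `tri-η` translates between
    -- these and the given functions pointwise.
    κ′ = tri (κ 0F) (κ 1F) (κ 2F)
    e′ = tri (e 0F) (e 1F) (e 2F)
    D ε : Fin 3 → ℤ
    D = grid ∘ tri (d 0F) (d 1F) (d 2F)
    ε = coeff D κ′ e′
    C≡2D : ∀ h → C h ≡ + 2 * D h
    C≡2D h = trans (C≡2grid h) (cong (λ i → + 2 * grid i) (sym (tri-η d h)))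
    Y≡ : ∀ j → combine± C j (κ j) ≡ + 2 * combine± D j (κ j)
    Y≡ j = halve-combine± (κ j) (C≡2D _) (C≡2D _) refl
    Z≡ : ∀ j → combine± C j (not (κ j)) ≡ + 2 * combine± D j (not (κ j))
    Z≡ j = halve-combine± (not (κ j)) (C≡2D _) (C≡2D _) refl
    halved : ∀ j y → combine± C j (κ j) ≡ + 2 * y → combine± D j (κ j) ≡ y
    halved j y eq = *-cancelˡ-≡ (+ 2) (combine± D j (κ j)) y (trans (sym (Y≡ j)) eq)
    Y-D : ∀ j → combine± D j (κ j) ∈0,±3
    Y-D j = Sum.map (halved j 0ℤ) (Sum.map (halved j (+ 3)) (halved j (- + 3))) (Y-C j)
    s·M≡6ε : ∀ j → dot (s j) (M j) ≡ + 6 * ε j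
    s·M≡6ε j = begin
      dot (s j) (M j)                                  ≡⟨ s·M j ⟩
      + 3 * combine± C j (not (κ j)) - + 6 * odds (e j)           ≡⟨ cong (λ z → + 3 * z - + 6 * odds (e j)) (Z≡ j) ⟩
      + 3 * (+ 2 * combine± D j (not (κ j))) - + 6 * odds (e j)   ≡⟨ ring (combine± D j (not (κ j))) (odds (e j)) ⟩
      + 6 * (combine± D j (not (κ j)) - odds (e j))               ≡⟨ cong₂ (λ k i → + 6 * (combine± D j (not k) - odds i)) (sym (tri-η κ j)) (sym (tri-η e j)) ⟩
      + 6 * ε j                                        ∎
      where
      open ≡-Reasoning
      ring : ∀ f o → + 3 * (+ 2 * f) - + 6 * o ≡ + 6 * (f - o)
      ring = solve-∀
    result = rigid {D} {ε} M s (λ j → combine± D j (κ′ j)) s-bal s·M≡6ε ΣM²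
      (λ j ≢0 → witness j (λ ≡0 → ≢0 (trans (cong (combine± D j) (tri-η κ j)) (halved j 0ℤ ≡0))))
      (search (d 0F) (d 1F) (d 2F) (halve-squares C D C≡2D ΣC²)
        (κ 0F) (Y-D 0F) (κ 1F) (Y-D 1F) (κ 2F) (Y-D 2F) (e 0F) (e 1F) (e 2F))

  -- The evenness of C has to come before the search: only its halves, with Σ D² = 18, lie in the
  -- small grid.
  isCutVector : ∀ (M : Fin 3 → Vector ℤ 6) (C : Fin 3 → ℤ) →
    sum (λ j → dot (M j) (M j)) ≡ + 54 → sum (sq ∘ C) ≡ + 72 →
    (∀ j → ∃[ κ ] Shadow (M j) (combine± C j κ) (combine± C j (not κ))) → IsCutVector M C
  isCutVector M C ΣM² ΣC² shadows = fromHalves (λ h → proj₁ (C-even h)) (λ h → proj₂ (C-even h))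
    where
    open Shadow
    κ = λ j → proj₁ (shadows j)
    sh = λ j → proj₂ (shadows j)
    even : ∀ {Y} → Y ∈0,±6 → Even Y
    even (inj₁ eq)        = 0ℤ , eq
    even (inj₂ (inj₁ eq)) = + 3 , eq
    even (inj₂ (inj₂ eq)) = - + 3 , eq
    C-even : ∀ h → Even (C h)
    C-even = all-even C ΣC² (λ j → κ j , even (Y-value (sh j)))
    fromHalves : (H : Fin 3 → ℤ) → (∀ h → C h ≡ + 2 * H h) → IsCutVector M C
    fromHalves H C≡2H with grid-coordinates H (halve-squares C H C≡2H ΣC²)
    ... | d , H≡grid = cut-vector-from-grid M (λ j → axis (sh j)) C d κ (λ j → index (sh j))
      (λ h → trans (C≡2H h) (cong (+ 2 *_) (H≡grid h))) ΣM² ΣC²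
      (λ j → Y-value (sh j)) (λ j → witness (sh j)) (λ j → axis-bal (sh j)) (λ j → axis-dot (sh j))

  -- Compatibility of indices

  open Pairing ℤ-algebra using (pairing; pairing-triple; pairing-cut)

  -- 36 times the inner product of the indexed vectors.
  form : Index → Index → ℤ
  form i i′ = pairing (blocks i) (λ h → + 6 * pairs i h) i′ + + 18

  infix 4 _∈0,36 _∈0,36?
  _∈0,36 : ℤ → Set
  z ∈0,36 = z ≡ 0ℤ ⊎ z ≡ + 36

  _∈0,36? : ∀ z → Dec (z ∈0,36)
  z ∈0,36? = (z ≟ 0ℤ) ⊎-dec (z ≟ + 36)

  -- A record rather than a synonym, so that the two indices can be read off the type and `form`
  -- does not unfold.
  record Compatible (i i′ : Index) : Set where
    constructor compatible
    field form-value : form i i′ ∈0,36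
  open Compatible

  form-comm : ∀ i i′ → form i i′ ≡ form i′ i
  form-comm i i′ = cong (_+ + 18) (cong₂ (λ a b → a + + 3 * b)
    (sum-cong-≗ (λ h → dot-comm (blocks i h) (blocks i′ h)))
    (sum-cong-≗ (λ h → ring (pairs i h) (pairs i′ h))))
    where
    ring : ∀ a b → + 6 * a * b ≡ + 6 * b * a
    ring = solve-∀

  compatible-sym : ∀ {i i′} → Compatible i i′ → Compatible i′ i
  compatible-sym {i} {i′} (compatible v) = compatible (subst _∈0,36 (form-comm i i′) v)

  kind : Index → Fin 4
  kind (triple _ _ _ _) = 0F
  kind (cut j _ _ _)    = suc j

  Valid : Index → Set
  Valid (triple _ _ _ _) = ⊤
  Valid (cut _ x _ _)    = Balanced (signs x)

  corner-sum : ∀ σ i → sum (λ k → sgn σ * (+ 1 + - + 6 * unit {6} i k)) ≡ 0ℤ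
  corner-sum = from-yes (allBool? λ σ → all? λ i → sum (λ k → sgn σ * (+ 1 + - + 6 * unit {6} i k)) ≟ 0ℤ)

  blocks-sum : ∀ i → Valid i → ∀ h → sum (blocks i h) ≡ 0ℤ
  blocks-sum (triple σ i j l) _ h = corner-sum σ ((i F.∷ j F.∷ l F.∷ F.[]) h)
  blocks-sum (cut j x y z) x-bal h = insert j h
    where
    tripled : sum (λ k → + 3 * signs x k) ≡ 0ℤ
    tripled = trans (sym (*-distribˡ-sum (+ 3) (signs x))) (cong (+ 3 *_) (sum-zero x-bal))
    insert : ∀ j h → sum (blocks (cut j x y z) h) ≡ 0ℤ
    insert 0F 0F = tripled
    insert 0F 1F = refl
    insert 0F 2F = refl
    insert 1F 0F = refl
    insert 1F 1F = tripled
    insert 1F 2F = refl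
    insert 2F 0F = refl
    insert 2F 1F = refl
    insert 2F 2F = tripled

  cut-entry : ∀ j x y z i₀ i₁ i₂ → let B = blocks (cut j x y z) in
    ∃[ b ] B 0F i₀ + (B 1F i₁ + B 2F i₂) ≡ + 3 * sgn b
  cut-entry 0F x y z i₀ i₁ i₂ = Vec.lookup x i₀ , +-identityʳ _
  cut-entry 1F x y z i₀ i₁ i₂ = Vec.lookup x i₁ , trans (+-identityˡ _) (+-identityʳ _)
  cut-entry 2F x y z i₀ i₁ i₂ = Vec.lookup x i₂ , trans (+-identityˡ _) (+-identityˡ _)

  -- The blocks of a cut sum to 0, so a triple reads off a single entry ±3 of it. The scaled product
  -- is then 18 ± 18, whatever the signs.
  cut-triple : ∀ i j x y z σ i₀ i₁ i₂ → i ≡ cut j x y z → Valid i → Compatible i (triple σ i₀ i₁ i₂)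
  cut-triple i@(cut j x y z) j x y z σ i₀ i₁ i₂ refl valid =
    compatible (subst _∈0,36 (sym value) (cases σ (proj₁ entry)))
    where
    entry = cut-entry j x y z i₀ i₁ i₂
    value : form i (triple σ i₀ i₁ i₂) ≡ - + 6 * sgn σ * (+ 3 * sgn (proj₁ entry)) + + 18
    value = cong (_+ + 18) (trans
      (pairing-triple (blocks i) (λ h → + 6 * pairs i h) σ i₀ i₁ i₂ (blocks-sum i valid))
      (cong (λ z → - + 6 * sgn σ * z) (proj₂ entry)))
    cases : ∀ σ b → let w = - + 6 * sgn σ * (+ 3 * sgn b) + + 18 in w ∈0,36
    cases true  true  = inj₁ refl
    cases true  false = inj₂ refl
    cases false true  = inj₂ refl
    cases false false = inj₁ refl

  -- The block parts have disjoint supports, and exactly one of v₄, v₅, v₆ is nonzero in both cuts.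
  -- It contributes ±18, so the scaled product is again 18 ± 18.
  cut-cut : ∀ j x y z j′ x′ y′ z′ → j ≢ j′ → Compatible (cut j x y z) (cut j′ x′ y′ z′)
  cut-cut j x y z j′ x′ y′ z′ j≢j′ =
    compatible (subst _∈0,36 (sym value) (values j j′ j≢j′ y z y′ z′))
    where
    rest w : Fin 3 → Fin 3 → Bool → Bool → Bool → Bool → ℤ
    rest j j′ y z y′ z′ = + 6 * F.insertAt (sgn y F.∷ sgn z F.∷ F.[]) j 0ℤ (punchIn j′ 0F) * sgn y′
      + + 6 * F.insertAt (sgn y F.∷ sgn z F.∷ F.[]) j 0ℤ (punchIn j′ 1F) * sgn z′
    w j j′ y z y′ z′ = + 3 * (0ℤ + rest j j′ y z y′ z′) + + 18
    values : ∀ j j′ → j ≢ j′ → ∀ y z y′ z′ → w j j′ y z y′ z′ ∈0,36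
    values = from-yes (all? λ j → all? λ j′ → ¬? (j Fin.≟ j′) →-dec (
      allBool? λ y → allBool? λ z → allBool? λ y′ → allBool? λ z′ →
      w j j′ y z y′ z′ ∈0,36?))
    disjoint : ∀ j j′ → j ≢ j′ → dot (blocks (cut j x y z) j′) (signs x′) ≡ 0ℤ
    disjoint 0F 0F j≢ = contradiction refl j≢
    disjoint 0F 1F _  = dot-0ˡ (signs x′)
    disjoint 0F 2F _  = dot-0ˡ (signs x′)
    disjoint 1F 0F _  = dot-0ˡ (signs x′)
    disjoint 1F 1F j≢ = contradiction refl j≢
    disjoint 1F 2F _  = dot-0ˡ (signs x′)
    disjoint 2F 0F _  = dot-0ˡ (signs x′)
    disjoint 2F 1F _  = dot-0ˡ (signs x′)
    disjoint 2F 2F j≢ = contradiction refl j≢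
    value : form (cut j x y z) (cut j′ x′ y′ z′) ≡ w j j′ y z y′ z′
    value = cong (_+ + 18) (trans
      (pairing-cut (blocks (cut j x y z)) (λ h → + 6 * pairs (cut j x y z) h) j′ x′ y′ z′)
      (cong (λ d → + 3 * (d + rest j j′ y z y′ z′)) (disjoint j j′ j≢j′)))

  compatible-kinds : ∀ i i′ → Valid i → Valid i′ → kind i ≢ kind i′ → Compatible i i′
  compatible-kinds (triple _ _ _ _) (triple _ _ _ _) _ _ ≢ = contradiction refl ≢
  compatible-kinds i@(triple σ a b c) i′@(cut j x y z) _ v ≢ =
    compatible-sym (cut-triple i′ j x y z σ a b c refl v)
  compatible-kinds i@(cut j x y z) (triple σ a b c) v _ ≢ = cut-triple i j x y z σ a b c refl v
  compatible-kinds (cut j x y z) (cut j′ x′ y′ z′) _ _ ≢ =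
    cut-cut j x y z j′ x′ y′ z′ (λ j≡ → ≢ (cong suc j≡))

  length-filter-split : ∀ {A : Set} {P : Pred A 0ℓ} (P? : Decidable P) (xs : List A) →
    length (List.filter P? xs) ℕ.+ length (List.filter (¬? ∘ P?) xs) ≡ length xs
  length-filter-split P? [] = refl
  length-filter-split P? (x ∷ xs) with P? x
  ... | yes _ = cong suc (length-filter-split P? xs)
  ... | no  _ = trans (ℕ.+-suc _ _) (cong suc (length-filter-split P? xs))

  -- Two agreeing positions contribute an entry -5 each and the third is -5 or 1; the scaled product
  -- is then one of 108, 72, -36, -72.
  bad-values : ∀ σ σ′ b → ¬ (- + 6 * sgn σ′ * (sgn σ * - + 5 + (sgn σ * - + 5 + sgn σ * (if b then - + 5 else + 1))) + + 18 ∈0,36)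
  bad-values = from-yes (allBool? λ σ → allBool? λ σ′ → allBool? λ b → ¬?
    (- + 6 * sgn σ′ * (sgn σ * - + 5 + (sgn σ * - + 5 + sgn σ * (if b then - + 5 else + 1))) + + 18 ∈0,36?))

  unit-refl : ∀ {n} (i : Fin n) → unit i i ≡ + 1
  unit-refl zero    = refl
  unit-refl (suc i) = unit-refl i

  corner : ∀ {n} → Fin n → Fin n → ℤ
  corner i k = + 1 + - + 6 * unit i k

  corner-refl : ∀ {n} (i : Fin n) → corner i i ≡ - + 5
  corner-refl i = cong (λ u → + 1 + - + 6 * u) (unit-refl i)

  corner-value : ∀ {n} (i k : Fin n) → ∃[ b ] corner i k ≡ (if b then - + 5 else + 1)
  corner-value zero    zero    = true , refl
  corner-value zero    (suc k) = false , refl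
  corner-value (suc i) zero    = false , refl
  corner-value (suc i) (suc k) = corner-value i k

  form-triple : ∀ σ i j l σ′ i′ j′ l′ → form (triple σ i j l) (triple σ′ i′ j′ l′) ≡
    - + 6 * sgn σ′ * (sgn σ * corner i i′ + (sgn σ * corner j j′ + sgn σ * corner l l′)) + + 18
  form-triple σ i j l σ′ i′ j′ l′ = cong (_+ + 18)
    (pairing-triple (blocks (triple σ i j l)) (λ _ → + 6 * 0ℤ) σ′ i′ j′ l′ (blocks-sum (triple σ i j l) tt))

  module _ {σ i j l σ′ i′ j′ l′} (c : Compatible (triple σ i j l) (triple σ′ i′ j′ l′)) where

    private
      value : ∀ {a b d} → sgn σ * corner i i′ + (sgn σ * corner j j′ + sgn σ * corner l l′) ≡
        sgn σ * a + (sgn σ * b + sgn σ * d) → - + 6 * sgn σ′ * (sgn σ * a + (sgn σ * b + sgn σ * d)) + + 18 ∈0,36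
      value eq = subst _∈0,36 (trans (form-triple σ i j l σ′ i′ j′ l′) (cong (λ w → - + 6 * sgn σ′ * w + + 18) eq)) (form-value c)

      scaled : ∀ {a b} → a ≡ b → sgn σ * a ≡ sgn σ * b
      scaled = cong (sgn σ *_)

    row-column≢ : i ≡ i′ → j ≢ j′
    row-column≢ refl refl with corner-value l l′
    ... | b , l≡ = bad-values σ σ′ b (value
      (cong₂ (λ x y → x + y) (scaled (corner-refl i)) (cong₂ (λ x y → x + y) (scaled (corner-refl j)) (scaled l≡))))

    row-symbol≢ : i ≡ i′ → l ≢ l′
    row-symbol≢ refl refl with corner-value j j′
    ... | b , j≡ = bad-values σ σ′ b (value
      (trans (cong₂ (λ x y → x + y) (scaled (corner-refl i)) (cong₂ (λ x y → x + y) (scaled j≡) (scaled (corner-refl l))))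
        (cong (λ z → sgn σ * - + 5 + z) (+-comm (sgn σ * (if b then - + 5 else + 1)) (sgn σ * - + 5)))))

    column-symbol≢ : j ≡ j′ → l ≢ l′
    column-symbol≢ refl refl with corner-value i i′
    ... | b , i≡ = bad-values σ σ′ b (value
      (trans (cong₂ (λ x y → x + y) (scaled i≡) (cong₂ (λ x y → x + y) (scaled (corner-refl j)) (scaled (corner-refl l))))
        (trans (+-comm (sgn σ * (if b then - + 5 else + 1)) (sgn σ * - + 5 + sgn σ * - + 5))
          (+-assoc (sgn σ * - + 5) (sgn σ * - + 5) _))))

  -- Cliques of cuts

  record Cut : Set where
    constructor mkCut
    field
      sides : Vec Bool 6
      sign₁ sign₂ : Bool
  open Cut

  toIndex : Fin 3 → Cut → Index
  toIndex j (mkCut x y z) = cut j x y z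

  -- A cut and its negative describe the same line; the sign is chosen such that
  -- the first pair has sign +.
  signed : Cut → Vector ℤ 6
  signed (mkCut x y z) k = sgn y * signs x k

  times : Bool → Bool → Bool
  times true  b = b
  times false b = not b

  sgn-times : ∀ a b → sgn (times a b) ≡ sgn a * sgn b
  sgn-times true  true  = refl
  sgn-times true  false = refl
  sgn-times false true  = refl
  sgn-times false false = refl

  -- κ is the product of the two pair signs. It is unchanged when the cut is negated, and after
  -- normalisation the pair signs are + and κ.
  InClass : Bool → Cut → Set
  InClass κ c = sign₂ c ≡ times κ (sign₁ c)

  inClass? : ∀ κ → Decidable (InClass κ)
  inClass? κ c = sign₂ c Bool.≟ times κ (sign₁ c)

  class-lengths : ∀ cs → length (List.filter (inClass? true) cs) ℕ.+ length (List.filter (inClass? false) cs) ≡ length cs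
  class-lengths []                        = refl
  class-lengths (mkCut _ true  true  ∷ cs) = cong suc (class-lengths cs)
  class-lengths (mkCut _ false false ∷ cs) = cong suc (class-lengths cs)
  class-lengths (mkCut _ true  false ∷ cs) = trans (ℕ.+-suc _ _) (cong suc (class-lengths cs))
  class-lengths (mkCut _ false true  ∷ cs) = trans (ℕ.+-suc _ _) (cong suc (class-lengths cs))

  signed-balanced : ∀ c → Balanced (signs (sides c)) → Balanced (signed c)
  signed-balanced (mkCut x y z) b .isSign k = product (sgn-isSign y) (isSign b k)
    where
    product : ∀ {a b} → IsSign a → IsSign b → IsSign (a * b)
    product (inj₁ refl) (inj₁ refl) = inj₁ refl
    product (inj₁ refl) (inj₂ refl) = inj₂ refl
    product (inj₂ refl) (inj₁ refl) = inj₂ refl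
    product (inj₂ refl) (inj₂ refl) = inj₁ refl
  signed-balanced (mkCut x y z) b .sum-zero = trans (sym (*-distribˡ-sum (sgn y) (signs x)))
    (trans (cong (sgn y *_) (sum-zero b)) (*-zeroʳ (sgn y)))

  dot-signed : ∀ x y M → dot (λ k → sgn y * signs x k) M ≡ sgn y * dot M (signs x)
  dot-signed x y M = trans (dot-*ˡ (sgn y) (signs x) M) (cong (sgn y *_) (dot-comm (signs x) M))

  -- The three clauses are the same argument; the split on `j` only lets `F.insertAt` compute.
  form-cut : ∀ j x y z x′ y′ z′ → form (cut j x y z) (cut j x′ y′ z′) ≡
    + 3 * (+ 3 * dot (signs x) (signs x′) + (+ 6 * sgn y * sgn y′ + + 6 * sgn z * sgn z′)) + + 18
  form-cut 0F x y z x′ y′ z′ = cong (_+ + 18) (trans (pairing-cut (blocks (cut 0F x y z)) (λ h → + 6 * pairs (cut 0F x y z) h) 0F x′ y′ z′)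
    (cong (λ d → + 3 * (d + (+ 6 * sgn y * sgn y′ + + 6 * sgn z * sgn z′))) (dot-*ˡ (+ 3) (signs x) (signs x′))))
  form-cut 1F x y z x′ y′ z′ = cong (_+ + 18) (trans (pairing-cut (blocks (cut 1F x y z)) (λ h → + 6 * pairs (cut 1F x y z) h) 1F x′ y′ z′)
    (cong (λ d → + 3 * (d + (+ 6 * sgn y * sgn y′ + + 6 * sgn z * sgn z′))) (dot-*ˡ (+ 3) (signs x) (signs x′))))
  form-cut 2F x y z x′ y′ z′ = cong (_+ + 18) (trans (pairing-cut (blocks (cut 2F x y z)) (λ h → + 6 * pairs (cut 2F x y z) h) 2F x′ y′ z′)
    (cong (λ d → + 3 * (d + (+ 6 * sgn y * sgn y′ + + 6 * sgn z * sgn z′))) (dot-*ˡ (+ 3) (signs x) (signs x′))))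

  -- Within a class, the product of two signed vectors is -4 ± 2.
  obtuse : ∀ κ j c c′ → InClass κ c → InClass κ c′ → Compatible (toIndex j c) (toIndex j c′) → Obtuse (signed c) (signed c′)
  obtuse κ j (mkCut x y _) (mkCut x′ y′ _) refl refl (compatible v) = subst (_≤ - + 2) (sym products)
    (bound κ y y′ (dot (signs x) (signs x′)) (subst _∈0,36 (form-cut j x y (times κ y) x′ y′ (times κ y′)) v))
    where
    products : dot (signed (mkCut x y (times κ y))) (signed (mkCut x′ y′ (times κ y′))) ≡ sgn y * (sgn y′ * dot (signs x) (signs x′))
    products = trans (dot-signed x y (signed (mkCut x′ y′ (times κ y′)))) (cong (sgn y *_)
      (trans (dot-*ˡ (sgn y′) (signs x′) (signs x)) (cong (sgn y′ *_) (dot-comm (signs x′) (signs x)))))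
    ninth : ∀ d a w → + 3 * (+ 3 * d + a) + + 18 ≡ w → + 9 * d ≡ w - + 18 - + 3 * a
    ninth d a w refl = ring d a
      where
      ring : ∀ d a → + 9 * d ≡ (+ 3 * (+ 3 * d + a) + + 18) - + 18 - + 3 * a
      ring = solve-∀
    same : ∀ d → + 3 * (+ 3 * d + + 12) + + 18 ∈0,36 → d ≤ - + 2
    same d (inj₁ eq) = subst (_≤ - + 2) (sym (*-cancelˡ-≡ (+ 9) d (- + 6) (ninth d (+ 12) 0ℤ eq))) (-≤- (s≤s z≤n))
    same d (inj₂ eq) = subst (_≤ - + 2) (sym (*-cancelˡ-≡ (+ 9) d (- + 2) (ninth d (+ 12) (+ 36) eq))) ≤-refl
    opposite : ∀ d → + 3 * (+ 3 * d + - + 12) + + 18 ∈0,36 → - + 1 * d ≤ - + 2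
    opposite d (inj₁ eq) = subst (λ d → - + 1 * d ≤ - + 2) (sym (*-cancelˡ-≡ (+ 9) d (+ 2) (ninth d (- + 12) 0ℤ eq))) ≤-refl
    opposite d (inj₂ eq) = subst (λ d → - + 1 * d ≤ - + 2) (sym (*-cancelˡ-≡ (+ 9) d (+ 6) (ninth d (- + 12) (+ 36) eq))) (-≤- (s≤s z≤n))
    flip : ∀ {d e} → d ≡ e → e ≤ - + 2 → d ≤ - + 2
    flip d≡e = subst (_≤ - + 2) (sym d≡e)
    minus : ∀ d → - + 1 * (- + 1 * d) ≡ d
    minus = solve-∀
    bound : ∀ κ y y′ d → + 3 * (+ 3 * d + (+ 6 * sgn y * sgn y′ + + 6 * sgn (times κ y) * sgn (times κ y′))) + + 18 ∈0,36 →
      sgn y * (sgn y′ * d) ≤ - + 2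
    bound true  true  true  d v = flip (trans (*-identityˡ _) (*-identityˡ d)) (same d v)
    bound true  false false d v = flip (minus d) (same d v)
    bound true  true  false d v = flip (*-identityˡ _) (opposite d v)
    bound true  false true  d v = flip (cong (- + 1 *_) (*-identityˡ d)) (opposite d v)
    bound false true  true  d v = flip (trans (*-identityˡ _) (*-identityˡ d)) (same d v)
    bound false false false d v = flip (minus d) (same d v)
    bound false true  false d v = flip (*-identityˡ _) (opposite d v)
    bound false false true  d v = flip (cong (- + 1 *_) (*-identityˡ d)) (opposite d v)

  -- An inner product 0 or 1, multiplied by 36 and freed of the 18 coming from v₇, is -18 or +18.
  record Meets (M : Fin 3 → Vector ℤ 6) (C : Fin 3 → ℤ) (i : Index) : Set where
    constructor meets
    field
      side          : Bool
      pairing-value : pairing M C i ≡ + 18 * sgn side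

  meets⇒hits : ∀ M C j c κ → InClass κ c → Meets M C (toIndex j c) → Hits (M j) (combine± C j κ) (signed c)
  meets⇒hits M C j (mkCut x y z) κ refl (meets σ eq) = times y σ , (begin
    dot (signed (mkCut x y z)) (M j) + combine± C j κ
      ≡⟨ cong (_+ combine± C j κ) (dot-signed x y (M j)) ⟩
    sgn y * d + (c + sgn κ * c′)
      ≡⟨ cong (λ w → sgn y * d + w) (sym (trans (cong (_* (c + sgn κ * c′)) (IsSign⇒square (sgn-isSign y))) (*-identityˡ _))) ⟩
    sgn y * d + sgn y * sgn y * (c + sgn κ * c′)
      ≡⟨ ring (sgn y) d c c′ (sgn κ) ⟩
    sgn y * (d + (c * sgn y + c′ * (sgn κ * sgn y)))
      ≡⟨ cong (λ w → sgn y * (d + (c * sgn y + c′ * w))) (sym (sgn-times κ y)) ⟩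
    sgn y * (d + (c * sgn y + c′ * sgn z))
      ≡⟨ cong (sgn y *_) (*-cancelˡ-≡ (+ 3) _ _ (trans (sym (pairing-cut M C j x y z)) (trans eq (*-assoc (+ 3) (+ 6) (sgn σ))))) ⟩
    sgn y * (+ 6 * sgn σ)
      ≡⟨ ring′ (sgn y) (sgn σ) ⟩
    + 6 * (sgn y * sgn σ)
      ≡⟨ cong (+ 6 *_) (sym (sgn-times y σ)) ⟩
    + 6 * sgn (times y σ) ∎)
    where
    open ≡-Reasoning
    d = dot (M j) (signs x)
    c = C (punchIn j 0F)
    c′ = C (punchIn j 1F)
    ring : ∀ y d c c′ κ → y * d + y * y * (c + κ * c′) ≡ y * (d + (c * y + c′ * (κ * y)))
    ring = solve-∀
    ring′ : ∀ y s → y * (+ 6 * s) ≡ + 6 * (y * s)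
    ring′ = solve-∀

  module Clique (j : Fin 3) (cs : List Cut) (valid : All (λ c → Balanced (signs (sides c))) cs)
    (clique : AllPairs (λ c c′ → Compatible (toIndex j c) (toIndex j c′)) cs) where

    class : Bool → List (Vector ℤ 6)
    class κ = List.map signed (List.filter (inClass? κ) cs)

    class-balanced : ∀ κ → All Balanced (class κ)
    class-balanced κ = All.map⁺ (All.map (λ {c} → signed-balanced c) (All.filter⁺ (inClass? κ) valid))

    class-obtuse : ∀ κ → AllPairs Obtuse (class κ)
    class-obtuse κ = AllPairs.map⁺ (pairwise (All.all-filter (inClass? κ) cs) (AllPairs.filter⁺ (inClass? κ) clique))
      where
      pairwise : ∀ {cs} → All (InClass κ) cs → AllPairs (λ c c′ → Compatible (toIndex j c) (toIndex j c′)) cs →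
        AllPairs (λ c c′ → Obtuse (signed c) (signed c′)) cs
      pairwise []       []       = []
      pairwise {c ∷ _} (p ∷ ps) (q ∷ qs) = All.zipWith (λ { {c′} (p′ , q′) → obtuse κ j c c′ p p′ q′ }) (ps , q) ∷ pairwise ps qs

    lengths : length (class true) ℕ.+ length (class false) ≡ length cs
    lengths = trans (cong₂ ℕ._+_ (List.length-map signed (List.filter (inClass? true) cs))
      (List.length-map signed (List.filter (inClass? false) cs))) (class-lengths cs)

    -- The opposite class takes at most four of the seven. A member of each class is wanted because
    -- one class controls the sum of the two pair entries and the other their difference.
    class-inhabited : 7 ℕ.≤ length cs → ∀ κ → ∃[ c ] c ∈ˡ cs × InClass κ c
    class-inhabited 7≤ κ = pick κ (inhabited (length (class (not κ))) (at-most-four (class-balanced (not κ)) (class-obtuse (not κ)))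
      (ℕ.≤-trans 7≤ (ℕ.≤-reflexive (sym (ordered κ)))))
      where
      ordered : ∀ κ → length (class (not κ)) ℕ.+ length (class κ) ≡ length cs
      ordered true  = trans (ℕ.+-comm (length (class false)) (length (class true))) lengths
      ordered false = lengths
      inhabited : ∀ m {n} → m ℕ.≤ 4 → 7 ℕ.≤ m ℕ.+ n → 1 ℕ.≤ n
      inhabited m {suc n} _ _ = s≤s z≤n
      inhabited m {zero} m≤4 7≤ = contradiction
        (ℕ.≤-trans 7≤ (ℕ.≤-trans (ℕ.≤-reflexive (ℕ.+-identityʳ m)) m≤4)) λ { (s≤s (s≤s (s≤s (s≤s ())))) }
      pick : ∀ κ → 1 ℕ.≤ length (class κ) → ∃[ c ] c ∈ˡ cs × InClass κ c
      pick κ 1≤ with List.filter (inClass? κ) cs in eq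
      ... | c ∷ _ = c , ∈-filter⁻ (inClass? κ) (subst (c ∈ˡ_) (sym eq) (here refl))

    clique-shadow : ∀ M C → sum (M j) ≡ 0ℤ → All (λ c → Meets M C (toIndex j c)) cs → 7 ℕ.≤ length cs →
      ∃[ κ ] Shadow (M j) (combine± C j κ) (combine± C j (not κ))
    clique-shadow M C ΣM≡0 cs-meet 7≤ = Sum.[ (true ,_) , (false ,_) ]
      (profile {M j} {combine± C j true} {combine± C j false} ΣM≡0 (class true) (class false) (properties true) (properties false)
        (subst (7 ℕ.≤_) (sym lengths) 7≤))
      where
      properties : ∀ κ → Class (M j) (combine± C j κ) (class κ)
      properties κ = class-balanced κ , class-obtuse κ , All.map⁺ (All.zipWith (λ { {c} (p , m) → meets⇒hits M C j c κ p m })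
        (All.all-filter (inClass? κ) cs , All.filter⁺ (inClass? κ) cs-meet))

  -- Cliques of triples and Latin squares

  injective⇒onto : ∀ {m n} (f : Fin n → Fin m) → (∀ {k k′} → f k ≡ f k′ → k ≡ k′) → m ℕ.≤ n → ∀ y → ∃[ k ] f k ≡ y
  injective⇒onto {suc m} {n} f f-inj m<n y with Fin.any? (λ k → f k Fin.≟ y)
  ... | yes found = found
  ... | no  ¬found = contradiction
    (Fin.injective⇒≤ {f = λ k → punchOut (missed k)} (λ eq → f-inj (Fin.punchOut-injective (missed _) (missed _) eq)))
    (ℕ.<⇒≱ m<n)
    where
    missed : ∀ k → y ≢ f k
    missed k eq = ¬found (k , sym eq)

  allPairs-lookup : ∀ {A : Set} {R : A → A → Set} → (∀ {x y} → R x y → R y x) → ∀ {xs} → AllPairs R xs →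
    ∀ {k k′} → k ≢ k′ → R (List.lookup xs k) (List.lookup xs k′)
  allPairs-lookup R-sym {_ ∷ _} (_ ∷ _)  {zero}  {zero}   ≢ = contradiction refl ≢
  allPairs-lookup R-sym {_ ∷ _} (r ∷ _) {zero}  {suc k′} ≢ = All.lookup r (∈-lookup k′)
  allPairs-lookup R-sym {_ ∷ _} (r ∷ _) {suc k} {zero}   ≢ = R-sym (All.lookup r (∈-lookup k))
  allPairs-lookup R-sym {_ ∷ _} (_ ∷ rs) {suc k} {suc k′} ≢ = allPairs-lookup R-sym rs (λ eq → ≢ (cong suc eq))

  record LatinSquare : Set where
    field
      entry            : Fin 6 → Fin 6 → Fin 6
      row-injective    : ∀ i {j j′} → entry i j ≡ entry i j′ → j ≡ j′
      column-injective : ∀ j {i i′} → entry i j ≡ entry i′ j → i ≡ i′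

  -- The value at a cut is a dummy; these projections are applied under `IsTriple`.
  row column symbol : Index → Fin 6
  row    (triple _ i _ _) = i
  row    (cut _ _ _ _)    = 0F
  column (triple _ _ j _) = j
  column (cut _ _ _ _)    = 0F
  symbol (triple _ _ _ l) = l
  symbol (cut _ _ _ _)    = 0F

  IsTriple : Index → Set
  IsTriple i = kind i ≡ 0F

  module _ {t t′} (c : Compatible t t′) (p : IsTriple t) (p′ : IsTriple t′) where
    row-column-clash : row t ≡ row t′ → column t ≢ column t′
    row-column-clash = clash t t′ c p p′
      where
      clash : ∀ t t′ → Compatible t t′ → IsTriple t → IsTriple t′ → row t ≡ row t′ → column t ≢ column t′
      clash (triple _ _ _ _) (triple _ _ _ _) c _ _ = row-column≢ c
    row-symbol-clash : row t ≡ row t′ → symbol t ≢ symbol t′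
    row-symbol-clash = clash t t′ c p p′
      where
      clash : ∀ t t′ → Compatible t t′ → IsTriple t → IsTriple t′ → row t ≡ row t′ → symbol t ≢ symbol t′
      clash (triple _ _ _ _) (triple _ _ _ _) c _ _ = row-symbol≢ c
    column-symbol-clash : column t ≡ column t′ → symbol t ≢ symbol t′
    column-symbol-clash = clash t t′ c p p′
      where
      clash : ∀ t t′ → Compatible t t′ → IsTriple t → IsTriple t′ → column t ≡ column t′ → symbol t ≢ symbol t′
      clash (triple _ _ _ _) (triple _ _ _ _) c _ _ = column-symbol≢ c

  -- 36 triples, any two agreeing in at most one position, are the cells of a Latin square.
  module Triples (ts : List Index) (triples : All IsTriple ts) (clique : AllPairs Compatible ts) (36≤ : 36 ℕ.≤ length ts) where
    private
      at : Fin (length ts) → Index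
      at = List.lookup ts
      isTriple : ∀ k → IsTriple (at k)
      isTriple k = All.lookup triples (∈-lookup k)
      -- Compatibility forbids distinct list entries a second agreement. The three choices of `f`
      -- and `g` give the injectivity of cells, rows and columns.
      agree : (f g : Index → Fin 6) →
        (∀ {t t′} → Compatible t t′ → IsTriple t → IsTriple t′ → f t ≡ f t′ → g t ≢ g t′) →
        ∀ {k k′} → f (at k) ≡ f (at k′) → g (at k) ≡ g (at k′) → k ≡ k′
      agree f g clash {k} {k′} f≡ g≡ with k Fin.≟ k′
      ... | yes k≡k′ = k≡k′
      ... | no  k≢k′ = contradiction g≡ (clash (allPairs-lookup compatible-sym clique k≢k′) (isTriple k) (isTriple k′) f≡)
      cell : Fin (length ts) → Fin 36
      cell k = combine {6} {6} (row (at k)) (column (at k))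
      cell-injective : ∀ {k k′} → cell k ≡ cell k′ → k ≡ k′
      cell-injective {k} {k′} eq = agree row column row-column-clash
        (Fin.combine-injectiveˡ (row (at k)) (column (at k)) (row (at k′)) (column (at k′)) eq)
        (Fin.combine-injectiveʳ (row (at k)) (column (at k)) (row (at k′)) (column (at k′)) eq)
      onto : ∀ i j → ∃[ k ] cell k ≡ combine {6} {6} i j
      onto i j = injective⇒onto cell cell-injective 36≤ (combine {6} {6} i j)
      position : Fin 6 → Fin 6 → Fin (length ts)
      position i j = proj₁ (onto i j)
      row≡ : ∀ i j → row (at (position i j)) ≡ i
      row≡ i j = Fin.combine-injectiveˡ (row (at (position i j))) (column (at (position i j))) i j (proj₂ (onto i j))
      column≡ : ∀ i j → column (at (position i j)) ≡ j
      column≡ i j = Fin.combine-injectiveʳ (row (at (position i j))) (column (at (position i j))) i j (proj₂ (onto i j))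

    square : LatinSquare
    square = record
      { entry = λ i j → symbol (at (position i j))
      ; row-injective = λ i {j} {j′} eq → trans (sym (column≡ i j)) (trans
          (cong (column ∘ at) (agree row symbol row-symbol-clash (trans (row≡ i j) (sym (row≡ i j′))) eq)) (column≡ i j′))
      ; column-injective = λ j {i} {i′} eq → trans (sym (row≡ i j)) (trans
          (cong (row ∘ at) (agree column symbol column-symbol-clash (trans (column≡ i j) (sym (column≡ i′ j))) eq)) (row≡ i′ j))
      }

    open LatinSquare square

    -- Nothing determines the sign of the triple that fills a cell, hence the existential over σ.
    cells : {Q : Index → Set} → All Q ts → ∀ i j → ∃[ σ ] Q (triple σ i j (entry i j))
    cells {Q} qs i j = fromTriple (at (position i j)) (isTriple (position i j)) (row≡ i j) (column≡ i j)
      (All.lookup qs (∈-lookup (position i j)))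
      where
      fromTriple : ∀ t → IsTriple t → row t ≡ i → column t ≡ j → Q t → ∃[ σ ] Q (triple σ i j (symbol t))
      fromTriple (triple σ _ _ _) _ refl refl q = σ , q

  module Permuted (𝔸 : ℤ-Algebra) where
    open ℤ-Algebra 𝔸 using (Carrier; _≈_)
    open Pairing 𝔸 using (sum-permute) renaming (sum to sumᴬ)

    sum-injective : ∀ {n} (f : Vector Carrier n) (π : Fin n → Fin n) → (∀ {k k′} → π k ≡ π k′ → k ≡ k′) →
      sumᴬ f ≈ sumᴬ (f ∘ π)
    sum-injective f π π-inj = sum-permute f (Perm.permutation π (λ y → proj₁ (inv y))
      (λ y → proj₂ (inv y)) (λ x → π-inj (proj₂ (inv (π x)))))
      where inv = injective⇒onto π π-inj ℕ.≤-refl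

  open Permuted ℤ-algebra using (sum-injective)

  sq-sgn : ∀ σ → sq (+ 3 * sgn σ) ≡ + 9
  sq-sgn true  = refl
  sq-sgn false = refl

  sixfold-sum : ∀ x → sum {6} (λ _ → x) ≡ + 6 * x
  sixfold-sum = ring
    where
    ring : ∀ x → x + (x + (x + (x + (x + (x + 0ℤ))))) ≡ + 6 * x
    ring = solve-∀

  square-sum : ∀ x (b c : Vector ℤ 6) → sum b ≡ 0ℤ → sum c ≡ 0ℤ →
    sum (λ j → sq (x + (b j + c j))) ≡ + 6 * (x * x) + (dot b b + (dot c c + + 2 * dot b c))
  square-sum x b c Σb≡0 Σc≡0 = begin
    sum (λ j → sq (x + (b j + c j)))
      ≡⟨ sum-cong-≗ (λ j → ring x (b j) (c j)) ⟩
    sum (λ j → x * x + (b j * b j + (c j * c j + (+ 2 * (b j * c j) + + 2 * x * (b j + c j)))))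
      ≡⟨ ∑-distrib-+ (λ _ → x * x) (λ j → b j * b j + (c j * c j + (+ 2 * (b j * c j) + + 2 * x * (b j + c j)))) ⟩
    X + sum (λ j → b j * b j + (c j * c j + (+ 2 * (b j * c j) + + 2 * x * (b j + c j))))
      ≡⟨ cong (λ z → X + z) (∑-distrib-+ (λ j → b j * b j) (λ j → c j * c j + (+ 2 * (b j * c j) + + 2 * x * (b j + c j)))) ⟩
    X + (dot b b + sum (λ j → c j * c j + (+ 2 * (b j * c j) + + 2 * x * (b j + c j))))
      ≡⟨ cong (λ z → X + (dot b b + z)) (∑-distrib-+ (λ j → c j * c j) (λ j → + 2 * (b j * c j) + + 2 * x * (b j + c j))) ⟩
    X + (dot b b + (dot c c + sum (λ j → + 2 * (b j * c j) + + 2 * x * (b j + c j))))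
      ≡⟨ cong (λ z → X + (dot b b + (dot c c + z))) (∑-distrib-+ (λ j → + 2 * (b j * c j)) (λ j → + 2 * x * (b j + c j))) ⟩
    X + (dot b b + (dot c c + (sum (λ j → + 2 * (b j * c j)) + sum (λ j → + 2 * x * (b j + c j)))))
      ≡⟨ cong₂ (λ y z → X + (dot b b + (dot c c + (y + z)))) (sym (*-distribˡ-sum (+ 2) (λ j → b j * c j))) (sym (*-distribˡ-sum (+ 2 * x) (λ j → b j + c j))) ⟩
    X + (dot b b + (dot c c + (+ 2 * dot b c + + 2 * x * sum (λ j → b j + c j))))
      ≡⟨ cong₂ (λ y z → y + (dot b b + (dot c c + (+ 2 * dot b c + + 2 * x * z)))) (sixfold-sum (x * x)) (trans (∑-distrib-+ b c) (cong₂ (λ y z → y + z) Σb≡0 Σc≡0)) ⟩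
    + 6 * (x * x) + (dot b b + (dot c c + (+ 2 * dot b c + + 2 * x * 0ℤ)))
      ≡⟨ cong (λ z → + 6 * (x * x) + (dot b b + (dot c c + z))) (trans (cong (λ z → + 2 * dot b c + z) (*-zeroʳ (+ 2 * x))) (+-identityʳ _)) ⟩
    + 6 * (x * x) + (dot b b + (dot c c + + 2 * dot b c)) ∎
    where
    open ≡-Reasoning
    X = sum {6} (λ _ → x * x)
    ring : ∀ x b c → (x + (b + c)) * (x + (b + c)) ≡ x * x + (b * b + (c * c + (+ 2 * (b * c) + + 2 * x * (b + c))))
    ring = solve-∀

  module LatinNorm (S : LatinSquare) (a b c : Vector ℤ 6)
    (Σb≡0 : sum b ≡ 0ℤ) (Σc≡0 : sum c ≡ 0ℤ) where
    open LatinSquare S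

    private
      row-perm : ∀ (f : Vector ℤ 6) i → sum (λ j → f (entry i j)) ≡ sum f
      row-perm f i = sym (sum-injective f (entry i) (row-injective i))
      column-perm : ∀ (f : Vector ℤ 6) j → sum (λ i → f (entry i j)) ≡ sum f
      column-perm f j = sym (sum-injective f (λ i → entry i j) (column-injective j))
      cross : sum (λ i → dot b (c ∘ entry i)) ≡ 0ℤ
      cross = begin
        sum (λ i → sum (λ j → b j * c (entry i j)))   ≡⟨ ∑-comm (λ i j → b j * c (entry i j)) ⟩
        sum (λ j → sum (λ i → b j * c (entry i j)))   ≡⟨ sum-cong-≗ (λ j → trans (sym (*-distribˡ-sum (b j) (λ i → c (entry i j))))
                                                           (trans (cong (b j *_) (trans (column-perm c j) Σc≡0)) (*-zeroʳ (b j)))) ⟩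
        sum {6} (λ _ → 0ℤ)                            ≡⟨ sum-replicate-zero 6 ⟩
        0ℤ                                            ∎
        where open ≡-Reasoning

    -- After expansion every mixed term has a factor `sum b` or `sum c`, because each symbol occurs
    -- once in every row and every column. Each of the three kinds of squares is counted six times.
    double-sum : sum (λ i → sum (λ j → sq (a i + (b j + c (entry i j))))) ≡ + 6 * (dot a a + (dot b b + (dot c c + 0ℤ)))
    double-sum = begin
      sum (λ i → sum (λ j → sq (a i + (b j + c (entry i j)))))
        ≡⟨ sum-cong-≗ (λ i → trans (square-sum (a i) b (c ∘ entry i) Σb≡0 (trans (row-perm c i) Σc≡0))
             (cong (λ z → + 6 * (a i * a i) + (dot b b + (z + + 2 * dot b (c ∘ entry i)))) (row-perm (λ l → c l * c l) i))) ⟩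
      sum (λ i → + 6 * (a i * a i) + (dot b b + (dot c c + + 2 * dot b (c ∘ entry i))))
        ≡⟨ ∑-distrib-+ (λ i → + 6 * (a i * a i)) (λ i → dot b b + (dot c c + + 2 * dot b (c ∘ entry i))) ⟩
      sum (λ i → + 6 * (a i * a i)) + sum (λ i → dot b b + (dot c c + + 2 * dot b (c ∘ entry i)))
        ≡⟨ cong₂ (λ y z → y + z) (sym (*-distribˡ-sum (+ 6) (λ i → a i * a i)))
             (∑-distrib-+ (λ _ → dot b b) (λ i → dot c c + + 2 * dot b (c ∘ entry i))) ⟩
      + 6 * dot a a + (sum {6} (λ _ → dot b b) + sum (λ i → dot c c + + 2 * dot b (c ∘ entry i)))
        ≡⟨ cong₂ (λ y z → + 6 * dot a a + (y + z)) (sixfold-sum (dot b b))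
             (∑-distrib-+ (λ _ → dot c c) (λ i → + 2 * dot b (c ∘ entry i))) ⟩
      + 6 * dot a a + (+ 6 * dot b b + (sum {6} (λ _ → dot c c) + sum (λ i → + 2 * dot b (c ∘ entry i))))
        ≡⟨ cong₂ (λ y z → + 6 * dot a a + (+ 6 * dot b b + (y + z))) (sixfold-sum (dot c c))
             (trans (sym (*-distribˡ-sum (+ 2) (λ i → dot b (c ∘ entry i)))) (cong (+ 2 *_) cross)) ⟩
      + 6 * dot a a + (+ 6 * dot b b + (+ 6 * dot c c + 0ℤ))
        ≡⟨ ring (dot a a) (dot b b) (dot c c) ⟩
      + 6 * (dot a a + (dot b b + (dot c c + 0ℤ))) ∎
      where
      open ≡-Reasoning
      ring : ∀ x y z → + 6 * x + (+ 6 * y + (+ 6 * z + 0ℤ)) ≡ + 6 * (x + (y + (z + 0ℤ)))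
      ring = solve-∀

  -- The 36 cells have square 9 each, and 36 · 9 = 324 = 6 · 54.
  latin-norm : ∀ S → let open LatinSquare S in ∀ (M : Fin 3 → Vector ℤ 6) → (∀ h → sum (M h) ≡ 0ℤ) →
    (∀ i j → ∃[ σ ] M 0F i + (M 1F j + M 2F (entry i j)) ≡ + 3 * sgn σ) → sum (λ h → dot (M h) (M h)) ≡ + 54
  latin-norm S M ΣM≡0 cell = *-cancelˡ-≡ (+ 6) _ (+ 54) (trans
    (sym (LatinNorm.double-sum S (M 0F) (M 1F) (M 2F) (ΣM≡0 1F) (ΣM≡0 2F)))
    (sum-cong-≗ {6} (λ i → sum-cong-≗ {6} (λ j → trans (cong sq (proj₂ (cell i j))) (sq-sgn (proj₁ (cell i j)))))))

  -- Integrality of an admissible vector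

  module Descent (𝔸 : ℤ-Algebra) where
    open Notation 𝔸
    open Pairing 𝔸 using (dotι; module Solver; sum-cong-≋; sum-replicate-zero)
      renaming (pairing to pairingᴬ; pairing-triple to pairing-tripleᴬ; pairing-cut to pairing-cutᴬ; sum to sumᴬ; ∑-distrib-+ to ∑-distrib-⊕)
    open Permuted 𝔸 renaming (sum-injective to sum-injectiveᴬ)
    open Solver using (solve; con; _:=_; _:+_; _:*_; _:-_; :-_)
    open import Relation.Binary.Reasoning.Setoid (ℤ-Algebra.setoid 𝔸)

    Integral : Carrier → Set
    Integral x = ∃[ m ] x ≈ ι m

    ι-sum : ∀ {n} (f : Vector ℤ n) → sumᴬ (ι ∘ f) ≈ ι (sum f)
    ι-sum {zero}  f = ≈-sym ι-0
    ι-sum {suc n} f = ≈-trans (⊕-congˡ (ι-sum (f ∘ suc))) (≈-sym (ι-+ (f zero) (sum (f ∘ suc))))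

    ι-dotι : ∀ {n} {P : Vector Carrier n} {M} → (∀ k → P k ≈ ι (M k)) → ∀ u → dotι P u ≈ ι (dot M u)
    ι-dotι {n} {P} {M} P≈M u = ≈-trans
      (sum-cong-≋ {n} (λ k → ≈-trans (⊗-congʳ (P≈M k)) (≈-sym (ι-* (M k) (u k)))))
      (ι-sum (λ k → M k * u k))

    ι-pairing : ∀ {P g M C} → (∀ h k → P h k ≈ ι (M h k)) → (∀ h → g h ≈ ι (C h)) →
      ∀ i → pairingᴬ P g i ≈ ι (pairing M C i)
    ι-pairing {P} {g} {M} {C} P≈M g≈C i = begin
      pairingᴬ P g i
        ≈⟨ ⊕-cong (≈-trans (sum-cong-≋ {3} (λ h → ι-dotι (P≈M h) (blocks i h))) (ι-sum (λ h → dot (M h) (blocks i h))))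
             (⊗-congˡ (ι-dotι g≈C (pairs i))) ⟩
      ι (sum (λ h → dot (M h) (blocks i h))) ⊕ ι (+ 3) ⊗ ι (dot C (pairs i))
        ≈⟨ ⊕-congˡ (ι-* (+ 3) (dot C (pairs i))) ⟨
      ι (sum (λ h → dot (M h) (blocks i h))) ⊕ ι (+ 3 * dot C (pairs i))
        ≈⟨ ι-+ (sum (λ h → dot (M h) (blocks i h))) (+ 3 * dot C (pairs i)) ⟨
      ι (pairing M C i) ∎

    record Meetsᴬ (P : Fin 3 → Vector Carrier 6) (g : Vector Carrier 3) (i : Index) : Set where
      constructor meetsᴬ
      field
        side          : Bool
        pairing-value : pairingᴬ P g i ≈ ι (+ 18 * sgn side)

    -- Along a line of the square `b` and `c` cancel, so 6 x is a sum of six terms ±3. Each of them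
    -- is 3 modulo 6, so that the sum is divisible by 6.
    integral-from-sum : ∀ x (b c : Vector Carrier 6) → sumᴬ b ≈ 0# → sumᴬ c ≈ 0# →
      (∀ j → ∃[ σ ] x ⊕ (b j ⊕ c j) ≈ ι (+ 3 * sgn σ)) → Integral x
    integral-from-sum x b c Σb≈0 Σc≈0 cell = + 3 + sum h , ι-cancel 5 (begin
      ι (+ 6) ⊗ x
        ≈⟨ solve 1 (λ x → con (+ 6) :* x := (x :+ (x :+ (x :+ (x :+ (x :+ (x :+ con 0ℤ)))))) :+ (con 0ℤ :+ con 0ℤ)) ≈-refl x ⟩
      (x ⊕ (x ⊕ (x ⊕ (x ⊕ (x ⊕ (x ⊕ ι 0ℤ)))))) ⊕ (ι 0ℤ ⊕ ι 0ℤ)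
        ≈⟨ ⊕-cong (⊕-congˡ (⊕-congˡ (⊕-congˡ (⊕-congˡ (⊕-congˡ (⊕-congˡ ι-0)))))) (⊕-cong (≈-trans ι-0 (≈-sym Σb≈0)) (≈-trans ι-0 (≈-sym Σc≈0))) ⟩
      sumᴬ {6} (λ _ → x) ⊕ (sumᴬ b ⊕ sumᴬ c)
        ≈⟨ ⊕-congˡ (∑-distrib-⊕ b c) ⟨
      sumᴬ {6} (λ _ → x) ⊕ sumᴬ (λ j → b j ⊕ c j)
        ≈⟨ ∑-distrib-⊕ (λ _ → x) (λ j → b j ⊕ c j) ⟨
      sumᴬ (λ j → x ⊕ (b j ⊕ c j))
        ≈⟨ sum-cong-≋ {6} (λ j → ≈-trans (proj₂ (cell j)) (≈-reflexive (cong ι (odd (proj₁ (cell j)))))) ⟩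
      sumᴬ (λ j → ι (+ 3 + + 6 * h j))
        ≈⟨ ι-sum (λ j → + 3 + + 6 * h j) ⟩
      ι (sum (λ j → + 3 + + 6 * h j))
        ≡⟨ cong ι (trans (∑-distrib-+ (λ _ → + 3) (λ j → + 6 * h j)) (trans (cong (λ z → + 18 + z) (sym (*-distribˡ-sum (+ 6) h)))
             (sym (*-distribˡ-+ (+ 6) (+ 3) (sum h))))) ⟩
      ι (+ 6 * (+ 3 + sum h))
        ≈⟨ ι-* (+ 6) (+ 3 + sum h) ⟩
      ι (+ 6) ⊗ ι (+ 3 + sum h) ∎)
      where
      h : Vector ℤ 6
      h j = half (sgn-isSign (proj₁ (cell j)))
      odd : ∀ σ → + 3 * sgn σ ≡ + 3 + + 6 * half (sgn-isSign σ)
      odd true  = refl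
      odd false = refl

    Cell : (Fin 3 → Vector Carrier 6) → Fin 6 → Fin 6 → Fin 6 → Set
    Cell P i j l = ∃[ σ ] P 0F i ⊕ (P 1F j ⊕ P 2F l) ≈ ι (+ 3 * sgn σ)

    latin-integral : ∀ S → let open LatinSquare S in ∀ P → (∀ h → sumᴬ (P h) ≈ 0#) →
      (∀ i j → Cell P i j (entry i j)) → ∀ h k → Integral (P h k)
    latin-integral S P ΣP≈0 cell = integral
      where
      open LatinSquare S
      integral₀ : ∀ i → Integral (P 0F i)
      integral₀ i = integral-from-sum (P 0F i) (P 1F) (P 2F ∘ entry i) (ΣP≈0 1F)
        (≈-trans (≈-sym (sum-injectiveᴬ (P 2F) (entry i) (row-injective i))) (ΣP≈0 2F)) (cell i)
      integral₁ : ∀ j → Integral (P 1F j)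
      integral₁ j = integral-from-sum (P 1F j) (P 0F) (P 2F ∘ λ i → entry i j) (ΣP≈0 0F)
        (≈-trans (≈-sym (sum-injectiveᴬ (P 2F) (λ i → entry i j) (column-injective j))) (ΣP≈0 2F))
        (λ i → proj₁ (cell i j) , ≈-trans
          (solve 3 (λ a b c → b :+ (a :+ c) := a :+ (b :+ c)) ≈-refl (P 0F i) (P 1F j) (P 2F (entry i j))) (proj₂ (cell i j)))
      integral₂ : ∀ l → Integral (P 2F l)
      -- Row 0 contains every symbol, and the cell of `l` in it expresses `P 2F l` through two
      -- entries already known to be integral.
      integral₂ l with injective⇒onto (entry 0F) (row-injective 0F) ℕ.≤-refl l
      ... | j , refl = + 3 * sgn (proj₁ (cell 0F j)) + - proj₁ (integral₀ 0F) + - proj₁ (integral₁ j) , (begin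
        P 2F (entry 0F j)
          ≈⟨ solve 3 (λ a b c → c := a :+ (b :+ c) :+ :- a :+ :- b) ≈-refl (P 0F 0F) (P 1F j) (P 2F (entry 0F j)) ⟩
        P 0F 0F ⊕ (P 1F j ⊕ P 2F (entry 0F j)) ⊕ ⊖ P 0F 0F ⊕ ⊖ P 1F j
          ≈⟨ ⊕-cong (⊕-cong (proj₂ (cell 0F j)) (⊖-cong (proj₂ (integral₀ 0F)))) (⊖-cong (proj₂ (integral₁ j))) ⟩
        ι (+ 3 * sgn (proj₁ (cell 0F j))) ⊕ ⊖ ι (proj₁ (integral₀ 0F)) ⊕ ⊖ ι (proj₁ (integral₁ j))
          ≈⟨ ⊕-cong (⊕-congˡ (ι-neg _)) (ι-neg _) ⟨
        ι (+ 3 * sgn (proj₁ (cell 0F j))) ⊕ ι (- proj₁ (integral₀ 0F)) ⊕ ι (- proj₁ (integral₁ j))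
          ≈⟨ ⊕-congʳ (ι-+ _ _) ⟨
        ι (+ 3 * sgn (proj₁ (cell 0F j)) + - proj₁ (integral₀ 0F)) ⊕ ι (- proj₁ (integral₁ j))
          ≈⟨ ι-+ _ _ ⟨
        ι (+ 3 * sgn (proj₁ (cell 0F j)) + - proj₁ (integral₀ 0F) + - proj₁ (integral₁ j)) ∎)
        where open ℤ-Algebra 𝔸 using () renaming (-_ to ⊖_; -‿cong to ⊖-cong)
      integral : ∀ h k → Integral (P h k)
      integral 0F = integral₀
      integral 1F = integral₁
      integral 2F = integral₂

    triple-cell : ∀ P g → (∀ h → sumᴬ (P h) ≈ 0#) → ∀ {σ i j l} → Meetsᴬ P g (triple σ i j l) → Cell P i j l
    triple-cell P g ΣP≈0 {σ} {i} {j} {l} (meetsᴬ τ eq) = times (not σ) τ , ι-cancel 5 (begin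
      ι (+ 6) ⊗ S
        ≈⟨ ⊗-congʳ (≈-reflexive (cong ι (six σ))) ⟩
      ι (sgn (not σ) * (- + 6 * sgn σ)) ⊗ S
        ≈⟨ ⊗-congʳ (ι-* (sgn (not σ)) (- + 6 * sgn σ)) ⟩
      ι (sgn (not σ)) ⊗ ι (- + 6 * sgn σ) ⊗ S
        ≈⟨ solve 3 (λ a b c → a :* b :* c := a :* (b :* c)) ≈-refl (ι (sgn (not σ))) (ι (- + 6 * sgn σ)) S ⟩
      ι (sgn (not σ)) ⊗ (ι (- + 6 * sgn σ) ⊗ S)
        ≈⟨ ⊗-congˡ (≈-trans (≈-sym (pairing-tripleᴬ P g σ i j l ΣP≈0)) eq) ⟩
      ι (sgn (not σ)) ⊗ ι (+ 18 * sgn τ)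
        ≈⟨ ι-* (sgn (not σ)) (+ 18 * sgn τ) ⟨
      ι (sgn (not σ) * (+ 18 * sgn τ))
        ≡⟨ cong ι (eighteen σ τ) ⟩
      ι (+ 6 * (+ 3 * sgn (times (not σ) τ)))
        ≈⟨ ι-* (+ 6) (+ 3 * sgn (times (not σ) τ)) ⟩
      ι (+ 6) ⊗ ι (+ 3 * sgn (times (not σ) τ)) ∎)
      where
      S = P 0F i ⊕ (P 1F j ⊕ P 2F l)
      six : ∀ σ → + 6 ≡ sgn (not σ) * (- + 6 * sgn σ)
      six true  = refl
      six false = refl
      eighteen : ∀ σ τ → sgn (not σ) * (+ 18 * sgn τ) ≡ + 6 * (+ 3 * sgn (times (not σ) τ))
      eighteen true  true  = refl
      eighteen true  false = refl
      eighteen false true  = refl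
      eighteen false false = refl

    -- The product x · M and the value 6 sgn σ are both even, and multiplying by the first pair sign
    -- y removes the dependence on it. Evenness of a + b and of a - b, one from each class, then
    -- makes a and b integral (`integral-from-halves`).
    cut-even : ∀ P g M j c κ → InClass κ c → (∀ k → P j k ≈ ι (M k)) → sum M ≡ 0ℤ →
      Balanced (signs (sides c)) → Meetsᴬ P g (toIndex j c) →
      ∃[ t ] g (punchIn j 0F) ⊕ g (punchIn j 1F) ⊗ ι (sgn κ) ≈ ι (+ 2 * t)
    cut-even P g M j (mkCut x y z) κ refl P≈M ΣM≡0 x-bal (meetsᴬ σ eq) = sgn y * (+ 3 * sgn σ - t′) , (begin
      a ⊕ b ⊗ ι (sgn κ)
        ≈⟨ solve 3 (λ a b k → a :+ b :* k := con (+ 1) :* (a :+ b :* k)) ≈-refl a b (ι (sgn κ)) ⟩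
      ι (+ 1) ⊗ (a ⊕ b ⊗ ι (sgn κ))
        ≈⟨ ⊗-congʳ (≈-trans (≈-reflexive (cong ι (sym (IsSign⇒square (sgn-isSign y))))) (ι-* (sgn y) (sgn y))) ⟩
      ι (sgn y) ⊗ ι (sgn y) ⊗ (a ⊕ b ⊗ ι (sgn κ))
        ≈⟨ solve 5 (λ y a b k d → y :* y :* (a :+ b :* k) := y :* ((d :+ (a :* y :+ b :* (k :* y))) :- d)) ≈-refl
             (ι (sgn y)) a b (ι (sgn κ)) d ⟩
      ι (sgn y) ⊗ ((d ⊕ (a ⊗ ι (sgn y) ⊕ b ⊗ (ι (sgn κ) ⊗ ι (sgn y)))) ⊖ d)
        ≈⟨ ⊗-congˡ (⊖-cong (⊕-congˡ (⊕-congˡ (⊗-congˡ (≈-trans (≈-sym (ι-* (sgn κ) (sgn y))) (≈-reflexive (cong ι (sym (sgn-times κ y))))))))) ⟩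
      ι (sgn y) ⊗ ((d ⊕ (a ⊗ ι (sgn y) ⊕ b ⊗ ι (sgn z))) ⊖ d)
        ≈⟨ ⊗-congˡ (≈-trans (⊖-cong value) (⊖-congˡ d≈)) ⟩
      ι (sgn y) ⊗ (ι (+ 6 * sgn σ) ⊖ ι (+ 2 * t′))
        ≈⟨ ⊗-congˡ (⊕-congˡ (ι-neg (+ 2 * t′))) ⟨
      ι (sgn y) ⊗ (ι (+ 6 * sgn σ) ⊕ ι (- (+ 2 * t′)))
        ≈⟨ ⊗-congˡ (ι-+ (+ 6 * sgn σ) (- (+ 2 * t′))) ⟨
      ι (sgn y) ⊗ ι (+ 6 * sgn σ - + 2 * t′)
        ≈⟨ ι-* (sgn y) (+ 6 * sgn σ - + 2 * t′) ⟨
      ι (sgn y * (+ 6 * sgn σ - + 2 * t′))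
        ≡⟨ cong ι (ring (sgn y) (sgn σ) t′) ⟩
      ι (+ 2 * (sgn y * (+ 3 * sgn σ - t′))) ∎)
      where
      open ℤ-Algebra 𝔸 using () renaming (_-_ to _⊖_; -‿cong to neg-cong)
      ⊖-cong : ∀ {a b c} → a ≈ b → a ⊖ c ≈ b ⊖ c
      ⊖-cong = ⊕-congʳ
      ⊖-congˡ : ∀ {a b c} → a ≈ b → c ⊖ a ≈ c ⊖ b
      ⊖-congˡ a≈b = ⊕-congˡ (neg-cong a≈b)
      a = g (punchIn j 0F)
      b = g (punchIn j 1F)
      d = dotι (P j) (signs x)
      even = balanced-dot-zero-sum x-bal M ΣM≡0
      t′ = dot (halves x-bal) M
      d≈ : d ≈ ι (+ 2 * t′)
      d≈ = ≈-trans (ι-dotι P≈M (signs x)) (≈-reflexive (cong ι (trans (dot-comm M (signs x)) even)))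
      value : d ⊕ (a ⊗ ι (sgn y) ⊕ b ⊗ ι (sgn z)) ≈ ι (+ 6 * sgn σ)
      value = ι-cancel 2 (≈-trans (≈-sym (pairing-cutᴬ P g j x y z)) (≈-trans eq
        (≈-trans (≈-reflexive (cong ι (*-assoc (+ 3) (+ 6) (sgn σ)))) (ι-* (+ 3) (+ 6 * sgn σ)))))
      ring : ∀ y s t → y * (+ 6 * s - + 2 * t) ≡ + 2 * (y * (+ 3 * s - t))
      ring = solve-∀

    integral-from-halves : ∀ {a b u v} → a ⊕ b ⊗ ι (+ 1) ≈ ι (+ 2 * u) → a ⊕ b ⊗ ι (- + 1) ≈ ι (+ 2 * v) →
      Integral a × Integral b
    integral-from-halves {a} {b} {u} {v} p q =
        (u + v , ι-cancel 1 (begin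
          ι (+ 2) ⊗ a                                   ≈⟨ solve 2 (λ a b → con (+ 2) :* a := (a :+ b :* con (+ 1)) :+ (a :+ b :* con (- + 1))) ≈-refl a b ⟩
          (a ⊕ b ⊗ ι (+ 1)) ⊕ (a ⊕ b ⊗ ι (- + 1))       ≈⟨ ⊕-cong p q ⟩
          ι (+ 2 * u) ⊕ ι (+ 2 * v)                     ≈⟨ ι-+ (+ 2 * u) (+ 2 * v) ⟨
          ι (+ 2 * u + + 2 * v)                         ≡⟨ cong ι (sym (*-distribˡ-+ (+ 2) u v)) ⟩
          ι (+ 2 * (u + v))                             ≈⟨ ι-* (+ 2) (u + v) ⟩
          ι (+ 2) ⊗ ι (u + v)                           ∎))
      , (u + - v , ι-cancel 1 (begin
          ι (+ 2) ⊗ b                                   ≈⟨ solve 2 (λ a b → con (+ 2) :* b := (a :+ b :* con (+ 1)) :+ con (- + 1) :* (a :+ b :* con (- + 1))) ≈-refl a b ⟩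
          (a ⊕ b ⊗ ι (+ 1)) ⊕ ι (- + 1) ⊗ (a ⊕ b ⊗ ι (- + 1)) ≈⟨ ⊕-cong p (⊗-congˡ q) ⟩
          ι (+ 2 * u) ⊕ ι (- + 1) ⊗ ι (+ 2 * v)         ≈⟨ ⊕-congˡ (ι-* (- + 1) (+ 2 * v)) ⟨
          ι (+ 2 * u) ⊕ ι (- + 1 * (+ 2 * v))           ≈⟨ ι-+ (+ 2 * u) (- + 1 * (+ 2 * v)) ⟨
          ι (+ 2 * u + - + 1 * (+ 2 * v))               ≡⟨ cong ι (ring u v) ⟩
          ι (+ 2 * (u + - v))                           ≈⟨ ι-* (+ 2) (u + - v) ⟩
          ι (+ 2) ⊗ ι (u + - v)                         ∎))
      where
      ring : ∀ u v → + 2 * u + - + 1 * (+ 2 * v) ≡ + 2 * (u + - v)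
      ring = solve-∀

  -- Explicit cliques, and cut vectors as indices

  compatible? : ∀ i i′ → Dec (Compatible i i′)
  compatible? i i′ = map′ compatible form-value (form i i′ ∈0,36?)

  valid? : ∀ i → Dec (Valid i)
  valid? (triple _ _ _ _) = yes tt
  valid? (cut _ x _ _)    = map′ (λ Σ≡0 → record { isSign = λ k → sgn-isSign (Vec.lookup x k) ; sum-zero = Σ≡0 })
    sum-zero (sum (signs x) ≟ 0ℤ)

  -- The Cayley table of ℤ/6.
  cyclic-triples : List Index
  cyclic-triples = List.map (λ { (i , j) → triple true i j ((toℕ i ℕ.+ toℕ j) mod 6) })
    (List.cartesianProduct (List.allFin 6) (List.allFin 6))

  cyclic-triples-clique : AllPairs Compatible cyclic-triples
  cyclic-triples-clique = from-yes (AllPairs.allPairs? compatible? cyclic-triples)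

  cyclic-triples-valid : All Valid cyclic-triples
  cyclic-triples-valid = from-yes (All.all? valid? cyclic-triples)

  -- Representatives of seven of the ten lines spanned by balanced vectors. The first, third, fourth
  -- and fifth form the class of opposite pair signs, where the normalised vectors add up to 0; the
  -- other three form the class of equal signs. Across the classes the pair terms cancel, and
  -- vectors on different lines have product ±2, which gives 0 or 36.
  seven-cuts : Fin 3 → List Index
  seven-cuts j =
      cut j (+ᵇ ∷ +ᵇ ∷ +ᵇ ∷ -ᵇ ∷ -ᵇ ∷ -ᵇ ∷ []) -ᵇ +ᵇ
    ∷ cut j (+ᵇ ∷ +ᵇ ∷ -ᵇ ∷ +ᵇ ∷ -ᵇ ∷ -ᵇ ∷ []) -ᵇ -ᵇ
    ∷ cut j (+ᵇ ∷ +ᵇ ∷ -ᵇ ∷ -ᵇ ∷ +ᵇ ∷ -ᵇ ∷ []) +ᵇ -ᵇ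
    ∷ cut j (+ᵇ ∷ -ᵇ ∷ +ᵇ ∷ +ᵇ ∷ -ᵇ ∷ -ᵇ ∷ []) +ᵇ -ᵇ
    ∷ cut j (+ᵇ ∷ -ᵇ ∷ -ᵇ ∷ +ᵇ ∷ +ᵇ ∷ -ᵇ ∷ []) -ᵇ +ᵇ
    ∷ cut j (+ᵇ ∷ -ᵇ ∷ -ᵇ ∷ +ᵇ ∷ -ᵇ ∷ +ᵇ ∷ []) +ᵇ +ᵇ
    ∷ cut j (+ᵇ ∷ -ᵇ ∷ -ᵇ ∷ -ᵇ ∷ +ᵇ ∷ +ᵇ ∷ []) -ᵇ -ᵇ
    ∷ []
    where
    open import Data.Vec.Base using (_∷_; [])
    +ᵇ -ᵇ : Bool
    +ᵇ = true
    -ᵇ = false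

  seven-cuts-clique : ∀ j → AllPairs Compatible (seven-cuts j)
  seven-cuts-clique = from-yes (all? λ j → AllPairs.allPairs? compatible? (seven-cuts j))

  seven-cuts-valid : ∀ j → All Valid (seven-cuts j)
  seven-cuts-valid = from-yes (all? λ j → All.all? valid? (seven-cuts j))

  by-punchIn : ∀ {n} {Q : Fin (suc n) → Set} j → Q j → (∀ h → Q (punchIn j h)) → ∀ h → Q h
  by-punchIn {Q = Q} j Qj Qh h with j Fin.≟ h
  ... | yes refl = Qj
  ... | no  j≢h  = subst Q (Fin.punchIn-punchOut j≢h) (Qh (punchOut j≢h))

  cut-index : ∀ M C → IsCutVector M C →
    ∃[ i ] Valid i × (∀ h k → M h k ≡ blocks i h k) × (∀ h → C h ≡ + 6 * pairs i h)
  cut-index M C (j , s , s-bal , Mj , M≡0 , Cj , C≡6) = cut j x σ₀ σ₁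
    , record
      { isSign = λ k → sgn-isSign (Vec.lookup x k)
      ; sum-zero = trans (sum-cong-≗ (λ k → sym (s≡ k))) (sum-zero s-bal) }
    , (λ h k → by-punchIn {Q = λ h → M h k ≡ blocks (cut j x σ₀ σ₁) h k} j
        (trans (Mj k) (trans (cong (+ 3 *_) (s≡ k)) (sym (cong (λ u → u k) (F.insertAt-lookup {n = 2} (λ _ _ → 0ℤ) j (λ k → + 3 * signs x k))))))
        (λ h → trans (M≡0 h k) (sym (cong (λ u → u k) (F.insertAt-punchIn {n = 2} (λ _ _ → 0ℤ) j (λ k → + 3 * signs x k) h)))) h)
    , by-punchIn j (trans Cj (cong (+ 6 *_) (sym (F.insertAt-lookup o j 0ℤ))))
        (λ h → trans (sixfold h) (cong (+ 6 *_) (sym (F.insertAt-punchIn o j 0ℤ h))))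
    where
    x = Vec.tabulate (λ k → proj₁ (IsSign⇒sgn (isSign s-bal k)))
    σ₀ = proj₁ (C≡6 0F)
    σ₁ = proj₁ (C≡6 1F)
    o = sgn σ₀ F.∷ sgn σ₁ F.∷ F.[]
    s≡ : ∀ k → s k ≡ signs x k
    s≡ k = trans (proj₂ (IsSign⇒sgn (isSign s-bal k)))
      (cong sgn (sym (Vec.lookup∘tabulate (λ k → proj₁ (IsSign⇒sgn (isSign s-bal k))) k)))
    sixfold : ∀ h → C (punchIn j h) ≡ + 6 * o h
    sixfold 0F = proj₂ (C≡6 0F)
    sixfold 1F = proj₂ (C≡6 1F)

  -- From an admissible vector to an index

  module Extension (𝔸 : ℤ-Algebra) where
    open Notation 𝔸
    open Pairing 𝔸 using (sum-cong-≋) renaming (sum to sumᴬ)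
    open Descent 𝔸

    descend : ∀ M C P g → (∀ h k → P h k ≈ ι (M h k)) → (∀ h → g h ≈ ι (C h)) →
      ∀ {i} → Meetsᴬ P g i → Meets M C i
    descend M C P g P≈M g≈C {i} (meetsᴬ σ eq) = meets σ (ι-injective (≈-trans (≈-sym (ι-pairing {P} {g} {M} {C} P≈M g≈C i)) eq))

    ι-squares : ∀ {n} {u : Vector Carrier n} {U} → (∀ k → u k ≈ ι (U k)) → sumᴬ (λ k → u k ⊗ u k) ≈ ι (dot U U)
    ι-squares {n} {u} {U} u≈U = ≈-trans
      (sum-cong-≋ {n} (λ k → ≈-trans (⊗-cong (u≈U k) (u≈U k)) (≈-sym (ι-* (U k) (U k)))))
      (ι-sum (λ k → U k * U k))

    -- `x` and `y` stand for Σ M² and Σ C² in `norm-equation`: 180 = 2 · 54 + 72.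
    norm-descends : ∀ {x y a c} → x ≈ ι a → y ≈ ι c → ι (+ 2) ⊗ x ⊕ y ≈ ι (+ 180) → a ≡ + 54 → c ≡ + 72
    norm-descends {x} {y} {a} {c} x≈a y≈c norm refl = +-cancelˡ (+ 108) c (+ 72) (ι-injective (begin
      ι (+ 108 + c)               ≈⟨ ι-+ (+ 108) c ⟩
      ι (+ 2 * + 54) ⊕ ι c        ≈⟨ ⊕-cong (≈-trans (ι-* (+ 2) (+ 54)) (⊗-congˡ (≈-sym x≈a))) (≈-sym y≈c) ⟩
      ι (+ 2) ⊗ x ⊕ y             ≈⟨ norm ⟩
      ι (+ 180)                   ∎))
      where open import Relation.Binary.Reasoning.Setoid (ℤ-Algebra.setoid 𝔸)

    module FromCells (P : Fin 3 → Vector Carrier 6) (g : Vector Carrier 3) (ΣP≈0 : ∀ h → sumᴬ (P h) ≈ 0#)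
      (norm : ι (+ 2) ⊗ sumᴬ (λ h → sumᴬ (λ k → P h k ⊗ P h k)) ⊕ sumᴬ (λ h → g h ⊗ g h) ≈ ι (+ 180))
      (square : LatinSquare) (cell : ∀ i j → Cell P i j (LatinSquare.entry square i j))
      (cs : Fin 3 → List Cut) (cs-valid : ∀ j → All (λ c → Balanced (signs (sides c))) (cs j))
      (cs-clique : ∀ j → AllPairs (λ c c′ → Compatible (toIndex j c) (toIndex j c′)) (cs j))
      (7≤ : ∀ j → 7 ℕ.≤ length (cs j))
      (cs-meet : ∀ j → All (λ c → Meetsᴬ P g (toIndex j c)) (cs j)) where

      open LatinSquare square

      module Integers (M : Fin 3 → Vector ℤ 6) (P≈M : ∀ h k → P h k ≈ ι (M h k)) where
        ΣM≡0 : ∀ h → sum (M h) ≡ 0ℤ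
        ΣM≡0 h = ι-injective (≈-trans (≈-sym (ι-sum (M h)))
          (≈-trans (sum-cong-≋ {6} (λ k → ≈-sym (P≈M h k))) (≈-trans (ΣP≈0 h) (≈-sym ι-0))))
        g-integral-pair : ∀ j → Integral (g (punchIn j 0F)) × Integral (g (punchIn j 1F))
        g-integral-pair j = integral-from-halves (proj₂ (even true)) (proj₂ (even false))
          where
          even : ∀ κ → ∃[ t ] g (punchIn j 0F) ⊕ g (punchIn j 1F) ⊗ ι (sgn κ) ≈ ι (+ 2 * t)
          even κ = fromMember (Clique.class-inhabited j (cs j) (cs-valid j) (cs-clique j) (7≤ j) κ)
            where
            fromMember : (∃[ c ] c ∈ˡ cs j × InClass κ c) → ∃[ t ] g (punchIn j 0F) ⊕ g (punchIn j 1F) ⊗ ι (sgn κ) ≈ ι (+ 2 * t)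
            fromMember (c , c∈ , c-class) = cut-even P g (M j) j c κ c-class (P≈M j) (ΣM≡0 j)
              (All.lookup (cs-valid j) c∈) (All.lookup (cs-meet j) c∈)
        g-integral : ∀ h → Integral (g h)
        g-integral 0F = proj₁ (g-integral-pair 1F)
        g-integral 1F = proj₁ (g-integral-pair 0F)
        g-integral 2F = proj₂ (g-integral-pair 0F)
        ΣM² : sum (λ h → dot (M h) (M h)) ≡ + 54
        ΣM² = latin-norm square M ΣM≡0 (λ i j → proj₁ (cell i j) , ι-injective (≈-trans
          (≈-trans (ι-+ (M 0F i) (M 1F j + M 2F (entry i j))) (⊕-cong (≈-sym (P≈M 0F i)) (≈-trans (ι-+ (M 1F j) (M 2F (entry i j)))
            (⊕-cong (≈-sym (P≈M 1F j)) (≈-sym (P≈M 2F (entry i j)))))))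
          (proj₂ (cell i j))))

      module Conclusion (M : Fin 3 → Vector ℤ 6) (P≈M : ∀ h k → P h k ≈ ι (M h k))
        (C : Fin 3 → ℤ) (g≈C : ∀ h → g h ≈ ι (C h)) where
        open Integers M P≈M using (ΣM≡0; ΣM²)
        ΣC² : sum (sq ∘ C) ≡ + 72
        ΣC² = norm-descends {a = sum (λ h → dot (M h) (M h))} {dot C C}
          (≈-trans (sum-cong-≋ {3} (λ h → ι-squares {6} {P h} {M h} (P≈M h))) (ι-sum (λ h → dot (M h) (M h))))
          (ι-squares {3} {g} {C} g≈C) norm ΣM²
        found : IsCutVector M C
        found = isCutVector M C ΣM² ΣC² (λ j → Clique.clique-shadow j (cs j) (cs-valid j) (cs-clique j) M C (ΣM≡0 j)
          (All.map (descend M C P g P≈M g≈C) (cs-meet j)) (7≤ j))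
        result : ∃[ i ] Valid i × (∀ h k → P h k ≈ ι (blocks i h k)) × (∀ h → g h ≈ ι (+ 6 * pairs i h))
        result = transport (cut-index M C found)
          where
          transport : ∃[ i ] Valid i × (∀ h k → M h k ≡ blocks i h k) × (∀ h → C h ≡ + 6 * pairs i h) →
            ∃[ i ] Valid i × (∀ h k → P h k ≈ ι (blocks i h k)) × (∀ h → g h ≈ ι (+ 6 * pairs i h))
          transport (i , valid , M≡ , C≡) = i , valid
            , (λ h k → ≈-trans (P≈M h k) (≈-reflexive (cong ι (M≡ h k))))
            , (λ h → ≈-trans (g≈C h) (≈-reflexive (cong ι (C≡ h))))

      extension-is-indexed : ∃[ i ] Valid i × (∀ h k → P h k ≈ ι (blocks i h k)) × (∀ h → g h ≈ ι (+ 6 * pairs i h))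
      extension-is-indexed = fromIntegral (λ h k → proj₁ (P-integral h k)) (λ h k → proj₂ (P-integral h k))
        where
        P-integral : ∀ h k → Integral (P h k)
        P-integral = latin-integral square P ΣP≈0 cell
        fromIntegral : (M : Fin 3 → Vector ℤ 6) → (∀ h k → P h k ≈ ι (M h k)) →
          ∃[ i ] Valid i × (∀ h k → P h k ≈ ι (blocks i h k)) × (∀ h → g h ≈ ι (+ 6 * pairs i h))
        fromIntegral M P≈M = Conclusion.result M P≈M (λ h → proj₁ (g-integral h)) (λ h → proj₂ (g-integral h))
          where open Integers M P≈M using (g-integral)

  -- The norm-3 vectors of L

  -- Six times α₅ is (1, ..., 1, -5), all of whose entries are 1 modulo 6; hence the entries of a
  -- scaled block of a lattice vector share one residue `r` modulo 6.
  record BlockShape (r : ℤ) (U z : Vector ℤ 6) : Set where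
    field
      U≡    : ∀ k → U k ≡ + 6 * z k + r
      ΣU≡0  : sum U ≡ 0ℤ
  open BlockShape

  -- (U - r)(U - r + 6) = 36 z (z + 1), summed over the block.
  block-norm : ∀ {r U z} → BlockShape r U z →
    dot U U ≡ + 6 * (r * (+ 6 - r)) + + 36 * sum (λ k → z k * (z k + + 1))
  block-norm {r} {U} {z} shape = begin
    dot U U
      ≡⟨ sum-cong-≗ (λ k → trans (cong (λ u → u * u) (U≡ shape k)) (trans (ring (z k) r) (cong (λ u → + 36 * (z k * (z k + + 1)) + (c * u + d)) (sym (U≡ shape k))))) ⟩
    sum (λ k → + 36 * (z k * (z k + + 1)) + (c * U k + d))
      ≡⟨ ∑-distrib-+ (λ k → + 36 * (z k * (z k + + 1))) (λ k → c * U k + d) ⟩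
    sum (λ k → + 36 * (z k * (z k + + 1))) + sum (λ k → c * U k + d)
      ≡⟨ cong₂ (λ x y → x + y) (sym (*-distribˡ-sum (+ 36) (λ k → z k * (z k + + 1)))) (∑-distrib-+ (λ k → c * U k) (λ _ → d)) ⟩
    + 36 * Z + (sum (λ k → c * U k) + sum {6} (λ _ → d))
      ≡⟨ cong₂ (λ x y → + 36 * Z + (x + y)) (trans (sym (*-distribˡ-sum c U)) (cong (c *_) (ΣU≡0 shape))) (sixfold-sum d) ⟩
    + 36 * Z + (c * 0ℤ + + 6 * d)
      ≡⟨ ring′ Z r ⟩
    + 6 * (r * (+ 6 - r)) + + 36 * Z ∎
    where
    open ≡-Reasoning
    c = + 2 * r - + 6
    d = r * (+ 6 - r)
    Z = sum (λ k → z k * (z k + + 1))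
    ring : ∀ z r → (+ 6 * z + r) * (+ 6 * z + r) ≡ + 36 * (z * (z + + 1)) + ((+ 2 * r - + 6) * (+ 6 * z + r) + r * (+ 6 - r))
    ring = solve-∀
    ring′ : ∀ Z r → + 36 * Z + ((+ 2 * r - + 6) * 0ℤ + + 6 * (r * (+ 6 - r))) ≡ + 6 * (r * (+ 6 - r)) + + 36 * Z
    ring′ = solve-∀

  0≤i*[i+1] : ∀ i → 0ℤ ≤ i * (i + + 1)
  0≤i*[i+1] (+ n) = subst (0ℤ ≤_) (pos-* n (n ℕ.+ 1)) (+≤+ z≤n)
  0≤i*[i+1] -[1+ 0 ]     = ≤-refl
  0≤i*[i+1] -[1+ suc n ] = +≤+ z≤n

  i*[i+1]≡0 : ∀ i → i * (i + + 1) ≡ 0ℤ → i ≡ 0ℤ ⊎ i ≡ - + 1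
  i*[i+1]≡0 i eq = Sum.map₂ (λ i+1≡0 → trans (ring i) (cong (_+ - + 1) i+1≡0)) (i*j≡0⇒i≡0∨j≡0 i eq)
    where
    ring : ∀ i → i ≡ (i + + 1) + - + 1
    ring = solve-∀

  ZeroOrMinusOne : ℤ → Set
  ZeroOrMinusOne i = i ≡ 0ℤ ⊎ i ≡ - + 1

  nonneg-neg : ∀ {i} → ZeroOrMinusOne i → 0ℤ ≤ - + 1 * i
  nonneg-neg (inj₁ refl) = ≤-refl
  nonneg-neg (inj₂ refl) = +≤+ z≤n

  all-zero : ∀ {n} (z : Vector ℤ n) → (∀ k → ZeroOrMinusOne (z k)) → sum z ≡ 0ℤ → ∀ k → z k ≡ 0ℤ
  all-zero z z∈ Σz≡0 k = *-cancelˡ-≡ (- + 1) (z k) 0ℤ (sum-nonneg-zero (λ k → - + 1 * z k) (λ k → nonneg-neg (z∈ k))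
    (≤-reflexive (trans (sym (*-distribˡ-sum (- + 1) z)) (cong (- + 1 *_) Σz≡0))) k)

  one-hot : ∀ {n} (z : Vector ℤ n) → (∀ k → ZeroOrMinusOne (z k)) → sum z ≡ - + 1 → ∃[ i ] ∀ k → z k ≡ - unit i k
  one-hot {zero}  z z∈ ()
  one-hot {suc n} z z∈ Σz with z∈ zero
  ... | inj₂ z₀≡-1 = zero , λ where
    zero    → z₀≡-1
    (suc k) → all-zero (z ∘ suc) (z∈ ∘ suc) (+-cancelˡ (z zero) _ _ (trans Σz (sym (trans (+-identityʳ _) z₀≡-1)))) k
  ... | inj₁ z₀≡0 with one-hot (z ∘ suc) (z∈ ∘ suc) (trans (sym (trans (cong (_+ sum (z ∘ suc)) z₀≡0) (+-identityˡ _))) Σz)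
  ...   | i , z≡ = suc i , λ where
    zero    → z₀≡0
    (suc k) → z≡ k

  affine-sum : ∀ {r U z} → BlockShape r U z → + 6 * sum z + + 6 * r ≡ 0ℤ
  affine-sum {r} {U} {z} shape = trans (sym (trans (sum-cong-≗ (U≡ shape))
    (trans (∑-distrib-+ (λ k → + 6 * z k) (λ _ → r)) (cong₂ (λ x y → x + y) (sym (*-distribˡ-sum (+ 6) z)) (sixfold-sum r)))))
    (ΣU≡0 shape)

  sum≡-r : ∀ {r U z} → BlockShape r U z → sum z ≡ - r
  sum≡-r {r} {U} {z} shape = *-cancelˡ-≡ (+ 6) (sum z) (- r) (trans (ring (sum z) r) (trans (cong (_+ + 6 * - r) (affine-sum shape)) (+-identityˡ _)))
    where
    ring : ∀ s r → + 6 * s ≡ (+ 6 * s + + 6 * r) + + 6 * - r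
    ring = solve-∀

  -- With entries 0 or -1 and sum -r, exactly r entries of `z` are -1. The residues treated here and
  -- in the next three lemmas are those that `minimal` leaves.
  shape-0 : ∀ {U z} → BlockShape 0ℤ U z → (∀ k → ZeroOrMinusOne (z k)) → ∀ k → U k ≡ 0ℤ
  shape-0 {U} {z} shape z∈ k = trans (U≡ shape k) (cong (λ x → + 6 * x + 0ℤ) (all-zero z z∈ (sum≡-r shape) k))

  shape-1 : ∀ {U z} → BlockShape (+ 1) U z → (∀ k → ZeroOrMinusOne (z k)) → ∃[ i ] ∀ k → U k ≡ + 1 * corner i k
  shape-1 {U} {z} shape z∈ = finish (one-hot z z∈ (sum≡-r shape))
    where
    finish : (∃[ i ] ∀ k → z k ≡ - unit i k) → ∃[ i ] ∀ k → U k ≡ + 1 * corner i k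
    finish (i , z≡) = i , λ k → trans (U≡ shape k) (trans (cong (λ x → + 6 * x + + 1) (z≡ k)) (ring (unit i k)))
      where
      ring : ∀ u → + 6 * - u + + 1 ≡ + 1 * (+ 1 + - + 6 * u)
      ring = solve-∀

  -- Exchanging 0 and -1 in `z` turns five entries -1 into one, which reduces this residue to
  -- `one-hot`.
  shape-5 : ∀ {U z} → BlockShape (+ 5) U z → (∀ k → ZeroOrMinusOne (z k)) → ∃[ i ] ∀ k → U k ≡ - + 1 * corner i k
  shape-5 {U} {z} shape z∈ = finish (one-hot z′ (λ k → mirrored (z∈ k)) Σz′)
    where
    z′ : Vector ℤ 6
    z′ k = - + 1 + - + 1 * z k
    mirrored : ∀ {i} → ZeroOrMinusOne i → ZeroOrMinusOne (- + 1 + - + 1 * i)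
    mirrored (inj₁ refl) = inj₂ refl
    mirrored (inj₂ refl) = inj₁ refl
    Σz′ : sum z′ ≡ - + 1
    Σz′ = trans (∑-distrib-+ (λ _ → - + 1) (λ k → - + 1 * z k)) (cong (λ x → - + 6 + x)
      (trans (sym (*-distribˡ-sum (- + 1) z)) (cong (- + 1 *_) (sum≡-r shape))))
    finish : (∃[ i ] ∀ k → z′ k ≡ - unit i k) → ∃[ i ] ∀ k → U k ≡ - + 1 * corner i k
    finish (i , z≡) = i , λ k → trans (U≡ shape k) (trans (ring (z k)) (trans (cong (λ x → - + 1 + - + 6 * x) (z≡ k)) (ring′ (unit i k))))
      where
      ring : ∀ z → + 6 * z + + 5 ≡ - + 1 + - + 6 * (- + 1 + - + 1 * z)
      ring = solve-∀
      ring′ : ∀ u → - + 1 + - + 6 * - u ≡ - + 1 * (+ 1 + - + 6 * u)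
      ring′ = solve-∀

  shape-3 : ∀ {U z} → BlockShape (+ 3) U z → (∀ k → ZeroOrMinusOne (z k)) → ∃[ s ] Balanced s × ∀ k → U k ≡ + 3 * s k
  shape-3 {U} {z} shape z∈ = s , record { isSign = λ k → odd (z∈ k) ; sum-zero = Σs } , λ k → trans (U≡ shape k) (ring (z k))
    where
    s : Vector ℤ 6
    s k = + 2 * z k + + 1
    odd : ∀ {i} → ZeroOrMinusOne i → IsSign (+ 2 * i + + 1)
    odd (inj₁ refl) = inj₁ refl
    odd (inj₂ refl) = inj₂ refl
    ring : ∀ z → + 6 * z + + 3 ≡ + 3 * (+ 2 * z + + 1)
    ring = solve-∀
    Σs : sum s ≡ 0ℤ
    Σs = trans (∑-distrib-+ (λ k → + 2 * z k) (λ _ → + 1)) (cong (_+ + 6)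
      (trans (sym (*-distribˡ-sum (+ 2) z)) (cong (+ 2 *_) (sum≡-r shape))))

  -- k = r + 6 t with 0 ≤ r < 6, for k = p + 3 b
  residue : Fin 6 → Bool → Fin 6
  residue 0F b = if b then 3F else 0F
  residue 1F b = if b then 4F else 1F
  residue 2F b = if b then 5F else 2F
  residue 3F b = if b then 0F else 3F
  residue 4F b = if b then 1F else 4F
  residue 5F b = if b then 2F else 5F

  num : ∀ {n} → Fin n → ℤ
  num i = + toℕ i

  residue-spec : ∀ p b → ∃[ t ] num p + + 3 * bit b ≡ num (residue p b) + + 6 * t
  residue-spec 0F true  = 0ℤ , refl
  residue-spec 1F true  = 0ℤ , refl
  residue-spec 2F true  = 0ℤ , refl
  residue-spec 3F true  = + 1 , refl
  residue-spec 4F true  = + 1 , refl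
  residue-spec 5F true  = + 1 , refl
  residue-spec 0F false = 0ℤ , refl
  residue-spec 1F false = 0ℤ , refl
  residue-spec 2F false = 0ℤ , refl
  residue-spec 3F false = 0ℤ , refl
  residue-spec 4F false = 0ℤ , refl
  residue-spec 5F false = 0ℤ , refl

  -- Least norms in the cosets of Λ

  xor : Bool → Bool → Bool
  xor true  b = not b
  xor false b = b

  xor-spec : ∀ a b → ∃[ t ] bit a + bit b ≡ bit (xor a b) + + 2 * t
  xor-spec true  true  = + 1 , refl
  xor-spec true  false = 0ℤ , refl
  xor-spec false true  = 0ℤ , refl
  xor-spec false false = 0ℤ , refl

  -- A lower bound for what a block of residue `r` and a pair entry of parity `b` add to the scaled
  -- norm: `block-norm` with z (z + 1) = 0, and 18 for the smallest odd square.
  cost : Fin 6 → Bool → ℤ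
  cost r b = + 6 * (num r * (+ 6 - num r)) + + 18 * bit b

  residues : Fin 6 → (Fin 3 → Bool) → Fin 3 → Fin 6
  residues p b j = residue p (b j)

  odd-pairs : (Fin 3 → Bool) → Fin 3 → Bool
  odd-pairs b j = xor (b (punchIn j 0F)) (b (punchIn j 1F))

  Constant : (Fin 3 → Fin 6) → (Fin 3 → Bool) → Fin 6 → Set
  Constant r odd q = ∀ j → r j ≡ q × odd j ≡ false

  -- The residue pattern of a cut: 3 in its own block, whose pair entry is even, and 0 in the other
  -- blocks, whose pair entries are odd. `Constant` with 1 or 5 is the pattern of a triple of either
  -- sign.
  Special : (Fin 3 → Fin 6) → (Fin 3 → Bool) → Set
  Special r odd = ∃[ j ] r j ≡ 3F × odd j ≡ false × (∀ h → r (punchIn j h) ≡ 0F × odd (punchIn j h) ≡ true)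

  total : Fin 6 → (Fin 3 → Bool) → ℤ
  total p b = sum (λ j → cost (residues p b j) (odd-pairs b j))

  Minimal : Fin 6 → (Fin 3 → Bool) → Set
  Minimal p b = total p b ≡ + 90
    × (Constant (residues p b) (odd-pairs b) 1F ⊎ Constant (residues p b) (odd-pairs b) 5F ⊎ Special (residues p b) (odd-pairs b))

  parityᵇ : Fin 6 → Bool
  parityᵇ 0F = false
  parityᵇ 1F = true
  parityᵇ 2F = false
  parityᵇ 3F = true
  parityᵇ 4F = false
  parityᵇ 5F = true

  minimal? : ∀ p b → Dec (Minimal p b)
  minimal? p b = (total p b ≟ + 90) ×-dec (constant? 1F ⊎-dec constant? 5F ⊎-dec
      Fin.any? λ j → (residues p b j Fin.≟ 3F) ×-dec (odd-pairs b j Bool.≟ false) ×-dec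
        all? λ h → (residues p b (punchIn j h) Fin.≟ 0F) ×-dec (odd-pairs b (punchIn j h) Bool.≟ true))
    where
    constant? : ∀ q → Dec (Constant (residues p b) (odd-pairs b) q)
    constant? q = all? λ j → (residues p b j Fin.≟ q) ×-dec (odd-pairs b j Bool.≟ false)

  -- A block of residue 1 or 5 costs 30, one of residue 3 costs 54, an odd pair 18. The parity
  -- condition excludes the cosets of smaller cost, and 90 is attained as 30 + 30 + 30 by triples
  -- and as 54 + 18 + 18 by cuts.
  minimal : ∀ p b₀ b₁ b₂ → xor (parityᵇ p) (xor b₀ (xor b₁ b₂)) ≡ true →
    total p (tri b₀ b₁ b₂) ≤ + 90 → Minimal p (tri b₀ b₁ b₂)
  minimal = from-yes (all? λ p → allBool? λ b₀ → allBool? λ b₁ → allBool? λ b₂ →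
    (xor (parityᵇ p) (xor b₀ (xor b₁ b₂)) Bool.≟ true) →-dec (total p (tri b₀ b₁ b₂) ≤? + 90) →-dec
    minimal? p (tri b₀ b₁ b₂))

  -- A vector of L, scaled by 6, in terms of its part x, w, w₃ in A₅³ ⊕ A₁⁴ and its coefficients
  -- at β₀, …, β₃; a and a₃ are a third of the first entries of the scaled v₄, v₅, v₆ and v₇.
  record LatticePoint (U : Fin 3 → Vector ℤ 6) (a : Fin 3 → ℤ) (a₃ : ℤ) : Set where
    field
      x   : Fin 3 → Vector ℤ 6
      w   : Fin 3 → ℤ
      w₃  : ℤ
      c₀  : ℤ
      c   : Fin 3 → ℤ
      Σx  : ∀ j → sum (x j) ≡ 0ℤ
      block≡ : ∀ j k → U j k ≡ + 6 * x j k + (c₀ + + 3 * c j) * corner 5F k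
      pair≡  : ∀ j → a j ≡ + 2 * w j + (c (punchIn j 0F) + c (punchIn j 1F))
      last≡  : a₃ ≡ + 2 * w₃ + (c₀ + (c 0F + (c 1F + c 2F)))

  mod-6 : ∀ i → ∃[ p ] ∃[ d ] i ≡ num {6} p + + 6 * d
  mod-6 i = fromℕ< (n%ℕd<d i 6) , i /ℕ 6 , trans (a≡a%ℕn+[a/ℕn]*n i 6)
    (cong₂ (λ x y → + x + y) (sym (Fin.toℕ-fromℕ< (n%ℕd<d i 6))) (*-comm (i /ℕ 6) (+ 6)))

  num-parity : ∀ (p : Fin 6) → ∃[ t ] num p ≡ bit (parityᵇ p) + + 2 * t
  num-parity 0F = 0ℤ , refl
  num-parity 1F = 0ℤ , refl
  num-parity 2F = + 1 , refl
  num-parity 3F = + 1 , refl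
  num-parity 4F = + 2 , refl
  num-parity 5F = + 2 , refl

  odd⇒true : ∀ q t → + 1 ≡ bit q + + 2 * t → q ≡ true
  odd⇒true true  t _  = refl
  odd⇒true false t eq = contradiction (trans eq (+-identityˡ (+ 2 * t))) (1≢2t {t})

  -- This is `last≡` modulo 2 for a₃ = 1: the root condition makes the sum of the four glue
  -- coefficients odd, and c₀ has the parity of its residue `p` modulo 6.
  xor-odd : ∀ {c₀ c₁ c₂ c₃ w d e₁ e₂ e₃} p b₁ b₂ b₃ → c₀ ≡ num {6} p + + 6 * d →
    c₁ ≡ bit b₁ + + 2 * e₁ → c₂ ≡ bit b₂ + + 2 * e₂ → c₃ ≡ bit b₃ + + 2 * e₃ →
    + 1 ≡ + 2 * w + (c₀ + (c₁ + (c₂ + c₃))) → xor (parityᵇ p) (xor b₁ (xor b₂ b₃)) ≡ true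
  xor-odd {w = w} {d} {e₁} {e₂} {e₃} p b₁ b₂ b₃ refl refl refl refl eq
    with num-parity p | xor-spec b₂ b₃ | xor-spec b₁ (xor b₂ b₃) | xor-spec (parityᵇ p) (xor b₁ (xor b₂ b₃))
  ... | t₀ , p≡ | t₁ , s₁ | t₂ , s₂ | t₃ , s₃ = odd⇒true _ (w + t₀ + + 3 * d + e₁ + e₂ + e₃ + t₁ + t₂ + t₃) (begin
    + 1
      ≡⟨ eq ⟩
    + 2 * w + (num p + + 6 * d + (bit b₁ + + 2 * e₁ + (bit b₂ + + 2 * e₂ + (bit b₃ + + 2 * e₃))))
      ≡⟨ cong (λ n → + 2 * w + (n + + 6 * d + (bit b₁ + + 2 * e₁ + (bit b₂ + + 2 * e₂ + (bit b₃ + + 2 * e₃))))) p≡ ⟩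
    + 2 * w + (P + + 2 * t₀ + + 6 * d + (bit b₁ + + 2 * e₁ + (bit b₂ + + 2 * e₂ + (bit b₃ + + 2 * e₃))))
      ≡⟨ ring₁ w P t₀ d (bit b₁) e₁ (bit b₂) e₂ (bit b₃) e₃ ⟩
    P + (bit b₁ + (bit b₂ + bit b₃)) + + 2 * T
      ≡⟨ cong (λ z → P + (bit b₁ + z) + + 2 * T) s₁ ⟩
    P + (bit b₁ + (bit (xor b₂ b₃) + + 2 * t₁)) + + 2 * T
      ≡⟨ ring₂ P (bit b₁) (bit (xor b₂ b₃)) t₁ T ⟩
    P + (bit b₁ + bit (xor b₂ b₃)) + + 2 * (T + t₁)
      ≡⟨ cong (λ z → P + z + + 2 * (T + t₁)) s₂ ⟩
    P + (bit (xor b₁ (xor b₂ b₃)) + + 2 * t₂) + + 2 * (T + t₁)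
      ≡⟨ ring₃ P (bit (xor b₁ (xor b₂ b₃))) t₂ (T + t₁) ⟩
    P + bit (xor b₁ (xor b₂ b₃)) + + 2 * (T + t₁ + t₂)
      ≡⟨ cong (λ z → z + + 2 * (T + t₁ + t₂)) s₃ ⟩
    bit (xor (parityᵇ p) (xor b₁ (xor b₂ b₃))) + + 2 * t₃ + + 2 * (T + t₁ + t₂)
      ≡⟨ ring₄ (bit (xor (parityᵇ p) (xor b₁ (xor b₂ b₃)))) t₃ (T + t₁ + t₂) ⟩
    bit (xor (parityᵇ p) (xor b₁ (xor b₂ b₃))) + + 2 * (T + t₁ + t₂ + t₃) ∎)
    where
    open ≡-Reasoning
    P = bit (parityᵇ p)
    T = w + t₀ + + 3 * d + e₁ + e₂ + e₃
    ring₁ : ∀ w P t d b₁ e₁ b₂ e₂ b₃ e₃ → + 2 * w + (P + + 2 * t + + 6 * d + (b₁ + + 2 * e₁ + (b₂ + + 2 * e₂ + (b₃ + + 2 * e₃)))) ≡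
      P + (b₁ + (b₂ + b₃)) + + 2 * (w + t + + 3 * d + e₁ + e₂ + e₃)
    ring₁ = solve-∀
    ring₂ : ∀ P b q t T → P + (b + (q + + 2 * t)) + + 2 * T ≡ P + (b + q) + + 2 * (T + t)
    ring₂ = solve-∀
    ring₃ : ∀ P q t T → P + (q + + 2 * t) + + 2 * T ≡ P + q + + 2 * (T + t)
    ring₃ = solve-∀
    ring₄ : ∀ q t T → q + + 2 * t + + 2 * T ≡ q + + 2 * (T + t)
    ring₄ = solve-∀

  -- A quarter of what the square of bit b + 2 m exceeds the least square of its parity by, see
  -- `square-slack`.
  slack : ℤ → Bool → ℤ
  slack m b = m * (m + bit b)

  0≤slack : ∀ m b → 0ℤ ≤ slack m b
  0≤slack m true  = 0≤i*[i+1] m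
  0≤slack m false = subst (λ z → 0ℤ ≤ m * z) (sym (+-identityʳ m)) (0≤i*i m)

  square-slack : ∀ m b → sq (bit b + + 2 * m) ≡ bit b + + 4 * slack m b
  square-slack m true = ring m
    where
    ring : ∀ m → (+ 1 + + 2 * m) * (+ 1 + + 2 * m) ≡ + 1 + + 4 * (m * (m + + 1))
    ring = solve-∀
  square-slack m false = ring m
    where
    ring : ∀ m → (0ℤ + + 2 * m) * (0ℤ + + 2 * m) ≡ 0ℤ + + 4 * (m * (m + 0ℤ))
    ring = solve-∀

  Indexed : (Fin 3 → Vector ℤ 6) → (Fin 3 → ℤ) → Set
  Indexed U a = ∃[ i ] Valid i × (∀ j k → U j k ≡ blocks i j k) × (∀ j → a j ≡ pairs i j)

  module Tight {p : Fin 6} {b : Fin 3 → Bool} {U z : Fin 3 → Vector ℤ 6} {a m : Fin 3 → ℤ}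
    (shape : ∀ j → BlockShape (num (residues p b j)) (U j) (z j))
    (a≡ : ∀ j → a j ≡ bit (odd-pairs b j) + + 2 * m j)
    (norm : sum (λ j → dot (U j) (U j) + + 18 * sq (a j)) ≡ + 90) where

    Z excess : Fin 3 → ℤ
    Z j = sum (λ k → z j k * (z j k + + 1))
    excess j = + 36 * Z j + + 72 * slack (m j) (odd-pairs b j)

    0≤Z : ∀ j → 0ℤ ≤ + 36 * Z j
    0≤Z j = *-monoˡ-≤-nonNeg (+ 36) (sum-nonneg _ (λ k → 0≤i*[i+1] (z j k)))

    0≤72slack : ∀ j → 0ℤ ≤ + 72 * slack (m j) (odd-pairs b j)
    0≤72slack j = *-monoˡ-≤-nonNeg (+ 72) (0≤slack (m j) (odd-pairs b j))

    0≤excess : ∀ j → 0ℤ ≤ excess j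
    0≤excess j = +-mono-≤ (0≤Z j) (0≤72slack j)

    -- The norm is the cost of the coset plus a nonnegative excess. Since `minimal` puts the cost at
    -- exactly 90, the excess vanishes term by term, which determines `z` and `m` up to the choices
    -- that an index records.
    norm-split : total p b + sum excess ≡ + 90
    norm-split = begin
      total p b + sum excess
        ≡⟨ sym (∑-distrib-+ (λ j → cost (residues p b j) (odd-pairs b j)) excess) ⟩
      sum (λ j → cost (residues p b j) (odd-pairs b j) + excess j)
        ≡⟨ sum-cong-≗ (λ j → sym (trans (cong₂ (λ x y → x + + 18 * y) (block-norm (shape j)) (trans (cong sq (a≡ j)) (square-slack (m j) (odd-pairs b j))))
             (ring (+ 6 * (num (residues p b j) * (+ 6 - num (residues p b j)))) (Z j) (bit (odd-pairs b j)) (slack (m j) (odd-pairs b j))))) ⟩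
      sum (λ j → dot (U j) (U j) + + 18 * sq (a j))
        ≡⟨ norm ⟩
      + 90 ∎
      where
      open ≡-Reasoning
      ring : ∀ n Z b s → n + + 36 * Z + + 18 * (b + + 4 * s) ≡ (n + + 18 * b) + (+ 36 * Z + + 72 * s)
      ring = solve-∀

    total≤90 : total p b ≤ + 90
    total≤90 = subst (total p b ≤_) norm-split (subst (_≤ total p b + sum excess) (+-identityʳ (total p b))
      (+-monoʳ-≤ (total p b) (sum-nonneg excess 0≤excess)))

    module _ (total≡90 : total p b ≡ + 90) where
      excess≡0 : ∀ j → excess j ≡ 0ℤ
      excess≡0 = sum-nonneg-zero excess 0≤excess (≤-reflexive
        (+-cancelˡ (+ 90) (sum excess) 0ℤ (trans (cong (_+ sum excess) (sym total≡90)) norm-split)))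
      parts : ∀ j → (+ 36 * Z j ≡ 0ℤ) × (+ 72 * slack (m j) (odd-pairs b j) ≡ 0ℤ)
      parts j = +-nonneg-zero (0≤Z j) (0≤72slack j) (≤-reflexive (excess≡0 j))
      z∈ : ∀ j k → ZeroOrMinusOne (z j k)
      z∈ j k = i*[i+1]≡0 (z j k) (sum-nonneg-zero _ (λ k → 0≤i*[i+1] (z j k))
        (≤-reflexive (*-cancelˡ-≡ (+ 36) (Z j) 0ℤ (proj₁ (parts j)))) k)
      slack≡0 : ∀ j → slack (m j) (odd-pairs b j) ≡ 0ℤ
      slack≡0 j = *-cancelˡ-≡ (+ 72) (slack (m j) (odd-pairs b j)) 0ℤ (proj₂ (parts j))
      shape-at : ∀ j {q} → residues p b j ≡ q → BlockShape (num q) (U j) (z j)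
      shape-at j eq = subst (λ q → BlockShape (num q) (U j) (z j)) eq (shape j)
      a-even : ∀ j → odd-pairs b j ≡ false → a j ≡ 0ℤ
      a-even j eq = go (odd-pairs b j) eq (a≡ j) (slack≡0 j)
        where
        go : ∀ q → q ≡ false → a j ≡ bit q + + 2 * m j → slack (m j) q ≡ 0ℤ → a j ≡ 0ℤ
        go false refl aj≡ s≡0 = trans aj≡ (cong (λ m → 0ℤ + + 2 * m) (i*i≡0⇒i≡0 (m j) (trans (cong (m j *_) (sym (+-identityʳ (m j)))) s≡0)))
      a-odd : ∀ j → odd-pairs b j ≡ true → ∃[ σ ] a j ≡ sgn σ
      a-odd j eq = go (odd-pairs b j) eq (a≡ j) (slack≡0 j)
        where
        signed-unit : ∀ {i} → ZeroOrMinusOne i → ∃[ σ ] + 1 + + 2 * i ≡ sgn σ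
        signed-unit (inj₁ refl) = true , refl
        signed-unit (inj₂ refl) = false , refl
        go : ∀ q → q ≡ true → a j ≡ bit q + + 2 * m j → slack (m j) q ≡ 0ℤ → ∃[ σ ] a j ≡ sgn σ
        go true refl aj≡ s≡0 = proj₁ u , trans aj≡ (proj₂ u)
          where u = signed-unit (i*[i+1]≡0 (m j) s≡0)

      triple-indexed : ∀ σ {q} → Constant (residues p b) (odd-pairs b) q →
        (∀ {U z} → BlockShape (num q) U z → (∀ k → ZeroOrMinusOne (z k)) → ∃[ i ] ∀ k → U k ≡ sgn σ * corner i k) →
        Indexed U a
      triple-indexed σ {q} const classify = triple σ (at 0F) (at 1F) (at 2F) , _ , blocks≡ , λ j → a-even j (proj₂ (const j))
        where
        hot : ∀ j → ∃[ i ] ∀ k → U j k ≡ sgn σ * corner i k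
        hot j = classify (shape-at j (proj₁ (const j))) (z∈ j)
        at : Fin 3 → Fin 6
        at j = proj₁ (hot j)
        blocks≡ : ∀ j k → U j k ≡ blocks (triple σ (at 0F) (at 1F) (at 2F)) j k
        blocks≡ 0F = proj₂ (hot 0F)
        blocks≡ 1F = proj₂ (hot 1F)
        blocks≡ 2F = proj₂ (hot 2F)

      cut-indexed : Special (residues p b) (odd-pairs b) → Indexed U a
      cut-indexed (j , r≡3 , even , others) = transport (cut-index U (λ h → + 6 * a h) (j , proj₁ s , proj₁ (proj₂ s) , proj₂ (proj₂ s)
        , (λ h k → shape-0 (shape-at (punchIn j h) (proj₁ (others h))) (z∈ (punchIn j h)) k)
        , cong (+ 6 *_) (a-even j even)
        , λ h → proj₁ (a-odd (punchIn j h) (proj₂ (others h))) , cong (+ 6 *_) (proj₂ (a-odd (punchIn j h) (proj₂ (others h))))))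
        where
        s = shape-3 (shape-at j r≡3) (z∈ j)
        transport : (∃[ i ] Valid i × (∀ j k → U j k ≡ blocks i j k) × (∀ j → + 6 * a j ≡ + 6 * pairs i j)) → Indexed U a
        transport (i , valid , U≡ , a≡) = i , valid , U≡ , λ j → *-cancelˡ-≡ (+ 6) (a j) (pairs i j) (a≡ j)

    indexed : Minimal p b → Indexed U a
    indexed (total≡ , inj₁ c)        = triple-indexed total≡ true c shape-1
    indexed (total≡ , inj₂ (inj₁ c)) = triple-indexed total≡ false c shape-5
    indexed (total≡ , inj₂ (inj₂ s)) = cut-indexed total≡ s

  lattice-block-sum : ∀ {U a a₃} → LatticePoint U a a₃ → ∀ j → sum (U j) ≡ 0ℤ
  lattice-block-sum {U} L j = begin
    sum (U j)
      ≡⟨ sum-cong-≗ (block≡ j) ⟩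
    sum (λ k → + 6 * x j k + κ * corner 5F k)
      ≡⟨ ∑-distrib-+ (λ k → + 6 * x j k) (λ k → κ * corner 5F k) ⟩
    sum (λ k → + 6 * x j k) + sum (λ k → κ * corner {6} 5F k)
      ≡⟨ cong₂ (λ u v → u + v) (trans (sym (*-distribˡ-sum (+ 6) (x j))) (cong (+ 6 *_) (Σx j)))
           (trans (sym (*-distribˡ-sum κ (corner {6} 5F))) (*-zeroʳ κ)) ⟩
    0ℤ ∎
    where
    open ≡-Reasoning
    open LatticePoint L
    κ = c₀ + + 3 * c j

  classification : ∀ {U a a₃} → LatticePoint U a a₃ → a₃ ≡ + 1 →
    sum (λ j → dot (U j) (U j) + + 18 * sq (a j)) ≡ + 90 → Indexed U a
  classification {U} {a} {a₃} L a₃≡1 norm = fromResidues (mod-6 c₀) (λ j → parity (c j))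
    where
    open LatticePoint L
    fromResidues : (∃[ p ] ∃[ d ] c₀ ≡ num {6} p + + 6 * d) → (∀ j → ∃[ b ] ∃[ e ] c j ≡ bit b + + 2 * e) → Indexed U a
    fromResidues (p , d , c₀≡) c≡ = T.indexed (minimal p (b′ 0F) (b′ 1F) (b′ 2F) odd T.total≤90)
      where
      b′ : Fin 3 → Bool
      b′ j = proj₁ (c≡ j)
      b : Fin 3 → Bool
      b = tri (b′ 0F) (b′ 1F) (b′ 2F)
      e : Fin 3 → ℤ
      e j = proj₁ (proj₂ (c≡ j))
      c≡b : ∀ j → c j ≡ bit (b j) + + 2 * e j
      c≡b j = trans (proj₂ (proj₂ (c≡ j))) (cong (λ q → bit q + + 2 * e j) (sym (tri-η b′ j)))
      odd : xor (parityᵇ p) (xor (b′ 0F) (xor (b′ 1F) (b′ 2F))) ≡ true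
      odd = xor-odd {w = w₃} {d} {e 0F} {e 1F} {e 2F} p (b′ 0F) (b′ 1F) (b′ 2F) c₀≡ (proj₂ (proj₂ (c≡ 0F))) (proj₂ (proj₂ (c≡ 1F)))
        (proj₂ (proj₂ (c≡ 2F))) (trans (sym a₃≡1) last≡)
      t : Fin 3 → ℤ
      t j = proj₁ (residue-spec p (b j))
      z : Fin 3 → Vector ℤ 6
      -- The coefficient c₀ + 3 c j equals r + 6 (t + d + e) with r the residue. Dividing the block
      -- by 6 leaves r and this quotient, and the corner subtracts the whole coefficient at position
      -- 5.
      z j k = x j k + (t j + d + e j) - (c₀ + + 3 * c j) * unit 5F k
      shape : ∀ j → BlockShape (num (residues p b j)) (U j) (z j)
      shape j = record { U≡ = λ k → trans (block≡ j k) (begin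
          + 6 * x j k + κ * (+ 1 + - + 6 * unit 5F k)
            ≡⟨ ring (x j k) κ (unit 5F k) (num p) (bit (b j)) d (e j) ⟩
          + 6 * (x j k + (d + e j) - κ * unit 5F k) + (num p + + 3 * bit (b j)) + (κ - (num p + + 6 * d + + 3 * (bit (b j) + + 2 * e j)))
            ≡⟨ cong₂ (λ u v → + 6 * (x j k + (d + e j) - κ * unit 5F k) + u + v) (proj₂ (residue-spec p (b j)))
                 (trans (cong (λ u → κ - u) (sym (cong₂ (λ u v → u + + 3 * v) c₀≡ (c≡b j)))) (+-inverseʳ κ)) ⟩
          + 6 * (x j k + (d + e j) - κ * unit 5F k) + (num (residue p (b j)) + + 6 * t j) + 0ℤ
            ≡⟨ ring′ (x j k) (κ * unit 5F k) (num (residue p (b j))) (t j) d (e j) ⟩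
          + 6 * (x j k + (t j + d + e j) - κ * unit 5F k) + num (residue p (b j)) ∎)
        ; ΣU≡0 = lattice-block-sum L j }
        where
        open ≡-Reasoning
        κ = c₀ + + 3 * c j
        ring : ∀ x κ u p b d e → + 6 * x + κ * (+ 1 + - + 6 * u) ≡
          + 6 * (x + (d + e) - κ * u) + (p + + 3 * b) + (κ - (p + + 6 * d + + 3 * (b + + 2 * e)))
        ring = solve-∀
        ring′ : ∀ x v r t d e → + 6 * (x + (d + e) - v) + (r + + 6 * t) + 0ℤ ≡ + 6 * (x + (t + d + e) - v) + r
        ring′ = solve-∀
      s : Fin 3 → ℤ
      s j = proj₁ (xor-spec (b (punchIn j 0F)) (b (punchIn j 1F)))
      m : Fin 3 → ℤ
      m j = w j + e (punchIn j 0F) + e (punchIn j 1F) + s j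
      a≡m : ∀ j → a j ≡ bit (odd-pairs b j) + + 2 * m j
      a≡m j = begin
        a j
          ≡⟨ pair≡ j ⟩
        + 2 * w j + (c h + c h′)
          ≡⟨ cong₂ (λ u v → + 2 * w j + (u + v)) (c≡b h) (c≡b h′) ⟩
        + 2 * w j + ((bit (b h) + + 2 * e h) + (bit (b h′) + + 2 * e h′))
          ≡⟨ ring (w j) (bit (b h)) (e h) (bit (b h′)) (e h′) ⟩
        (bit (b h) + bit (b h′)) + + 2 * (w j + e h + e h′)
          ≡⟨ cong (_+ + 2 * (w j + e h + e h′)) (proj₂ (xor-spec (b h) (b h′))) ⟩
        (bit (odd-pairs b j) + + 2 * s j) + + 2 * (w j + e h + e h′)
          ≡⟨ ring′ (bit (odd-pairs b j)) (s j) (w j + e h + e h′) ⟩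
        bit (odd-pairs b j) + + 2 * m j ∎
        where
        open ≡-Reasoning
        h = punchIn j 0F
        h′ = punchIn j 1F
        ring : ∀ w b e b′ e′ → + 2 * w + ((b + + 2 * e) + (b′ + + 2 * e′)) ≡ (b + b′) + + 2 * (w + e + e′)
        ring = solve-∀
        ring′ : ∀ q s v → (q + + 2 * s) + + 2 * v ≡ q + + 2 * (v + s)
        ring′ = solve-∀
      module T = Tight {p} {b} {U} {z} {a} {m} shape a≡m norm

  -- Coordinates in dimension 26

  -- The coordinates of v₁, v₂, v₃ (blk), of v₄, v₅, v₆ (pr) and of v₇ (end).
  blk : Fin 3 → Fin 6 → Fin 26
  blk 0F k = k ↑ˡ 20
  blk 1F k = 6 ↑ʳ (k ↑ˡ 14)
  blk 2F k = 6 ↑ʳ (6 ↑ʳ (k ↑ˡ 8))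

  pr : Fin 3 → Fin 2 → Fin 26
  pr 0F e = 6 ↑ʳ (6 ↑ʳ (6 ↑ʳ (e ↑ˡ 6)))
  pr 1F e = 6 ↑ʳ (6 ↑ʳ (6 ↑ʳ (2 ↑ʳ (e ↑ˡ 4))))
  pr 2F e = 6 ↑ʳ (6 ↑ʳ (6 ↑ʳ (2 ↑ʳ (2 ↑ʳ (e ↑ˡ 2)))))

  end : Fin 2 → Fin 26
  end e = 6 ↑ʳ (6 ↑ʳ (6 ↑ʳ (2 ↑ʳ (2 ↑ʳ (2 ↑ʳ e)))))

  by-split : ∀ m {n} {Q : Fin (m ℕ.+ n) → Set} → (∀ i → Q (i ↑ˡ n)) → (∀ i → Q (m ↑ʳ i)) → ∀ i → Q i
  by-split m {n} {Q} l r i = subst Q (Fin.join-splitAt m n i) (go (splitAt m i))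
    where
    go : ∀ s → Q (join m n s)
    go (inj₁ i) = l i
    go (inj₂ i) = r i

  by-coordinates : {Q : Fin 26 → Set} → (∀ j k → Q (blk j k)) → (∀ h e → Q (pr h e)) → (∀ e → Q (end e)) → ∀ i → Q i
  by-coordinates B p l = by-split 6 (B 0F) (by-split 6 (B 1F) (by-split 6 (B 2F)
    (by-split 2 (p 0F) (by-split 2 (p 1F) (by-split 2 (p 2F) l)))))

  -- Inner products split into blocks, pairs and the end

  module Geometry (𝔸 : ℤ-Algebra) where
    open Notation 𝔸
    open Pairing 𝔸 using (dotι; module Solver; sum-cong-≋)
      renaming (pairing to pairingᴬ; sum to sumᴬ; ∑-distrib-+ to ∑-distrib-⊕; *-distribˡ-sum to ⊗-distribˡ-sum)
    open Descent 𝔸 using (ι-sum; ι-dotι; ι-pairing)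
    open Solver using (solve; con; _:=_; _:+_; _:*_; _:-_; :-_)
    open import Relation.Binary.Reasoning.Setoid (ℤ-Algebra.setoid 𝔸)

    sum-split : ∀ m {n} (f : Vector Carrier (m ℕ.+ n)) → sumᴬ f ≈ sumᴬ (λ i → f (i ↑ˡ n)) ⊕ sumᴬ (λ i → f (m ↑ʳ i))
    sum-split zero    f = ≈-sym (⊕-identityˡ (sumᴬ f))
    sum-split (suc m) f = ≈-trans (⊕-congˡ (sum-split m (f ∘ suc))) (≈-sym (⊕-assoc _ _ _))

    sum-coordinates : ∀ (f : Vector Carrier 26) →
      sumᴬ f ≈ sumᴬ (λ j → sumᴬ (f ∘ blk j)) ⊕ (sumᴬ (λ h → sumᴬ (f ∘ pr h)) ⊕ sumᴬ (f ∘ end))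
    sum-coordinates f = begin
      sumᴬ f
        ≈⟨ ≈-trans (sum-split 6 f) (⊕-congˡ (≈-trans (sum-split 6 (f ∘ (6 ↑ʳ_))) (⊕-congˡ (≈-trans (sum-split 6 (f ∘ λ i → 6 ↑ʳ (6 ↑ʳ i)))
           (⊕-congˡ (≈-trans (sum-split 2 (f ∘ λ i → 6 ↑ʳ (6 ↑ʳ (6 ↑ʳ i)))) (⊕-congˡ (≈-trans (sum-split 2 (f ∘ λ i → 6 ↑ʳ (6 ↑ʳ (6 ↑ʳ (2 ↑ʳ i)))))
           (⊕-congˡ (sum-split 2 (f ∘ λ i → 6 ↑ʳ (6 ↑ʳ (6 ↑ʳ (2 ↑ʳ (2 ↑ʳ i))))))))))))))) ⟩
      B 0F ⊕ (B 1F ⊕ (B 2F ⊕ (p 0F ⊕ (p 1F ⊕ (p 2F ⊕ sumᴬ (f ∘ end))))))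
        ≈⟨ solve 7 (λ a b c d e f g → a :+ (b :+ (c :+ (d :+ (e :+ (f :+ g))))) :=
             (a :+ (b :+ (c :+ con 0ℤ))) :+ ((d :+ (e :+ (f :+ con 0ℤ))) :+ g)) ≈-refl (B 0F) (B 1F) (B 2F) (p 0F) (p 1F) (p 2F) (sumᴬ (f ∘ end)) ⟩
      (B 0F ⊕ (B 1F ⊕ (B 2F ⊕ ι 0ℤ))) ⊕ ((p 0F ⊕ (p 1F ⊕ (p 2F ⊕ ι 0ℤ))) ⊕ sumᴬ (f ∘ end))
        ≈⟨ ⊕-cong (⊕-congˡ (⊕-congˡ (⊕-congˡ ι-0))) (⊕-congʳ (⊕-congˡ (⊕-congˡ (⊕-congˡ ι-0)))) ⟩
      sumᴬ B ⊕ (sumᴬ p ⊕ sumᴬ (f ∘ end)) ∎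
      where
      B p : Fin 3 → Carrier
      B j = sumᴬ (f ∘ blk j)
      p h = sumᴬ (f ∘ pr h)

    inner : ∀ {n} → Vector Carrier n → Vector Carrier n → Carrier
    inner u v = sumᴬ (λ k → u k ⊗ v k)

    -- Seven linear equations, cutting out a subspace of dimension 26 - 7 = 19 that contains ℝL;
    -- membership of `v` in ℝL is used in this form.
    record ZeroSums (v : Vector Carrier 26) : Set where
      field
        block-sum : ∀ j → sumᴬ (v ∘ blk j) ≈ 0#
        pair-sum  : ∀ h → sumᴬ (v ∘ pr h) ≈ 0#
        end-sum   : sumᴬ (v ∘ end) ≈ 0#
    open ZeroSums

    opposite : ∀ {a b} → a ⊕ (b ⊕ 0#) ≈ 0# → b ≈ ι (- + 1) ⊗ a
    opposite {a} {b} eq = begin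
      b                                              ≈⟨ solve 2 (λ a b → b := (a :+ (b :+ con 0ℤ)) :+ con (- + 1) :* a) ≈-refl a b ⟩
      (a ⊕ (b ⊕ ι 0ℤ)) ⊕ ι (- + 1) ⊗ a               ≈⟨ ⊕-congʳ (≈-trans (⊕-congˡ (⊕-congˡ ι-0)) eq) ⟩
      0# ⊕ ι (- + 1) ⊗ a                             ≈⟨ ⊕-identityˡ _ ⟩
      ι (- + 1) ⊗ a                                  ∎

    record IsRoot (r : Vector Carrier 26) : Set where
      field
        root-block : ∀ j k → r (blk j k) ≈ 0#
        root-pair  : ∀ h e → r (pr h e) ≈ 0#
        root-end₀  : r (end 0F) ≈ ι (+ 1)
        root-end₁  : r (end 1F) ≈ ι (- + 1)
    open IsRoot

    sum-zero-terms : ∀ {n} {f : Vector Carrier n} → (∀ k → f k ≈ 0#) → sumᴬ f ≈ 0#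
    sum-zero-terms {zero}  f≈0 = ≈-refl
    sum-zero-terms {suc n} f≈0 = ≈-trans (⊕-cong (f≈0 zero) (sum-zero-terms (f≈0 ∘ suc))) (⊕-identityˡ 0#)

    inner-root : ∀ {v r} → ZeroSums v → IsRoot r → inner v r ≈ ι (+ 2) ⊗ v (end 0F)
    inner-root {v} {r} v-zero r-root = begin
      inner v r
        ≈⟨ sum-coordinates (λ k → v k ⊗ r k) ⟩
      sumᴬ (λ j → sumᴬ (λ k → v (blk j k) ⊗ r (blk j k))) ⊕ (sumᴬ (λ h → sumᴬ (λ e → v (pr h e) ⊗ r (pr h e))) ⊕ sumᴬ (λ e → v (end e) ⊗ r (end e)))
        ≈⟨ ⊕-cong (sum-zero-terms {3} (λ j → sum-zero-terms {6} (λ k → ≈-trans (⊗-congˡ (root-block r-root j k)) (⊗-zeroʳ (v (blk j k))))))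
             (⊕-congʳ (sum-zero-terms {3} (λ h → sum-zero-terms {2} (λ e → ≈-trans (⊗-congˡ (root-pair r-root h e)) (⊗-zeroʳ (v (pr h e))))))) ⟩
      0# ⊕ (0# ⊕ sumᴬ (λ e → v (end e) ⊗ r (end e)))
        ≈⟨ ≈-trans (⊕-identityˡ _) (⊕-identityˡ _) ⟩
      v (end 0F) ⊗ r (end 0F) ⊕ (v (end 1F) ⊗ r (end 1F) ⊕ 0#)
        ≈⟨ ⊕-cong (⊗-congˡ (root-end₀ r-root)) (≈-trans (⊕-identityʳ _) (⊗-cong (opposite (end-sum v-zero)) (root-end₁ r-root))) ⟩
      v (end 0F) ⊗ ι (+ 1) ⊕ (ι (- + 1) ⊗ v (end 0F)) ⊗ ι (- + 1)
        ≈⟨ solve 1 (λ e → e :* con (+ 1) :+ (con (- + 1) :* e) :* con (- + 1) := con (+ 2) :* e) ≈-refl (v (end 0F)) ⟩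
      ι (+ 2) ⊗ v (end 0F) ∎

    blockPart : Vector Carrier 26 → Fin 3 → Vector Carrier 6
    blockPart v j k = ι (+ 6) ⊗ v (blk j k)

    -- Twelve and not six: the two entries of a pair are opposite and contribute equally to an inner
    -- product, and the doubled factor lets `pairing-cut` weigh pair and block entries alike.
    pairPart : Vector Carrier 26 → Vector Carrier 3
    pairPart v h = ι (+ 12) ⊗ v (pr h 0F)

    -- Lattice pairs are integer multiples of α₁ = (½, -½), so they become 3 (a, -a) when scaled by
    -- 6.
    record Represents (v : Vector Carrier 26) (U : Fin 3 → Vector ℤ 6) (a : Fin 3 → ℤ) (a₃ : ℤ) : Set where
      field
        rep-block : ∀ j k → ι (+ 6) ⊗ v (blk j k) ≈ ι (U j k)
        rep-pair₀ : ∀ h → ι (+ 6) ⊗ v (pr h 0F) ≈ ι (+ 3 * a h)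
        rep-pair₁ : ∀ h → ι (+ 6) ⊗ v (pr h 1F) ≈ ι (- + 3 * a h)
        rep-end₀  : ι (+ 6) ⊗ v (end 0F) ≈ ι (+ 3 * a₃)
        rep-end₁  : ι (+ 6) ⊗ v (end 1F) ≈ ι (- + 3 * a₃)
    open Represents

    RepresentsIndex : Vector Carrier 26 → Index → Set
    RepresentsIndex v i = Represents v (blocks i) (pairs i) (+ 1)

    Rooted : Vector Carrier 26 → Set
    Rooted v = ι (+ 2) ⊗ v (end 0F) ≈ ι (+ 1)

    private
      scale-sum : ∀ {n} c (f : Vector Carrier n) g → (∀ k → c ⊗ f k ≈ g k) → c ⊗ sumᴬ f ≈ sumᴬ g
      scale-sum {n} c f g eq = ≈-trans (⊗-distribˡ-sum c f) (sum-cong-≋ {n} eq)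

      product-36 : ∀ a b → ι (+ 36) ⊗ (a ⊗ b) ≈ (ι (+ 6) ⊗ a) ⊗ (ι (+ 6) ⊗ b)
      product-36 = solve 2 (λ a b → con (+ 36) :* (a :* b) := (con (+ 6) :* a) :* (con (+ 6) :* b)) ≈-refl

      pair-36 : ∀ {v₀ v₁ w₀ w₁} a → v₀ ⊕ (v₁ ⊕ 0#) ≈ 0# → ι (+ 6) ⊗ w₀ ≈ ι (+ 3 * a) → ι (+ 6) ⊗ w₁ ≈ ι (- + 3 * a) →
        ι (+ 36) ⊗ (v₀ ⊗ w₀ ⊕ (v₁ ⊗ w₁ ⊕ 0#)) ≈ ι (+ 3) ⊗ ((ι (+ 12) ⊗ v₀) ⊗ ι a)
      pair-36 {v₀} {v₁} {w₀} {w₁} a v-zero w₀≈ w₁≈ = begin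
        ι (+ 36) ⊗ (v₀ ⊗ w₀ ⊕ (v₁ ⊗ w₁ ⊕ 0#))
          ≈⟨ ⊗-congˡ (⊕-congˡ (⊕-identityʳ _)) ⟩
        ι (+ 36) ⊗ (v₀ ⊗ w₀ ⊕ v₁ ⊗ w₁)
          ≈⟨ solve 4 (λ a b c d → con (+ 36) :* (a :* c :+ b :* d) := con (+ 6) :* a :* (con (+ 6) :* c) :+ con (+ 6) :* b :* (con (+ 6) :* d)) ≈-refl v₀ v₁ w₀ w₁ ⟩
        ι (+ 6) ⊗ v₀ ⊗ (ι (+ 6) ⊗ w₀) ⊕ ι (+ 6) ⊗ v₁ ⊗ (ι (+ 6) ⊗ w₁)
          ≈⟨ ⊕-cong (⊗-congˡ (≈-trans w₀≈ (ι-* (+ 3) a))) (⊗-cong (⊗-congˡ (opposite v-zero)) (≈-trans w₁≈ (ι-* (- + 3) a))) ⟩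
        ι (+ 6) ⊗ v₀ ⊗ (ι (+ 3) ⊗ ι a) ⊕ ι (+ 6) ⊗ (ι (- + 1) ⊗ v₀) ⊗ (ι (- + 3) ⊗ ι a)
          ≈⟨ solve 2 (λ v a → con (+ 6) :* v :* (con (+ 3) :* a) :+ con (+ 6) :* (con (- + 1) :* v) :* (con (- + 3) :* a) := con (+ 3) :* (con (+ 12) :* v :* a)) ≈-refl v₀ (ι a) ⟩
        ι (+ 3) ⊗ (ι (+ 12) ⊗ v₀ ⊗ ι a) ∎

      square-72 : ∀ {v₀ v₁} → v₀ ⊕ (v₁ ⊕ 0#) ≈ 0# →
        ι (+ 72) ⊗ (v₀ ⊗ v₀ ⊕ (v₁ ⊗ v₁ ⊕ 0#)) ≈ (ι (+ 12) ⊗ v₀) ⊗ (ι (+ 12) ⊗ v₀)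
      square-72 {v₀} {v₁} v-zero = begin
        ι (+ 72) ⊗ (v₀ ⊗ v₀ ⊕ (v₁ ⊗ v₁ ⊕ 0#))
          ≈⟨ ⊗-congˡ (⊕-congˡ (≈-trans (⊕-identityʳ _) (⊗-cong (opposite v-zero) (opposite v-zero)))) ⟩
        ι (+ 72) ⊗ (v₀ ⊗ v₀ ⊕ (ι (- + 1) ⊗ v₀) ⊗ (ι (- + 1) ⊗ v₀))
          ≈⟨ solve 1 (λ v → con (+ 72) :* (v :* v :+ (con (- + 1) :* v) :* (con (- + 1) :* v)) := (con (+ 12) :* v) :* (con (+ 12) :* v)) ≈-refl v₀ ⟩
        (ι (+ 12) ⊗ v₀) ⊗ (ι (+ 12) ⊗ v₀) ∎

    inner-represented : ∀ {v w U a} → ZeroSums v → Rooted v → Represents w U a (+ 1) →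
      ι (+ 36) ⊗ inner v w ≈ (sumᴬ (λ j → dotι (blockPart v j) (U j)) ⊕ ι (+ 3) ⊗ dotι (pairPart v) a) ⊕ ι (+ 18)
    inner-represented {v} {w} {U} {a} v-zero v-root w-rep = begin
      ι (+ 36) ⊗ inner v w
        ≈⟨ ⊗-congˡ (sum-coordinates (λ k → v k ⊗ w k)) ⟩
      ι (+ 36) ⊗ (B ⊕ (p ⊕ l))
        ≈⟨ solve 3 (λ a b c → con (+ 36) :* (a :+ (b :+ c)) := (con (+ 36) :* a :+ con (+ 36) :* b) :+ con (+ 36) :* c) ≈-refl B p l ⟩
      (ι (+ 36) ⊗ B ⊕ ι (+ 36) ⊗ p) ⊕ ι (+ 36) ⊗ l
        ≈⟨ ⊕-cong (⊕-cong
             (scale-sum {3} (ι (+ 36)) (λ j → sumᴬ (λ k → v (blk j k) ⊗ w (blk j k))) (λ j → dotι (blockPart v j) (U j))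
               (λ j → scale-sum {6} (ι (+ 36)) (λ k → v (blk j k) ⊗ w (blk j k)) (λ k → blockPart v j k ⊗ ι (U j k))
                 (λ k → ≈-trans (product-36 (v (blk j k)) (w (blk j k))) (⊗-congˡ (rep-block w-rep j k)))))
             (≈-trans (scale-sum {3} (ι (+ 36)) (λ h → sumᴬ (λ e → v (pr h e) ⊗ w (pr h e))) (λ h → ι (+ 3) ⊗ (pairPart v h ⊗ ι (a h)))
               (λ h → pair-36 (a h) (pair-sum v-zero h) (rep-pair₀ w-rep h) (rep-pair₁ w-rep h)))
               (≈-sym (⊗-distribˡ-sum (ι (+ 3)) (λ h → pairPart v h ⊗ ι (a h))))))
             last ⟩
      (sumᴬ (λ j → dotι (blockPart v j) (U j)) ⊕ ι (+ 3) ⊗ dotι (pairPart v) a) ⊕ ι (+ 18) ∎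
      where
      B = sumᴬ (λ j → sumᴬ (λ k → v (blk j k) ⊗ w (blk j k)))
      p = sumᴬ (λ h → sumᴬ (λ e → v (pr h e) ⊗ w (pr h e)))
      l = sumᴬ (λ e → v (end e) ⊗ w (end e))
      last : ι (+ 36) ⊗ l ≈ ι (+ 18)
      last = begin
        ι (+ 36) ⊗ l                                        ≈⟨ pair-36 (+ 1) (end-sum v-zero) (rep-end₀ w-rep) (rep-end₁ w-rep) ⟩
        ι (+ 3) ⊗ ((ι (+ 12) ⊗ v (end 0F)) ⊗ ι (+ 1))       ≈⟨ solve 1 (λ e → con (+ 3) :* ((con (+ 12) :* e) :* con (+ 1)) := con (+ 18) :* (con (+ 2) :* e)) ≈-refl (v (end 0F)) ⟩
        ι (+ 18) ⊗ (ι (+ 2) ⊗ v (end 0F))                   ≈⟨ ⊗-congˡ v-root ⟩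
        ι (+ 18) ⊗ ι (+ 1)                                  ≈⟨ ι-* (+ 18) (+ 1) ⟨
        ι (+ 18)                                            ∎

    -- With 72 in place of 36, a pair contributes 144 v₀², the square of its entry in `pairPart`;
    -- this is the origin of the factor 2 in front of the blocks.
    inner-square : ∀ {v} → ZeroSums v → Rooted v → ι (+ 72) ⊗ inner v v ≈
      (ι (+ 2) ⊗ sumᴬ (λ j → inner (blockPart v j) (blockPart v j)) ⊕ inner (pairPart v) (pairPart v)) ⊕ ι (+ 36)
    inner-square {v} v-zero v-root = begin
      ι (+ 72) ⊗ inner v v
        ≈⟨ ⊗-congˡ (sum-coordinates (λ k → v k ⊗ v k)) ⟩
      ι (+ 72) ⊗ (B ⊕ (p ⊕ l))
        ≈⟨ solve 3 (λ a b c → con (+ 72) :* (a :+ (b :+ c)) := (con (+ 2) :* (con (+ 36) :* a) :+ con (+ 72) :* b) :+ con (+ 72) :* c) ≈-refl B p l ⟩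
      (ι (+ 2) ⊗ (ι (+ 36) ⊗ B) ⊕ ι (+ 72) ⊗ p) ⊕ ι (+ 72) ⊗ l
        ≈⟨ ⊕-cong (⊕-cong
             (⊗-congˡ (scale-sum {3} (ι (+ 36)) (λ j → sumᴬ (λ k → v (blk j k) ⊗ v (blk j k))) (λ j → inner (blockPart v j) (blockPart v j))
               (λ j → scale-sum {6} (ι (+ 36)) (λ k → v (blk j k) ⊗ v (blk j k)) (λ k → blockPart v j k ⊗ blockPart v j k)
                 (λ k → product-36 (v (blk j k)) (v (blk j k))))))
             (scale-sum {3} (ι (+ 72)) (λ h → sumᴬ (λ e → v (pr h e) ⊗ v (pr h e))) (λ h → pairPart v h ⊗ pairPart v h)
               (λ h → square-72 (pair-sum v-zero h))))
             last ⟩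
      (ι (+ 2) ⊗ sumᴬ (λ j → inner (blockPart v j) (blockPart v j)) ⊕ inner (pairPart v) (pairPart v)) ⊕ ι (+ 36) ∎
      where
      B = sumᴬ (λ j → sumᴬ (λ k → v (blk j k) ⊗ v (blk j k)))
      p = sumᴬ (λ h → sumᴬ (λ e → v (pr h e) ⊗ v (pr h e)))
      l = sumᴬ (λ e → v (end e) ⊗ v (end e))
      last : ι (+ 72) ⊗ l ≈ ι (+ 36)
      last = begin
        ι (+ 72) ⊗ l                                            ≈⟨ square-72 (end-sum v-zero) ⟩
        (ι (+ 12) ⊗ v (end 0F)) ⊗ (ι (+ 12) ⊗ v (end 0F))       ≈⟨ solve 1 (λ e → (con (+ 12) :* e) :* (con (+ 12) :* e) := con (+ 36) :* ((con (+ 2) :* e) :* (con (+ 2) :* e))) ≈-refl (v (end 0F)) ⟩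
        ι (+ 36) ⊗ ((ι (+ 2) ⊗ v (end 0F)) ⊗ (ι (+ 2) ⊗ v (end 0F))) ≈⟨ ⊗-congˡ (⊗-cong v-root v-root) ⟩
        ι (+ 36) ⊗ (ι (+ 1) ⊗ ι (+ 1))                          ≈⟨ solve 0 (con (+ 36) :* (con (+ 1) :* con (+ 1)) := con (+ 36)) ≈-refl ⟩
        ι (+ 36)                                                ∎

    norm-equation : ∀ {v} → ZeroSums v → Rooted v → inner v v ≈ ι (+ 3) →
      ι (+ 2) ⊗ sumᴬ (λ j → inner (blockPart v j) (blockPart v j)) ⊕ inner (pairPart v) (pairPart v) ≈ ι (+ 180)
    norm-equation {v} v-zero v-root norm = begin
      S                                 ≈⟨ solve 1 (λ s → s := (s :+ con (+ 36)) :+ con (- + 36)) ≈-refl S ⟩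
      (S ⊕ ι (+ 36)) ⊕ ι (- + 36)       ≈⟨ ⊕-congʳ (inner-square v-zero v-root) ⟨
      ι (+ 72) ⊗ inner v v ⊕ ι (- + 36) ≈⟨ ⊕-congʳ (⊗-congˡ norm) ⟩
      ι (+ 72) ⊗ ι (+ 3) ⊕ ι (- + 36)   ≈⟨ solve 0 (con (+ 72) :* con (+ 3) :+ con (- + 36) := con (+ 180)) ≈-refl ⟩
      ι (+ 180)                         ∎
      where S = ι (+ 2) ⊗ sumᴬ (λ j → inner (blockPart v j) (blockPart v j)) ⊕ inner (pairPart v) (pairPart v)

    represents-unique : ∀ {v w U a a₃} → Represents v U a a₃ → Represents w U a a₃ → ∀ k → v k ≈ w k
    represents-unique {v} {w} p q = by-coordinates
      (λ j k → ι-cancel 5 (≈-trans (rep-block p j k) (≈-sym (rep-block q j k))))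
      (λ { h 0F → ι-cancel 5 (≈-trans (rep-pair₀ p h) (≈-sym (rep-pair₀ q h)))
         ; h 1F → ι-cancel 5 (≈-trans (rep-pair₁ p h) (≈-sym (rep-pair₁ q h))) })
      (λ { 0F → ι-cancel 5 (≈-trans (rep-end₀ p) (≈-sym (rep-end₀ q)))
         ; 1F → ι-cancel 5 (≈-trans (rep-end₁ p) (≈-sym (rep-end₁ q))) })

  -- Sums and multiples of lattice points

  point-+ : ∀ {U a a₃ U′ a′ a₃′} → LatticePoint U a a₃ → LatticePoint U′ a′ a₃′ →
    LatticePoint (λ j k → U j k + U′ j k) (λ h → a h + a′ h) (a₃ + a₃′)
  point-+ p q = record
    { x      = λ j k → P.x j k + Q.x j k
    ; w      = λ h → P.w h + Q.w h
    ; w₃     = P.w₃ + Q.w₃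
    ; c₀     = P.c₀ + Q.c₀
    ; c      = λ h → P.c h + Q.c h
    ; Σx     = λ j → trans (∑-distrib-+ (P.x j) (Q.x j)) (cong₂ (λ u v → u + v) (P.Σx j) (Q.Σx j))
    ; block≡ = λ j k → trans (cong₂ (λ u v → u + v) (P.block≡ j k) (Q.block≡ j k))
        (block-ring (P.x j k) (Q.x j k) P.c₀ Q.c₀ (P.c j) (Q.c j) (corner 5F k))
    ; pair≡  = λ h → trans (cong₂ (λ u v → u + v) (P.pair≡ h) (Q.pair≡ h))
        (pair-ring (P.w h) (Q.w h) (P.c (punchIn h 0F)) (Q.c (punchIn h 0F)) (P.c (punchIn h 1F)) (Q.c (punchIn h 1F)))
    ; last≡  = trans (cong₂ (λ u v → u + v) P.last≡ Q.last≡)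
        (last-ring P.w₃ Q.w₃ P.c₀ Q.c₀ (P.c 0F) (Q.c 0F) (P.c 1F) (Q.c 1F) (P.c 2F) (Q.c 2F))
    }
    where
    module P = LatticePoint p
    module Q = LatticePoint q
    block-ring : ∀ x x′ c₀ c₀′ c c′ u →
      (+ 6 * x + (c₀ + + 3 * c) * u) + (+ 6 * x′ + (c₀′ + + 3 * c′) * u) ≡ + 6 * (x + x′) + (c₀ + c₀′ + + 3 * (c + c′)) * u
    block-ring = solve-∀
    pair-ring : ∀ w w′ c c′ d d′ → (+ 2 * w + (c + d)) + (+ 2 * w′ + (c′ + d′)) ≡ + 2 * (w + w′) + ((c + c′) + (d + d′))
    pair-ring = solve-∀
    last-ring : ∀ w w′ c₀ c₀′ c₁ c₁′ c₂ c₂′ c₃ c₃′ →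
      (+ 2 * w + (c₀ + (c₁ + (c₂ + c₃)))) + (+ 2 * w′ + (c₀′ + (c₁′ + (c₂′ + c₃′)))) ≡
      + 2 * (w + w′) + ((c₀ + c₀′) + ((c₁ + c₁′) + ((c₂ + c₂′) + (c₃ + c₃′))))
    last-ring = solve-∀

  point-* : ∀ {U a a₃} z → LatticePoint U a a₃ → LatticePoint (λ j k → z * U j k) (λ h → z * a h) (z * a₃)
  point-* z p = record
    { x      = λ j k → z * x j k
    ; w      = λ h → z * w h
    ; w₃     = z * w₃
    ; c₀     = z * c₀
    ; c      = λ h → z * c h
    ; Σx     = λ j → trans (sym (*-distribˡ-sum z (x j))) (trans (cong (z *_) (Σx j)) (*-zeroʳ z))
    ; block≡ = λ j k → trans (cong (z *_) (block≡ j k)) (block-ring z (x j k) c₀ (c j) (corner 5F k))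
    ; pair≡  = λ h → trans (cong (z *_) (pair≡ h)) (pair-ring z (w h) (c (punchIn h 0F)) (c (punchIn h 1F)))
    ; last≡  = trans (cong (z *_) last≡) (last-ring z w₃ c₀ (c 0F) (c 1F) (c 2F))
    }
    where
    open LatticePoint p
    block-ring : ∀ z x c₀ c u → z * (+ 6 * x + (c₀ + + 3 * c) * u) ≡ + 6 * (z * x) + (z * c₀ + + 3 * (z * c)) * u
    block-ring = solve-∀
    pair-ring : ∀ z w c d → z * (+ 2 * w + (c + d)) ≡ + 2 * (z * w) + (z * c + z * d)
    pair-ring = solve-∀
    last-ring : ∀ z w c₀ c₁ c₂ c₃ → z * (+ 2 * w + (c₀ + (c₁ + (c₂ + c₃)))) ≡ + 2 * (z * w) + (z * c₀ + (z * c₁ + (z * c₂ + z * c₃)))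
    last-ring = solve-∀

  point-0 : LatticePoint (λ _ _ → 0ℤ) (λ _ → 0ℤ) 0ℤ
  point-0 = record
    { x = λ _ _ → 0ℤ ; w = λ _ → 0ℤ ; w₃ = 0ℤ ; c₀ = 0ℤ ; c = λ _ → 0ℤ
    ; Σx = λ _ → refl ; block≡ = λ _ k → refl ; pair≡ = λ _ → refl ; last≡ = refl }

  -- Lattice vectors of norm 3 and the vectors of indices

  module LatticeGeometry (𝔸 : ℤ-Algebra) where
    open Notation 𝔸
    open Pairing 𝔸 using (dotι; module Solver; sum-cong-≋)
      renaming (pairing to pairingᴬ; sum to sumᴬ; *-distribˡ-sum to ⊗-distribˡ-sum; ∑-distrib-+ to ∑-distrib-⊕)
    open Descent 𝔸 using (ι-sum; ι-dotι; ι-pairing)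
    open Extension 𝔸 using (ι-squares; norm-descends)
    open Geometry 𝔸
    open Represents
    open ZeroSums
    open Solver using (solve; con; _:=_; _:+_; _:*_; _:-_; :-_)
    open import Relation.Binary.Reasoning.Setoid (ℤ-Algebra.setoid 𝔸)

    represents-from-parts : ∀ {v U a} → ZeroSums v → Rooted v → (∀ j k → blockPart v j k ≈ ι (U j k)) →
      (∀ h → pairPart v h ≈ ι (+ 6 * a h)) → Represents v U a (+ 1)
    represents-from-parts {v} {U} {a} v-zero v-root P≈U g≈a = record
      { rep-block = P≈U
      ; rep-pair₀ = first
      ; rep-pair₁ = λ h → negated (pair-sum v-zero h) (first h)
      ; rep-end₀  = end₀
      ; rep-end₁  = negated {b = + 1} (end-sum v-zero) end₀
      }
      where
      first : ∀ h → ι (+ 6) ⊗ v (pr h 0F) ≈ ι (+ 3 * a h)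
      first h = ι-cancel 1 (begin
        ι (+ 2) ⊗ (ι (+ 6) ⊗ v (pr h 0F))   ≈⟨ solve 1 (λ v → con (+ 2) :* (con (+ 6) :* v) := con (+ 12) :* v) ≈-refl (v (pr h 0F)) ⟩
        pairPart v h                        ≈⟨ g≈a h ⟩
        ι (+ 6 * a h)                       ≡⟨ cong ι (*-assoc (+ 2) (+ 3) (a h)) ⟩
        ι (+ 2 * (+ 3 * a h))               ≈⟨ ι-* (+ 2) (+ 3 * a h) ⟩
        ι (+ 2) ⊗ ι (+ 3 * a h)             ∎)
      end₀ : ι (+ 6) ⊗ v (end 0F) ≈ ι (+ 3)
      end₀ = begin
        ι (+ 6) ⊗ v (end 0F)                ≈⟨ solve 1 (λ v → con (+ 6) :* v := con (+ 3) :* (con (+ 2) :* v)) ≈-refl (v (end 0F)) ⟩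
        ι (+ 3) ⊗ (ι (+ 2) ⊗ v (end 0F))    ≈⟨ ⊗-congˡ v-root ⟩
        ι (+ 3) ⊗ ι (+ 1)                   ≈⟨ ι-* (+ 3) (+ 1) ⟨
        ι (+ 3)                             ∎
      negated : ∀ {x y b} → x ⊕ (y ⊕ 0#) ≈ 0# → ι (+ 6) ⊗ x ≈ ι (+ 3 * b) → ι (+ 6) ⊗ y ≈ ι (- + 3 * b)
      negated {x} {y} {b} x+y x≈ = begin
        ι (+ 6) ⊗ y                         ≈⟨ ⊗-congˡ (opposite x+y) ⟩
        ι (+ 6) ⊗ (ι (- + 1) ⊗ x)           ≈⟨ solve 1 (λ x → con (+ 6) :* (con (- + 1) :* x) := con (- + 1) :* (con (+ 6) :* x)) ≈-refl x ⟩
        ι (- + 1) ⊗ (ι (+ 6) ⊗ x)           ≈⟨ ⊗-congˡ x≈ ⟩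
        ι (- + 1) ⊗ ι (+ 3 * b)             ≈⟨ ι-* (- + 1) (+ 3 * b) ⟨
        ι (- + 1 * (+ 3 * b))               ≡⟨ cong ι (sym (*-assoc (- + 1) (+ 3) b)) ⟩
        ι (- + 3 * b)                       ∎

    zero-sums : ∀ {v U a a₃} → Represents v U a a₃ → (∀ j → sum (U j) ≡ 0ℤ) → ZeroSums v
    zero-sums {v} {U} {a} {a₃} rep ΣU = record
      { block-sum = λ j → vanishes (v ∘ blk j) (U j) (rep-block rep j) (ΣU j)
      ; pair-sum  = λ h → vanishes (v ∘ pr h) (+ 3 * a h F.∷ - + 3 * a h F.∷ F.[])
          (λ { 0F → rep-pair₀ rep h ; 1F → rep-pair₁ rep h }) (ring (a h))
      ; end-sum   = vanishes (v ∘ end) (+ 3 * a₃ F.∷ - + 3 * a₃ F.∷ F.[]) (λ { 0F → rep-end₀ rep ; 1F → rep-end₁ rep }) (ring a₃)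
      }
      where
      ring : ∀ a → + 3 * a + (- + 3 * a + 0ℤ) ≡ 0ℤ
      ring = solve-∀
      vanishes : ∀ {n} (f : Vector Carrier n) (F : Vector ℤ n) → (∀ k → ι (+ 6) ⊗ f k ≈ ι (F k)) → sum F ≡ 0ℤ → sumᴬ f ≈ 0#
      vanishes {n} f F f≈F ΣF = ι-cancel 5 (begin
        ι (+ 6) ⊗ sumᴬ f                    ≈⟨ ⊗-distribˡ-sum (ι (+ 6)) f ⟩
        sumᴬ (λ k → ι (+ 6) ⊗ f k)          ≈⟨ sum-cong-≋ {n} f≈F ⟩
        sumᴬ (ι ∘ F)                        ≈⟨ ι-sum F ⟩
        ι (sum F)                           ≡⟨ cong ι ΣF ⟩
        ι 0ℤ                                ≈⟨ ι-0 ⟩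
        0#                                  ≈⟨ ⊗-zeroʳ (ι (+ 6)) ⟨
        ι (+ 6) ⊗ 0#                        ∎)

    record InLattice (v : Vector Carrier 26) : Set where
      constructor inLattice
      field
        {scaled}    : Fin 3 → Vector ℤ 6
        {pair-entries}   : Fin 3 → ℤ
        {end-entry}  : ℤ
        represents  : Represents v scaled pair-entries end-entry
        point       : LatticePoint scaled pair-entries end-entry
    open InLattice

    lattice-zero-sums : ∀ {v} → InLattice v → ZeroSums v
    lattice-zero-sums (inLattice rep p) = zero-sums rep (lattice-block-sum p)

    pair-values : ∀ {v U a a₃} → Represents v U a a₃ → ∀ h → pairPart v h ≈ ι (+ 6 * a h)
    pair-values {v} {U} {a} rep h = begin
      ι (+ 12) ⊗ v (pr h 0F)                ≈⟨ solve 1 (λ v → con (+ 12) :* v := con (+ 2) :* (con (+ 6) :* v)) ≈-refl (v (pr h 0F)) ⟩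
      ι (+ 2) ⊗ (ι (+ 6) ⊗ v (pr h 0F))     ≈⟨ ⊗-congˡ (rep-pair₀ rep h) ⟩
      ι (+ 2) ⊗ ι (+ 3 * a h)               ≈⟨ ι-* (+ 2) (+ 3 * a h) ⟨
      ι (+ 2 * (+ 3 * a h))                 ≡⟨ cong ι (sym (*-assoc (+ 2) (+ 3) (a h))) ⟩
      ι (+ 6 * a h)                         ∎

    end-value : ∀ {v U a a₃} → Represents v U a a₃ → Rooted v → a₃ ≡ + 1
    end-value {v} {a₃ = a₃} rep v-root = *-cancelˡ-≡ (+ 3) a₃ (+ 1) (ι-injective (begin
      ι (+ 3 * a₃)                          ≈⟨ rep-end₀ rep ⟨
      ι (+ 6) ⊗ v (end 0F)                  ≈⟨ solve 1 (λ v → con (+ 6) :* v := con (+ 3) :* (con (+ 2) :* v)) ≈-refl (v (end 0F)) ⟩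
      ι (+ 3) ⊗ (ι (+ 2) ⊗ v (end 0F))      ≈⟨ ⊗-congˡ v-root ⟩
      ι (+ 3) ⊗ ι (+ 1)                     ≈⟨ ι-* (+ 3) (+ 1) ⟨
      ι (+ 3 * + 1)                         ∎))

    integer-norm : ∀ {v U a a₃} → Represents v U a a₃ → ZeroSums v → Rooted v → inner v v ≈ ι (+ 3) →
      sum (λ j → dot (U j) (U j) + + 18 * sq (a j)) ≡ + 90
    integer-norm {v} {U} {a} rep v-zero v-root norm = *-cancelˡ-≡ (+ 2) _ (+ 90) (trans (integral-split U a) (ι-injective (begin
      ι (+ 2 * A + C)
        ≈⟨ ≈-trans (ι-+ (+ 2 * A) C) (⊕-congʳ (ι-* (+ 2) A)) ⟩
      ι (+ 2) ⊗ ι A ⊕ ι C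
        ≈⟨ ⊕-cong (⊗-congˡ (≈-sym (≈-trans (sum-cong-≋ {3} (λ j → ι-squares {6} {blockPart v j} {U j} (rep-block rep j))) (ι-sum (λ j → dot (U j) (U j))))))
             (≈-sym (ι-squares {3} {pairPart v} {λ h → + 6 * a h} (pair-values rep))) ⟩
      ι (+ 2) ⊗ sumᴬ (λ j → inner (blockPart v j) (blockPart v j)) ⊕ inner (pairPart v) (pairPart v)
        ≈⟨ norm-equation v-zero v-root norm ⟩
      ι (+ 180) ∎)))
      where
      A = sum (λ j → dot (U j) (U j))
      C = dot (λ h → + 6 * a h) (λ h → + 6 * a h)
      integral-split : ∀ (U : Fin 3 → Vector ℤ 6) a → + 2 * sum (λ j → dot (U j) (U j) + + 18 * sq (a j)) ≡
        + 2 * sum (λ j → dot (U j) (U j)) + dot (λ h → + 6 * a h) (λ h → + 6 * a h)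
      integral-split U a = trans (cong (+ 2 *_) (∑-distrib-+ (λ j → dot (U j) (U j)) (λ j → + 18 * sq (a j))))
        (trans (*-distribˡ-+ (+ 2) (sum (λ j → dot (U j) (U j))) (sum (λ j → + 18 * sq (a j))))
          (cong (λ z → + 2 * sum (λ j → dot (U j) (U j)) + z) (trans (*-distribˡ-sum (+ 2) (λ j → + 18 * sq (a j))) (sum-cong-≗ (λ j → ring (a j))))))
        where
        ring : ∀ a → + 2 * (+ 18 * (a * a)) ≡ (+ 6 * a) * (+ 6 * a)
        ring = solve-∀

    -- The root condition fixes the end of 6 v at (3, -3), which takes 18 of the scaled norm 36 · 3
    -- = 108; `classification` deals with the remaining 90.
    lattice-indexed : ∀ {v} → InLattice v → Rooted v → inner v v ≈ ι (+ 3) → ∃[ i ] Valid i × RepresentsIndex v i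
    lattice-indexed {v} v∈L@(inLattice rep p) v-root norm = transport (classification p (end-value rep v-root)
      (integer-norm rep v-zero v-root norm))
      where
      v-zero = lattice-zero-sums v∈L
      transport : Indexed (scaled v∈L) (pair-entries v∈L) → ∃[ i ] Valid i × RepresentsIndex v i
      transport (i , valid , U≡ , a≡) = i , valid , represents-from-parts v-zero v-root
        (λ j k → ≈-trans (rep-block rep j k) (≈-reflexive (cong ι (U≡ j k))))
        (λ h → ≈-trans (pair-values rep h) (≈-reflexive (cong (λ a → ι (+ 6 * a)) (a≡ h))))

    index-zero-sums : ∀ {v} i → Valid i → RepresentsIndex v i → ZeroSums v
    index-zero-sums i valid rep = zero-sums rep (blocks-sum i valid)

    index-rooted : ∀ {v} i → RepresentsIndex v i → Rooted v
    index-rooted {v} i rep = ι-cancel 2 (begin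
      ι (+ 3) ⊗ (ι (+ 2) ⊗ v (end 0F))      ≈⟨ solve 1 (λ v → con (+ 3) :* (con (+ 2) :* v) := con (+ 6) :* v) ≈-refl (v (end 0F)) ⟩
      ι (+ 6) ⊗ v (end 0F)                  ≈⟨ rep-end₀ rep ⟩
      ι (+ 3 * + 1)                         ≈⟨ ι-* (+ 3) (+ 1) ⟩
      ι (+ 3) ⊗ ι (+ 1)                     ∎)

    inner-index : ∀ {v w} i → ZeroSums v → Rooted v → RepresentsIndex w i →
      ι (+ 36) ⊗ inner v w ≈ pairingᴬ (blockPart v) (pairPart v) i ⊕ ι (+ 18)
    inner-index i v-zero v-root rep = inner-represented v-zero v-root rep

    inner-form : ∀ {v w} i i′ → Valid i → RepresentsIndex v i → RepresentsIndex w i′ → ι (+ 36) ⊗ inner v w ≈ ι (form i i′)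
    inner-form {v} {w} i i′ valid rep rep′ = begin
      ι (+ 36) ⊗ inner v w
        ≈⟨ inner-index i′ (index-zero-sums i valid rep) (index-rooted i rep) rep′ ⟩
      pairingᴬ (blockPart v) (pairPart v) i′ ⊕ ι (+ 18)
        ≈⟨ ⊕-congʳ (ι-pairing {blockPart v} {pairPart v} {blocks i} {λ h → + 6 * pairs i h} (rep-block rep) (pair-values rep) i′) ⟩
      ι (pairing (blocks i) (λ h → + 6 * pairs i h) i′) ⊕ ι (+ 18)
        ≈⟨ ι-+ (pairing (blocks i) (λ h → + 6 * pairs i h) i′) (+ 18) ⟨
      ι (form i i′) ∎

    lattice-+ : ∀ {u v w} → InLattice u → InLattice v → (∀ k → w k ≈ u k ⊕ v k) → InLattice w
    lattice-+ {u} {v} {w} (inLattice {U} {a} {a₃} p P) (inLattice {V} {b} {b₃} q Q) w≈ = inLattice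
      (record
        { rep-block = λ j k → entry (rep-block p j k) (rep-block q j k) refl (w≈ (blk j k))
        ; rep-pair₀ = λ h → entry (rep-pair₀ p h) (rep-pair₀ q h) (sym (*-distribˡ-+ (+ 3) (a h) (b h))) (w≈ (pr h 0F))
        ; rep-pair₁ = λ h → entry (rep-pair₁ p h) (rep-pair₁ q h) (sym (*-distribˡ-+ (- + 3) (a h) (b h))) (w≈ (pr h 1F))
        ; rep-end₀  = entry (rep-end₀ p) (rep-end₀ q) (sym (*-distribˡ-+ (+ 3) a₃ b₃)) (w≈ (end 0F))
        ; rep-end₁  = entry (rep-end₁ p) (rep-end₁ q) (sym (*-distribˡ-+ (- + 3) a₃ b₃)) (w≈ (end 1F))
        })
      (point-+ P Q)
      where
      entry : ∀ {x y z m n o} → ι (+ 6) ⊗ x ≈ ι m → ι (+ 6) ⊗ y ≈ ι n → m + n ≡ o → z ≈ x ⊕ y → ι (+ 6) ⊗ z ≈ ι o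
      entry {x} {y} {z} {m} {n} x≈ y≈ refl z≈ = begin
        ι (+ 6) ⊗ z                   ≈⟨ ⊗-congˡ z≈ ⟩
        ι (+ 6) ⊗ (x ⊕ y)             ≈⟨ ⊗-distribˡ (ι (+ 6)) x y ⟩
        ι (+ 6) ⊗ x ⊕ ι (+ 6) ⊗ y     ≈⟨ ⊕-cong x≈ y≈ ⟩
        ι m ⊕ ι n                     ≈⟨ ι-+ m n ⟨
        ι (m + n)                     ∎

    lattice-* : ∀ {v w} z → InLattice v → (∀ k → w k ≈ ι z ⊗ v k) → InLattice w
    lattice-* {v} {w} z (inLattice {U} {a} {a₃} p P) w≈ = inLattice
      (record
        { rep-block = λ j k → entry (rep-block p j k) refl (w≈ (blk j k))
        ; rep-pair₀ = λ h → entry (rep-pair₀ p h) (ring z (+ 3) (a h)) (w≈ (pr h 0F))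
        ; rep-pair₁ = λ h → entry (rep-pair₁ p h) (ring z (- + 3) (a h)) (w≈ (pr h 1F))
        ; rep-end₀  = entry (rep-end₀ p) (ring z (+ 3) a₃) (w≈ (end 0F))
        ; rep-end₁  = entry (rep-end₁ p) (ring z (- + 3) a₃) (w≈ (end 1F))
        })
      (point-* z P)
      where
      ring : ∀ z t a → z * (t * a) ≡ t * (z * a)
      ring = solve-∀
      entry : ∀ {x y m o} → ι (+ 6) ⊗ x ≈ ι m → z * m ≡ o → y ≈ ι z ⊗ x → ι (+ 6) ⊗ y ≈ ι o
      entry {x} {y} {m} x≈ refl y≈ = begin
        ι (+ 6) ⊗ y                   ≈⟨ ⊗-congˡ y≈ ⟩
        ι (+ 6) ⊗ (ι z ⊗ x)           ≈⟨ solve 2 (λ z x → con (+ 6) :* (z :* x) := z :* (con (+ 6) :* x)) ≈-refl (ι z) x ⟩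
        ι z ⊗ (ι (+ 6) ⊗ x)           ≈⟨ ⊗-congˡ x≈ ⟩
        ι z ⊗ ι m                     ≈⟨ ι-* z m ⟨
        ι (z * m)                     ∎

    lattice-resp : ∀ {v w} → (∀ k → v k ≈ w k) → InLattice v → InLattice w
    lattice-resp v≈w (inLattice p P) = inLattice
      (record
        { rep-block = λ j k → ≈-trans (⊗-congˡ (≈-sym (v≈w (blk j k)))) (rep-block p j k)
        ; rep-pair₀ = λ h → ≈-trans (⊗-congˡ (≈-sym (v≈w (pr h 0F)))) (rep-pair₀ p h)
        ; rep-pair₁ = λ h → ≈-trans (⊗-congˡ (≈-sym (v≈w (pr h 1F)))) (rep-pair₁ p h)
        ; rep-end₀  = ≈-trans (⊗-congˡ (≈-sym (v≈w (end 0F)))) (rep-end₀ p)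
        ; rep-end₁  = ≈-trans (⊗-congˡ (≈-sym (v≈w (end 1F)))) (rep-end₁ p)
        }) P

    lattice-0 : InLattice (λ _ → 0#)
    lattice-0 = inLattice
      (record { rep-block = λ _ _ → null ; rep-pair₀ = λ _ → null ; rep-pair₁ = λ _ → null ; rep-end₀ = null ; rep-end₁ = null })
      point-0
      where
      null : ι (+ 6) ⊗ 0# ≈ ι 0ℤ
      null = ≈-trans (⊗-zeroʳ (ι (+ 6))) (≈-sym ι-0)

    zero-sums-+ : ∀ {u v w} → ZeroSums u → ZeroSums v → (∀ k → w k ≈ u k ⊕ v k) → ZeroSums w
    zero-sums-+ {u} {v} {w} p q w≈ = record
      { block-sum = λ j → added (blk j) (block-sum p j) (block-sum q j)
      ; pair-sum  = λ h → added (pr h) (pair-sum p h) (pair-sum q h)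
      ; end-sum   = added end (end-sum p) (end-sum q)
      }
      where
      added : ∀ {n} (φ : Fin n → Fin 26) → sumᴬ (u ∘ φ) ≈ 0# → sumᴬ (v ∘ φ) ≈ 0# → sumᴬ (w ∘ φ) ≈ 0#
      added {n} φ u≈0 v≈0 = ≈-trans (sum-cong-≋ {n} (λ k → w≈ (φ k)))
        (≈-trans (∑-distrib-⊕ (u ∘ φ) (v ∘ φ)) (≈-trans (⊕-cong u≈0 v≈0) (⊕-identityʳ 0#)))

    zero-sums-* : ∀ {v w} z → ZeroSums v → (∀ k → w k ≈ z ⊗ v k) → ZeroSums w
    zero-sums-* {v} {w} z p w≈ = record
      { block-sum = λ j → scaled′ (blk j) (block-sum p j)
      ; pair-sum  = λ h → scaled′ (pr h) (pair-sum p h)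
      ; end-sum   = scaled′ end (end-sum p)
      }
      where
      scaled′ : ∀ {n} (φ : Fin n → Fin 26) → sumᴬ (v ∘ φ) ≈ 0# → sumᴬ (w ∘ φ) ≈ 0#
      scaled′ {n} φ v≈0 = ≈-trans (sum-cong-≋ {n} (λ k → w≈ (φ k)))
        (≈-trans (≈-sym (⊗-distribˡ-sum z (v ∘ φ))) (≈-trans (⊗-congˡ v≈0) (⊗-zeroʳ z)))

    block-part-sum : ∀ {v} → ZeroSums v → ∀ j → sumᴬ (blockPart v j) ≈ 0#
    block-part-sum {v} v-zero j = ≈-trans (≈-sym (⊗-distribˡ-sum (ι (+ 6)) (v ∘ blk j)))
      (≈-trans (⊗-congˡ (block-sum v-zero j)) (⊗-zeroʳ (ι (+ 6))))

  -- Indexed vectors and glue vectors as lattice points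

  corners-cancel : ∀ σ i → sum (λ k → sgn σ * (unit {6} 5F k - unit {6} i k)) ≡ 0ℤ
  corners-cancel = from-yes (allBool? λ σ → all? λ i → sum (λ k → sgn σ * (unit {6} 5F k - unit {6} i k)) ≟ 0ℤ)

  -- This is ±β₀, with the corners moved from position 5 by elements of A₅. For the negative sign,
  -- w₃ = 1 brings the end of -β₀ from -α₁ back to α₁.
  triple-point : ∀ σ i j l → LatticePoint (blocks (triple σ i j l)) (pairs (triple σ i j l)) (+ 1)
  triple-point σ i j l = record
    { x      = λ h k → sgn σ * (unit 5F k - unit (at h) k)
    ; w      = λ _ → 0ℤ
    ; w₃     = - half (sgn-isSign σ)
    ; c₀     = sgn σ
    ; c      = λ _ → 0ℤ
    ; Σx     = λ h → corners-cancel σ (at h)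
    ; block≡ = λ h k → ring (sgn σ) (unit (at h) k) (unit 5F k)
    ; pair≡  = λ _ → refl
    ; last≡  = last σ
    }
    where
    at : Fin 3 → Fin 6
    at = i F.∷ j F.∷ l F.∷ F.[]
    ring : ∀ s u v → s * (+ 1 + - + 6 * u) ≡ + 6 * (s * (v - u)) + (s + + 3 * 0ℤ) * (+ 1 + - + 6 * v)
    ring = solve-∀
    last : ∀ σ → + 1 ≡ + 2 * - half (sgn-isSign σ) + (sgn σ + (0ℤ + (0ℤ + 0ℤ)))
    last true  = refl
    last false = refl

  -- This is the glue vector of type `j` corrected by an element of Λ: with x = 2 h + 1, the block 3
  -- x differs from 3 (1 - 6 e) by 6 (h + 3 e), where e is the unit vector at position 5, and h + 3
  -- e sums to 0.
  cut-point : ∀ j x y z → Balanced (signs x) → LatticePoint (blocks (cut j x y z)) (pairs (cut j x y z)) (+ 1)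
  cut-point j x y z x-bal = record
    { x      = F.insertAt {n = 2} (λ _ _ → 0ℤ) j s
    ; w      = F.insertAt (half (sgn-isSign y) F.∷ half (sgn-isSign z) F.∷ F.[]) j 0ℤ
    ; w₃     = 0ℤ
    ; c₀     = 0ℤ
    ; c      = unit j
    ; Σx     = Σx j
    ; block≡ = block j
    ; pair≡  = pair j
    ; last≡  = last j
    }
    where
    s : Vector ℤ 6
    s k = halves x-bal k + + 3 * unit 5F k
    Σs : sum s ≡ 0ℤ
    Σs = trans (∑-distrib-+ (halves x-bal) (λ k → + 3 * unit 5F k)) (cong (_+ + 3) (sum-halves x-bal))
    Σx : ∀ j h → sum (F.insertAt {n = 2} (λ _ _ → 0ℤ) j s h) ≡ 0ℤ
    Σx 0F 0F = Σs
    Σx 0F 1F = refl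
    Σx 0F 2F = refl
    Σx 1F 0F = refl
    Σx 1F 1F = Σs
    Σx 1F 2F = refl
    Σx 2F 0F = refl
    Σx 2F 1F = refl
    Σx 2F 2F = Σs
    direct : ∀ k → + 3 * signs x k ≡ + 6 * s k + (0ℤ + + 3 * + 1) * corner 5F k
    direct k = trans (cong (+ 3 *_) (IsSign⇒odd (isSign x-bal k))) (ring (halves x-bal k) (unit 5F k))
      where
      ring : ∀ h u → + 3 * (+ 2 * h + + 1) ≡ + 6 * (h + + 3 * u) + + 3 * (+ 1 + - + 6 * u)
      ring = solve-∀
    block : ∀ j h k → blocks (cut j x y z) h k ≡ + 6 * F.insertAt {n = 2} (λ _ _ → 0ℤ) j s h k + (0ℤ + + 3 * unit j h) * corner 5F k
    block 0F 0F k = direct k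
    block 0F 1F k = refl
    block 0F 2F k = refl
    block 1F 0F k = refl
    block 1F 1F k = direct k
    block 1F 2F k = refl
    block 2F 0F k = refl
    block 2F 1F k = refl
    block 2F 2F k = direct k
    signed-half : ∀ b → sgn b ≡ + 2 * half (sgn-isSign b) + + 1
    signed-half b = IsSign⇒odd (sgn-isSign b)
    pair : ∀ j h → pairs (cut j x y z) h ≡ + 2 * F.insertAt (half (sgn-isSign y) F.∷ half (sgn-isSign z) F.∷ F.[]) j 0ℤ h
      + (unit j (punchIn h 0F) + unit j (punchIn h 1F))
    pair 0F 0F = refl
    pair 0F 1F = signed-half y
    pair 0F 2F = signed-half z
    pair 1F 0F = signed-half y
    pair 1F 1F = refl
    pair 1F 2F = signed-half z
    pair 2F 0F = signed-half y
    pair 2F 1F = signed-half z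
    pair 2F 2F = refl
    last : ∀ j → + 1 ≡ + 2 * 0ℤ + (0ℤ + (unit j 0F + (unit j 1F + unit {3} j 2F)))
    last 0F = refl
    last 1F = refl
    last 2F = refl

  index-point : ∀ i → Valid i → LatticePoint (blocks i) (pairs i) (+ 1)
  index-point (triple σ i j l) _     = triple-point σ i j l
  index-point (cut j x y z)    x-bal = cut-point j x y z x-bal

  self-form : ∀ i → Valid i → form i i ≡ + 108
  self-form (triple σ i j l) _ = trans (form-triple σ i j l σ i j l) (trans
    (cong₂ (λ a b → - + 6 * sgn σ * (sgn σ * a + b) + + 18) (corner-refl i)
      (cong₂ (λ a b → sgn σ * a + sgn σ * b) (corner-refl j) (corner-refl l)))
    (value σ))
    where
    value : ∀ σ → - + 6 * sgn σ * (sgn σ * - + 5 + (sgn σ * - + 5 + sgn σ * - + 5)) + + 18 ≡ + 108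
    value true  = refl
    value false = refl
  self-form (cut j x y z) x-bal = trans (form-cut j x y z x y z)
    (trans (cong (λ d → + 3 * (+ 3 * d + (+ 6 * sgn y * sgn y + + 6 * sgn z * sgn z)) + + 18) (balanced-square x-bal)) (value y z))
    where
    value : ∀ y z → + 3 * (+ 3 * + 6 + (+ 6 * sgn y * sgn y + + 6 * sgn z * sgn z)) + + 18 ≡ + 108
    value true  true  = refl
    value true  false = refl
    value false true  = refl
    value false false = refl

  -- LatticePoint coordinates of β₀, …, β₃.
  glue-block : Fin 4 → Fin 3 → Vector ℤ 6
  glue-block zero    j k = corner 5F k
  glue-block (suc g) j k = + 3 * unit g j * corner 5F k

  glue-pair : Fin 4 → Fin 3 → ℤ
  glue-pair zero    h = 0ℤ
  glue-pair (suc g) h = unit g (punchIn h 0F) + unit g (punchIn h 1F)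

  combination : ℤ → ℤ → (Fin 3 → ℤ) → (Fin 4 → ℤ) → ℤ
  combination m c₀ c n = + 6 * m + (c₀ * n 0F + (c 0F * n 1F + (c 1F * n 2F + c 2F * n 3F)))

  combination-block : ∀ x c₀ c j k → combination x c₀ c (λ t → glue-block t j k) ≡ + 6 * x + (c₀ + + 3 * c j) * corner 5F k
  combination-block x c₀ c 0F k = ring x c₀ (c 0F) (c 1F) (c 2F) (corner 5F k)
    where
    ring : ∀ x c₀ c d e u → + 6 * x + (c₀ * u + (c * (+ 3 * + 1 * u) + (d * (+ 3 * 0ℤ * u) + e * (+ 3 * 0ℤ * u)))) ≡ + 6 * x + (c₀ + + 3 * c) * u
    ring = solve-∀
  combination-block x c₀ c 1F k = ring x c₀ (c 0F) (c 1F) (c 2F) (corner 5F k)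
    where
    ring : ∀ x c₀ c d e u → + 6 * x + (c₀ * u + (c * (+ 3 * 0ℤ * u) + (d * (+ 3 * + 1 * u) + e * (+ 3 * 0ℤ * u)))) ≡ + 6 * x + (c₀ + + 3 * d) * u
    ring = solve-∀
  combination-block x c₀ c 2F k = ring x c₀ (c 0F) (c 1F) (c 2F) (corner 5F k)
    where
    ring : ∀ x c₀ c d e u → + 6 * x + (c₀ * u + (c * (+ 3 * 0ℤ * u) + (d * (+ 3 * 0ℤ * u) + e * (+ 3 * + 1 * u)))) ≡ + 6 * x + (c₀ + + 3 * e) * u
    ring = solve-∀

  -- `t` is 3 for the first entry of a pair and -3 for the second; accordingly `m` is w or -w.
  combination-pair : ∀ {m t w} c₀ c h → + 6 * m ≡ t * (+ 2 * w) →
    combination m c₀ c (λ g → t * glue-pair g h) ≡ t * (+ 2 * w + (c (punchIn h 0F) + c (punchIn h 1F)))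
  combination-pair {m} {t} {w} c₀ c h 6m≡ = trans (cong (_+ (c₀ * (t * 0ℤ) + rest h)) 6m≡) (pair-ring h)
    where
    rest : Fin 3 → ℤ
    rest h = c 0F * (t * glue-pair 1F h) + (c 1F * (t * glue-pair 2F h) + c 2F * (t * glue-pair 3F h))
    pair-ring : ∀ h → t * (+ 2 * w) + (c₀ * (t * 0ℤ) + rest h) ≡ t * (+ 2 * w + (c (punchIn h 0F) + c (punchIn h 1F)))
    pair-ring 0F = ring t (+ 2 * w) c₀ (c 0F) (c 1F) (c 2F)
      where
      ring : ∀ t w c₀ c d e → t * w + (c₀ * (t * 0ℤ) + (c * (t * (0ℤ + 0ℤ)) + (d * (t * (+ 1 + 0ℤ)) + e * (t * (0ℤ + + 1))))) ≡ t * (w + (d + e))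
      ring = solve-∀
    pair-ring 1F = ring t (+ 2 * w) c₀ (c 0F) (c 1F) (c 2F)
      where
      ring : ∀ t w c₀ c d e → t * w + (c₀ * (t * 0ℤ) + (c * (t * (+ 1 + 0ℤ)) + (d * (t * (0ℤ + 0ℤ)) + e * (t * (0ℤ + + 1))))) ≡ t * (w + (c + e))
      ring = solve-∀
    pair-ring 2F = ring t (+ 2 * w) c₀ (c 0F) (c 1F) (c 2F)
      where
      ring : ∀ t w c₀ c d e → t * w + (c₀ * (t * 0ℤ) + (c * (t * (+ 1 + 0ℤ)) + (d * (t * (0ℤ + + 1)) + e * (t * (0ℤ + 0ℤ))))) ≡ t * (w + (c + d))
      ring = solve-∀

  combination-end : ∀ {m t w} c₀ c → + 6 * m ≡ t * (+ 2 * w) →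
    combination m c₀ c (λ _ → t * + 1) ≡ t * (+ 2 * w + (c₀ + (c 0F + (c 1F + c 2F))))
  combination-end {m} {t} {w} c₀ c 6m≡ = trans (cong (_+ rest) 6m≡) (ring t (+ 2 * w) c₀ (c 0F) (c 1F) (c 2F))
    where
    rest = c₀ * (t * + 1) + (c 0F * (t * + 1) + (c 1F * (t * + 1) + c 2F * (t * + 1)))
    ring : ∀ t w c₀ c d e → t * w + (c₀ * (t * + 1) + (c * (t * + 1) + (d * (t * + 1) + e * (t * + 1)))) ≡ t * (w + (c₀ + (c + (d + e))))
    ring = solve-∀

  glue-point : ∀ t → LatticePoint (glue-block t) (glue-pair t) (+ 1)
  glue-point zero = record
    { x = λ _ _ → 0ℤ ; w = λ _ → 0ℤ ; w₃ = 0ℤ ; c₀ = + 1 ; c = λ _ → 0ℤ ; Σx = λ _ → refl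
    ; block≡ = λ j k → ring (corner 5F k) ; pair≡ = λ _ → refl ; last≡ = refl }
    where
    ring : ∀ u → u ≡ + 6 * 0ℤ + (+ 1 + + 3 * 0ℤ) * u
    ring = solve-∀
  glue-point (suc g) = record
    { x = λ _ _ → 0ℤ ; w = λ _ → 0ℤ ; w₃ = 0ℤ ; c₀ = 0ℤ ; c = unit g ; Σx = λ _ → refl
    ; block≡ = λ j k → ring (unit g j) (corner 5F k) ; pair≡ = λ h → sym (+-identityˡ _) ; last≡ = last g }
    where
    ring : ∀ v u → + 3 * v * u ≡ + 6 * 0ℤ + (0ℤ + + 3 * v) * u
    ring = solve-∀
    last : ∀ g → + 1 ≡ + 2 * 0ℤ + (0ℤ + (unit g 0F + (unit g 1F + unit {3} g 2F)))
    last 0F = refl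
    last 1F = refl
    last 2F = refl

  -- Lattice points as combinations of the generators

  module Generation (𝔸 : ℤ-Algebra) where
    open Notation 𝔸
    open Pairing 𝔸 using (module Solver)
    open Geometry 𝔸
    open LatticeGeometry 𝔸
    open Represents
    open Solver using (solve; con; _:=_; _:+_; _:*_)
    open import Relation.Binary.Reasoning.Setoid (ℤ-Algebra.setoid 𝔸)

    record IntegerEntries (v : Vector Carrier 26) (x : Fin 3 → Vector ℤ 6) (w : Fin 3 → ℤ) (w₃ : ℤ) : Set where
      field
        int-block : ∀ j k → v (blk j k) ≈ ι (x j k)
        int-pair₀ : ∀ h → v (pr h 0F) ≈ ι (w h)
        int-pair₁ : ∀ h → v (pr h 1F) ≈ ι (- + 1 * w h)
        int-end₀  : v (end 0F) ≈ ι w₃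
        int-end₁  : v (end 1F) ≈ ι (- + 1 * w₃)
    open IntegerEntries

    integer-lattice : ∀ {v x w w₃} → IntegerEntries v x w w₃ → (∀ j → sum (x j) ≡ 0ℤ) → InLattice v
    integer-lattice {v} {x} {w} {w₃} int Σx = inLattice
      (record
        { rep-block = λ j k → six (int-block int j k) refl
        ; rep-pair₀ = λ h → six (int-pair₀ int h) (ring (w h))
        ; rep-pair₁ = λ h → six (int-pair₁ int h) (ring′ (w h))
        ; rep-end₀  = six (int-end₀ int) (ring w₃)
        ; rep-end₁  = six (int-end₁ int) (ring′ w₃)
        })
      (record { x = x ; w = w ; w₃ = w₃ ; c₀ = 0ℤ ; c = λ _ → 0ℤ ; Σx = Σx
        ; block≡ = λ j k → sym (+-identityʳ (+ 6 * x j k))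
        ; pair≡ = λ h → sym (+-identityʳ (+ 2 * w h)) ; last≡ = sym (+-identityʳ (+ 2 * w₃)) })
      where
      ring : ∀ w → + 6 * w ≡ + 3 * (+ 2 * w)
      ring = solve-∀
      ring′ : ∀ w → + 6 * (- + 1 * w) ≡ - + 3 * (+ 2 * w)
      ring′ = solve-∀
      six : ∀ {y n o} → y ≈ ι n → + 6 * n ≡ o → ι (+ 6) ⊗ y ≈ ι o
      six {y} {n} y≈ refl = ≈-trans (⊗-congˡ y≈) (≈-sym (ι-* (+ 6) n))

    combine-generators : Vector Carrier 26 → (Fin 4 → Vector Carrier 26) → ℤ → (Fin 3 → ℤ) → Vector Carrier 26
    combine-generators l b c₀ c k =
      l k ⊕ (ι c₀ ⊗ b 0F k ⊕ (ι (c 0F) ⊗ b 1F k ⊕ (ι (c 1F) ⊗ b 2F k ⊕ ι (c 2F) ⊗ b 3F k)))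

    combine-entry : ∀ c₀ (c : Fin 3 → ℤ) {y z o} m (e : Fin 4 → Carrier) (n : Fin 4 → ℤ) → y ≈ ι m → (∀ t → ι (+ 6) ⊗ e t ≈ ι (n t)) →
      combination m c₀ c n ≡ o → ι (+ 6) ⊗ z ≈ ι o →
      y ⊕ (ι c₀ ⊗ e 0F ⊕ (ι (c 0F) ⊗ e 1F ⊕ (ι (c 1F) ⊗ e 2F ⊕ ι (c 2F) ⊗ e 3F))) ≈ z
    combine-entry c₀ c {y} {z} m e n y≈ e≈ refl z≈ = ι-cancel 5 (begin
      ι (+ 6) ⊗ (y ⊕ (ι c₀ ⊗ e 0F ⊕ (ι (c 0F) ⊗ e 1F ⊕ (ι (c 1F) ⊗ e 2F ⊕ ι (c 2F) ⊗ e 3F))))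
        ≈⟨ ≈-trans (⊗-distribˡ _ _ _) (⊕-congˡ (≈-trans (⊗-distribˡ _ _ _) (⊕-cong (swap c₀ (e 0F))
             (≈-trans (⊗-distribˡ _ _ _) (⊕-cong (swap (c 0F) (e 1F))
               (≈-trans (⊗-distribˡ _ _ _) (⊕-cong (swap (c 1F) (e 2F)) (swap (c 2F) (e 3F))))))))) ⟩
      ι (+ 6) ⊗ y ⊕ (ι c₀ ⊗ (ι (+ 6) ⊗ e 0F) ⊕ (ι (c 0F) ⊗ (ι (+ 6) ⊗ e 1F) ⊕ (ι (c 1F) ⊗ (ι (+ 6) ⊗ e 2F) ⊕ ι (c 2F) ⊗ (ι (+ 6) ⊗ e 3F))))
        ≈⟨ ⊕-cong (mul (+ 6) y≈) (⊕-cong (mul c₀ (e≈ 0F)) (⊕-cong (mul (c 0F) (e≈ 1F)) (⊕-cong (mul (c 1F) (e≈ 2F)) (mul (c 2F) (e≈ 3F))))) ⟩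
      ι (+ 6 * m) ⊕ (ι (c₀ * n 0F) ⊕ (ι (c 0F * n 1F) ⊕ (ι (c 1F * n 2F) ⊕ ι (c 2F * n 3F))))
        ≈⟨ ≈-sym (≈-trans (ι-+ (+ 6 * m) S₀) (⊕-congˡ (≈-trans (ι-+ (c₀ * n 0F) S₁) (⊕-congˡ (≈-trans (ι-+ (c 0F * n 1F) S₂) (⊕-congˡ (ι-+ (c 1F * n 2F) (c 2F * n 3F)))))))) ⟩
      ι (combination m c₀ c n)
        ≈⟨ z≈ ⟨
      ι (+ 6) ⊗ z ∎)
      where
      S₂ = c 1F * n 2F + c 2F * n 3F
      S₁ = c 0F * n 1F + S₂
      S₀ = c₀ * n 0F + S₁
      swap : ∀ s y → ι (+ 6) ⊗ (ι s ⊗ y) ≈ ι s ⊗ (ι (+ 6) ⊗ y)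
      swap s y = solve 2 (λ s y → con (+ 6) :* (s :* y) := s :* (con (+ 6) :* y)) ≈-refl (ι s) y
      mul : ∀ s {y n} → y ≈ ι n → ι s ⊗ y ≈ ι (s * n)
      mul s {n = n} y≈ = ≈-trans (⊗-congˡ y≈) (≈-sym (ι-* s n))

    -- Compared entry by entry after multiplication by 6, which turns the fractions in β into the
    -- integers of `glue-block` and `glue-pair`.
    generated : ∀ {v U a a₃ l b} → Represents v U a a₃ → (p : LatticePoint U a a₃) → let open LatticePoint p in
      IntegerEntries l x w w₃ → (∀ t → Represents (b t) (glue-block t) (glue-pair t) (+ 1)) →
      ∀ k → combine-generators l b c₀ c k ≈ v k
    generated {v} {U} {a} {a₃} {l} {b} rep p int gen = by-coordinates
      (λ j k → combine-entry c₀ c (x j k) (λ t → b t (blk j k)) (λ t → glue-block t j k) (int-block int j k) (λ t → rep-block (gen t) j k)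
        (trans (combination-block (x j k) c₀ c j k) (sym (block≡ j k))) (rep-block rep j k))
      pair
      ends
      where
      open LatticePoint p
      minus : ∀ w → + 6 * (- + 1 * w) ≡ - + 3 * (+ 2 * w)
      minus = solve-∀
      pair : ∀ h e → combine-generators l b c₀ c (pr h e) ≈ v (pr h e)
      pair h 0F = combine-entry c₀ c (w h) (λ t → b t (pr h 0F)) (λ t → + 3 * glue-pair t h) (int-pair₀ int h) (λ t → rep-pair₀ (gen t) h)
        (trans (combination-pair {w h} {+ 3} {w h} c₀ c h (*-assoc (+ 3) (+ 2) (w h))) (cong (+ 3 *_) (sym (pair≡ h)))) (rep-pair₀ rep h)
      pair h 1F = combine-entry c₀ c (- + 1 * w h) (λ t → b t (pr h 1F)) (λ t → - + 3 * glue-pair t h) (int-pair₁ int h) (λ t → rep-pair₁ (gen t) h)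
        (trans (combination-pair { - + 1 * w h} { - + 3} {w h} c₀ c h (minus (w h))) (cong (- + 3 *_) (sym (pair≡ h)))) (rep-pair₁ rep h)
      ends : ∀ e → combine-generators l b c₀ c (end e) ≈ v (end e)
      ends 0F = combine-entry c₀ c w₃ (λ t → b t (end 0F)) (λ _ → + 3 * + 1) (int-end₀ int) (λ t → rep-end₀ (gen t))
        (trans (combination-end {w₃} {+ 3} {w₃} c₀ c (*-assoc (+ 3) (+ 2) w₃)) (cong (+ 3 *_) (sym last≡))) (rep-end₀ rep)
      ends 1F = combine-entry c₀ c (- + 1 * w₃) (λ t → b t (end 1F)) (λ _ → - + 3 * + 1) (int-end₁ int) (λ t → rep-end₁ (gen t))
        (trans (combination-end { - + 1 * w₃} { - + 3} {w₃} c₀ c (minus w₃)) (cong (- + 3 *_) (sym last≡))) (rep-end₁ rep)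

  -- Inner products 0 and 1 as compatibility of indices

  module Angles (𝔸 : ℤ-Algebra) where
    open Notation 𝔸
    open Pairing 𝔸 using (module Solver) renaming (pairing to pairingᴬ)
    open Descent 𝔸 using (Meetsᴬ; meetsᴬ)
    open Geometry 𝔸
    open LatticeGeometry 𝔸
    open Represents
    open Solver using (solve; con; _:=_; _:+_)
    open import Relation.Binary.Reasoning.Setoid (ℤ-Algebra.setoid 𝔸)

    infix 4 _∈0,1
    _∈0,1 : Carrier → Set
    x ∈0,1 = x ≈ ι 0ℤ ⊎ x ≈ ι (+ 1)

    represents-resp : ∀ {v w U a a₃} → (∀ k → v k ≈ w k) → Represents v U a a₃ → Represents w U a a₃
    represents-resp {v} {w} v≈w p = record
      { rep-block = λ j k → moved (rep-block p j k) (v≈w (blk j k))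
      ; rep-pair₀ = λ h → moved (rep-pair₀ p h) (v≈w (pr h 0F))
      ; rep-pair₁ = λ h → moved (rep-pair₁ p h) (v≈w (pr h 1F))
      ; rep-end₀  = moved (rep-end₀ p) (v≈w (end 0F))
      ; rep-end₁  = moved (rep-end₁ p) (v≈w (end 1F))
      }
      where
      moved : ∀ {x y z} → ι (+ 6) ⊗ x ≈ z → x ≈ y → ι (+ 6) ⊗ y ≈ z
      moved eq x≈y = ≈-trans (⊗-congˡ (≈-sym x≈y)) eq

    scaled-form : ∀ {v w} i i′ z → Valid i → RepresentsIndex v i → RepresentsIndex w i′ →
      inner v w ≈ ι z → form i i′ ≡ + 36 * z
    scaled-form {v} {w} i i′ z valid p q eq = ι-injective (begin
      ι (form i i′)             ≈⟨ inner-form i i′ valid p q ⟨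
      ι (+ 36) ⊗ inner v w      ≈⟨ ⊗-congˡ eq ⟩
      ι (+ 36) ⊗ ι z            ≈⟨ ι-* (+ 36) z ⟨
      ι (+ 36 * z)              ∎)

    inner-value : ∀ {v w} i i′ z → Valid i → RepresentsIndex v i → RepresentsIndex w i′ →
      form i i′ ≡ + 36 * z → inner v w ≈ ι z
    inner-value {v} {w} i i′ z valid p q eq = ι-cancel 35 (begin
      ι (+ 36) ⊗ inner v w      ≈⟨ inner-form i i′ valid p q ⟩
      ι (form i i′)             ≡⟨ cong ι eq ⟩
      ι (+ 36 * z)              ≈⟨ ι-* (+ 36) z ⟩
      ι (+ 36) ⊗ ι z            ∎)

    angle⇒compatible : ∀ {v w} i i′ → Valid i → RepresentsIndex v i → RepresentsIndex w i′ → inner v w ∈0,1 → Compatible i i′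
    angle⇒compatible i i′ valid p q (inj₁ eq) = compatible (inj₁ (scaled-form i i′ 0ℤ valid p q eq))
    angle⇒compatible i i′ valid p q (inj₂ eq) = compatible (inj₂ (scaled-form i i′ (+ 1) valid p q eq))

    compatible⇒angle : ∀ {v w} i i′ → Valid i → RepresentsIndex v i → RepresentsIndex w i′ → Compatible i i′ → inner v w ∈0,1
    compatible⇒angle i i′ valid p q (compatible (inj₁ eq)) = inj₁ (inner-value i i′ 0ℤ valid p q eq)
    compatible⇒angle i i′ valid p q (compatible (inj₂ eq)) = inj₂ (inner-value i i′ (+ 1) valid p q eq)

    index-norm : ∀ {v} i → Valid i → RepresentsIndex v i → inner v v ≈ ι (+ 3)
    index-norm i valid p = inner-value i i (+ 3) valid p p (self-form i valid)

    -- The form of the two indices would be 36 times the norm, that is 108, which is neither 0 nor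
    -- 36. Different positions of a clique therefore represent different vectors.
    one-index : ∀ {v} i i′ → Valid i → RepresentsIndex v i → RepresentsIndex v i′ → ¬ Compatible i i′
    one-index {v} i i′ valid p q (compatible c) = absurd (subst _∈0,36 (scaled-form i i′ (+ 3) valid p q (index-norm i valid p)) c)
      where
      absurd : ¬ (+ 108 ∈0,36)
      absurd = from-no (+ 108 ∈0,36?)

    index-root : ∀ {v r} i → Valid i → RepresentsIndex v i → IsRoot r → inner v r ≈ ι (+ 1)
    index-root i valid p r-root = ≈-trans (inner-root (index-zero-sums i valid p) r-root) (index-rooted i p)

    rooted : ∀ {v r} → ZeroSums v → IsRoot r → inner v r ≈ ι (+ 1) → Rooted v
    rooted v-zero r-root eq = ≈-trans (≈-sym (inner-root v-zero r-root)) eq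

    angle⇒meets : ∀ {v w} i → ZeroSums v → Rooted v → RepresentsIndex w i → inner v w ∈0,1 → Meetsᴬ (blockPart v) (pairPart v) i
    angle⇒meets {v} {w} i v-zero v-root q = Sum.[ (λ eq → meetsᴬ false (value 0ℤ eq)) , (λ eq → meetsᴬ true (value (+ 1) eq)) ]
      where
      X = pairingᴬ (blockPart v) (pairPart v) i
      value : ∀ z → inner v w ≈ ι z → X ≈ ι (+ 36 * z + - + 18)
      value z eq = begin
        X                                       ≈⟨ solve 1 (λ x → x := (x :+ con (+ 18)) :+ con (- + 18)) ≈-refl X ⟩
        (X ⊕ ι (+ 18)) ⊕ ι (- + 18)             ≈⟨ ⊕-congʳ (inner-index i v-zero v-root q) ⟨
        ι (+ 36) ⊗ inner v w ⊕ ι (- + 18)       ≈⟨ ⊕-congʳ (≈-trans (⊗-congˡ eq) (≈-sym (ι-* (+ 36) z))) ⟩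
        ι (+ 36 * z) ⊕ ι (- + 18)               ≈⟨ ι-+ (+ 36 * z) (- + 18) ⟨
        ι (+ 36 * z + - + 18)                   ∎

open import Defs
open import Algebra.Properties.Ring ℚ.+-*-ring using (x∙y⁻¹≈ε⇒x≈y)
open Indices
open Integral

open +-*-Solver using (solve; con; _:=_; _:+_; _:*_; _:-_)

-- The ring ℝ

Null : (ℕ → ℚ) → Set
Null s = ∀ ε → 0ℚ ℚ.< ε → Eventually (λ n → ℚ.∣ s n ∣ ℚ.≤ ε)

half>0 : ∀ {ε} → 0ℚ ℚ.< ε → 0ℚ ℚ.< ½ ℚ.* ε
half>0 {ε} 0<ε = ℚ.positive⁻¹ (½ ℚ.* ε) {{ℚ.pos*pos⇒pos ½ ε {{ℚ.positive 0<ε}}}}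

Null-+ : ∀ {s t} → Null s → Null t → Null (λ n → s n ℚ.+ t n)
Null-+ {s} {t} s→0 t→0 ε 0<ε with s→0 (½ ℚ.* ε) (half>0 0<ε) | t→0 (½ ℚ.* ε) (half>0 0<ε)
... | M , f | N , g = M ℕ.⊔ N , λ n n≥ →
  subst (ℚ.∣ s n ℚ.+ t n ∣ ℚ.≤_) (solve 1 (λ e → con ½ :* e :+ con ½ :* e := e) refl ε)
    (ℚ.≤-trans (ℚ.∣p+q∣≤∣p∣+∣q∣ (s n) (t n))
      (ℚ.+-mono-≤ (f n (ℕ.m⊔n≤o⇒m≤o M N n≥)) (g n (ℕ.m⊔n≤o⇒n≤o M N n≥))))

divide : ∀ {B ε} → 0ℚ ℚ.< B → 0ℚ ℚ.< ε → ∃[ δ ] 0ℚ ℚ.< δ × B ℚ.* δ ≡ ε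
divide {B} {ε} 0<B 0<ε = B⁻¹ ℚ.* ε
  , ℚ.positive⁻¹ (B⁻¹ ℚ.* ε) {{ℚ.pos*pos⇒pos B⁻¹ {{ℚ.1/pos⇒pos B {{B⁺}}}} ε {{ℚ.positive 0<ε}}}}
  , trans (sym (ℚ.*-assoc B B⁻¹ ε)) (trans (cong (ℚ._* ε) (ℚ.*-inverseʳ B {{B≢0}})) (ℚ.*-identityˡ ε))
  where
  B⁺ = ℚ.positive 0<B
  B≢0 = ℚ.pos⇒nonZero B {{B⁺}}
  B⁻¹ = ℚ.1/_ B {{B≢0}}

Null-* : ∀ {s} x → Null s → Null (λ n → seq x n ℚ.* s n)
Null-* {s} x s→0 ε 0<ε with bounded x
... | B , 0<B , K , p with divide 0<B 0<ε
... | δ , 0<δ , Bδ≡ε with s→0 δ 0<δ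
... | N , f = K ℕ.⊔ N , λ n n≥ → begin
  ℚ.∣ seq x n ℚ.* s n ∣           ≡⟨ ℚ.∣p*q∣≡∣p∣*∣q∣ (seq x n) (s n) ⟩
  ℚ.∣ seq x n ∣ ℚ.* ℚ.∣ s n ∣     ≤⟨ ℚ.*-monoʳ-≤-nonNeg ℚ.∣ s n ∣ {{ℚ.∣-∣-nonNeg (s n)}} (p n (ℕ.m⊔n≤o⇒m≤o K N n≥)) ⟩
  B ℚ.* ℚ.∣ s n ∣                 ≤⟨ ℚ.*-monoˡ-≤-nonNeg B {{ℚ.pos⇒nonNeg B {{ℚ.positive 0<B}}}} (f n (ℕ.m⊔n≤o⇒n≤o K N n≥)) ⟩
  B ℚ.* δ                         ≡⟨ Bδ≡ε ⟩
  ε                               ∎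
  where open ℚ.≤-Reasoning

Null-≗ : ∀ {s t} → (∀ n → s n ≡ t n) → Null s → Null t
Null-≗ s≗t s→0 ε 0<ε with s→0 ε 0<ε
... | N , f = N , λ n n≥ → subst (λ q → ℚ.∣ q ∣ ℚ.≤ ε) (s≗t n) (f n n≥)

pointwise : ∀ {x y} → (∀ n → seq x n ≡ seq y n) → x ≈ y
pointwise {x} {y} x≗y ε 0<ε = 0 , λ n _ → subst (ℚ._≤ ε)
  (sym (cong ℚ.∣_∣ (trans (cong (ℚ._- seq y n) (x≗y n)) (ℚ.+-inverseʳ (seq y n))))) (ℚ.<⇒≤ 0<ε)

+-cong : ∀ {x x′ y y′} → x ≈ x′ → y ≈ y′ → x + y ≈ x′ + y′
+-cong {x} {x′} {y} {y′} x≈x′ y≈y′ = Null-≗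
  (λ n → solve 4 (λ a b c d → (a :- b) :+ (c :- d) := (a :+ c) :- (b :+ d)) refl
    (seq x n) (seq x′ n) (seq y n) (seq y′ n))
  (Null-+ {λ n → seq x n ℚ.- seq x′ n} {λ n → seq y n ℚ.- seq y′ n} x≈x′ y≈y′)

*-cong : ∀ {x x′ y y′} → x ≈ x′ → y ≈ y′ → x * y ≈ x′ * y′
*-cong {x} {x′} {y} {y′} x≈x′ y≈y′ = Null-≗
  (λ n → solve 4 (λ a b c d → a :* (c :- d) :+ d :* (a :- b) := a :* c :- b :* d) refl
    (seq x n) (seq x′ n) (seq y n) (seq y′ n))
  (Null-+ {λ n → seq x n ℚ.* (seq y n ℚ.- seq y′ n)} {λ n → seq y′ n ℚ.* (seq x n ℚ.- seq x′ n)}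
    (Null-* {λ n → seq y n ℚ.- seq y′ n} x y≈y′) (Null-* {λ n → seq x n ℚ.- seq x′ n} y′ x≈x′))

-- As a product with -1, negation inherits its Cauchy property from `_*_`.
-ℝ_ : ℝ → ℝ
-ℝ x = fromℤ -[1+ 0 ] * x

ℝ-commutativeRing : CommutativeRing 0ℓ 0ℓ
ℝ-commutativeRing = record
  { Carrier = ℝ ; _≈_ = _≈_ ; _+_ = _+_ ; _*_ = _*_ ; -_ = -ℝ_ ; 0# = 0ℝ ; 1# = 1ℝ
  ; isCommutativeRing = record
    { isRing = record
      { +-isAbelianGroup = record
        { isGroup = record
          { isMonoid = record
            { isSemigroup = record
              { isMagma = record
                { isEquivalence = record
                  { refl = λ {x} → ≈-refl {x}
                  ; sym = λ {x} {y} → ≈-sym {x} {y}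
                  ; trans = λ {x} {y} {z} → ≈-trans {x} {y} {z} }
                ; ∙-cong = λ {x} {x′} {y} {y′} → +-cong {x} {x′} {y} {y′} }
              ; assoc = λ x y z → pointwise {(x + y) + z} {x + (y + z)}
                  (λ n → ℚ.+-assoc (seq x n) (seq y n) (seq z n)) }
            ; identity = (λ x → pointwise {0ℝ + x} {x} (λ n → ℚ.+-identityˡ (seq x n)))
                       , (λ x → pointwise {x + 0ℝ} {x} (λ n → ℚ.+-identityʳ (seq x n))) }
          ; inverse = (λ x → pointwise {(-ℝ x) + x} {0ℝ} (λ n → solve 1
                        (λ a → con (-[1+ 0 ] ℚ./ 1) :* a :+ a := con 0ℚ) refl (seq x n)))
                    , (λ x → pointwise {x + (-ℝ x)} {0ℝ} (λ n → solve 1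
                        (λ a → a :+ con (-[1+ 0 ] ℚ./ 1) :* a := con 0ℚ) refl (seq x n)))
          ; ⁻¹-cong = λ {x} {y} → *-cong {fromℤ -[1+ 0 ]} {fromℤ -[1+ 0 ]} {x} {y} (≈-refl {fromℤ -[1+ 0 ]}) }
        ; comm = λ x y → pointwise {x + y} {y + x} (λ n → ℚ.+-comm (seq x n) (seq y n)) }
      ; *-cong = λ {x} {x′} {y} {y′} → *-cong {x} {x′} {y} {y′}
      ; *-assoc = λ x y z → pointwise {(x * y) * z} {x * (y * z)}
          (λ n → ℚ.*-assoc (seq x n) (seq y n) (seq z n))
      ; *-identity = (λ x → pointwise {1ℝ * x} {x} (λ n → ℚ.*-identityˡ (seq x n)))
                   , (λ x → pointwise {x * 1ℝ} {x} (λ n → ℚ.*-identityʳ (seq x n)))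
      ; distrib = (λ x y z → pointwise {x * (y + z)} {x * y + x * z}
                    (λ n → ℚ.*-distribˡ-+ (seq x n) (seq y n) (seq z n)))
                , (λ x y z → pointwise {(y + z) * x} {y * x + z * x}
                    (λ n → ℚ.*-distribʳ-+ (seq x n) (seq y n) (seq z n))) }
    ; *-comm = λ x y → pointwise {x * y} {y * x} (λ n → ℚ.*-comm (seq x n) (seq y n)) } }

fromℚᵘ-+ : ∀ p q → ℚ.fromℚᵘ (p ℚᵘ.+ q) ≡ ℚ.fromℚᵘ p ℚ.+ ℚ.fromℚᵘ q
fromℚᵘ-+ p q = ℚ.toℚᵘ-injective (begin
  ℚ.toℚᵘ (ℚ.fromℚᵘ (p ℚᵘ.+ q))                         ≈⟨ ℚ.toℚᵘ-fromℚᵘ (p ℚᵘ.+ q) ⟩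
  p ℚᵘ.+ q                                             ≈⟨ ℚᵘ.+-cong (ℚ.toℚᵘ-fromℚᵘ p) (ℚ.toℚᵘ-fromℚᵘ q) ⟨
  ℚ.toℚᵘ (ℚ.fromℚᵘ p) ℚᵘ.+ ℚ.toℚᵘ (ℚ.fromℚᵘ q)         ≈⟨ ℚ.toℚᵘ-homo-+ (ℚ.fromℚᵘ p) (ℚ.fromℚᵘ q) ⟨
  ℚ.toℚᵘ (ℚ.fromℚᵘ p ℚ.+ ℚ.fromℚᵘ q)                   ∎)
  where open import Relation.Binary.Reasoning.Setoid ℚᵘ.≃-setoid

fromℚᵘ-* : ∀ p q → ℚ.fromℚᵘ (p ℚᵘ.* q) ≡ ℚ.fromℚᵘ p ℚ.* ℚ.fromℚᵘ q
fromℚᵘ-* p q = ℚ.toℚᵘ-injective (begin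
  ℚ.toℚᵘ (ℚ.fromℚᵘ (p ℚᵘ.* q))                         ≈⟨ ℚ.toℚᵘ-fromℚᵘ (p ℚᵘ.* q) ⟩
  p ℚᵘ.* q                                             ≈⟨ ℚᵘ.*-cong (ℚ.toℚᵘ-fromℚᵘ p) (ℚ.toℚᵘ-fromℚᵘ q) ⟨
  ℚ.toℚᵘ (ℚ.fromℚᵘ p) ℚᵘ.* ℚ.toℚᵘ (ℚ.fromℚᵘ q)         ≈⟨ ℚ.toℚᵘ-homo-* (ℚ.fromℚᵘ p) (ℚ.fromℚᵘ q) ⟨
  ℚ.toℚᵘ (ℚ.fromℚᵘ p ℚ.* ℚ.fromℚᵘ q)                   ∎)
  where open import Relation.Binary.Reasoning.Setoid ℚᵘ.≃-setoid

/1-+ : ∀ a b → (a ℤ.+ b) ℚ./ 1 ≡ (a ℚ./ 1) ℚ.+ (b ℚ./ 1)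
/1-+ a b = trans (ℚ.fromℚᵘ-cong {ℚᵘ.mkℚᵘ (a ℤ.+ b) 0} {ℚᵘ.mkℚᵘ a 0 ℚᵘ.+ ℚᵘ.mkℚᵘ b 0} (ℚᵘ.*≡* (cong (ℤ._* + 1) (sym (cong₂ ℤ._+_ (ℤ.*-identityʳ a) (ℤ.*-identityʳ b))))))
  (fromℚᵘ-+ (ℚᵘ.mkℚᵘ a 0) (ℚᵘ.mkℚᵘ b 0))

/1-* : ∀ a b → (a ℤ.* b) ℚ./ 1 ≡ (a ℚ./ 1) ℚ.* (b ℚ./ 1)
/1-* a b = fromℚᵘ-* (ℚᵘ.mkℚᵘ a 0) (ℚᵘ.mkℚᵘ b 0)

/1-injective : ∀ {a b} → a ℚ./ 1 ≡ b ℚ./ 1 → a ≡ b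
/1-injective {a} {b} eq with ℚᵘ.≃-trans (ℚᵘ.≃-sym (ℚ.toℚᵘ-fromℚᵘ (ℚᵘ.mkℚᵘ a 0)))
  (ℚᵘ.≃-trans (ℚᵘ.≃-reflexive (cong ℚ.toℚᵘ eq)) (ℚ.toℚᵘ-fromℚᵘ (ℚᵘ.mkℚᵘ b 0)))
... | ℚᵘ.*≡* a*1≡b*1 = trans (sym (ℤ.*-identityʳ a)) (trans a*1≡b*1 (ℤ.*-identityʳ b))

distance>0 : ∀ {p q} → p ≢ q → 0ℚ ℚ.< ℚ.∣ p ℚ.- q ∣
distance>0 {p} {q} p≢q = ℚ.≰⇒> (λ d≤0 → p≢q (x∙y⁻¹≈ε⇒x≈y p q
  (ℚ.∣p∣≡0⇒p≡0 (p ℚ.- q) (ℚ.≤-antisym d≤0 (ℚ.0≤∣p∣ (p ℚ.- q))))))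

half< : ∀ {d} → 0ℚ ℚ.< d → ½ ℚ.* d ℚ.< d
half< {d} 0<d = subst (½ ℚ.* d ℚ.<_) (solve 1 (λ d → con ½ :* d :+ con ½ :* d := d) refl d)
  (subst (ℚ._< ½ ℚ.* d ℚ.+ ½ ℚ.* d) (ℚ.+-identityʳ (½ ℚ.* d)) (ℚ.+-monoʳ-< (½ ℚ.* d) (half>0 0<d)))

-- Constant sequences at distance d > 0 never come within d / 2 of each other.
fromℚ-injective : ∀ {p q} → fromℚ p ≈ fromℚ q → p ≡ q
fromℚ-injective {p} {q} p≈q with p ℚ.≟ q
... | yes p≡q = p≡q
... | no  p≢q with p≈q (½ ℚ.* ℚ.∣ p ℚ.- q ∣) (half>0 (distance>0 p≢q))
... | N , f = contradiction (ℚ.<-≤-trans (half< (distance>0 p≢q)) (f N ℕ.≤-refl)) (ℚ.<-irrefl refl)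

inverse : ∀ n → ((+ suc n) ℚ./ 1) ℚ.* (+ 1 ℚ./ suc n) ≡ 1ℚ
inverse n = trans (sym (fromℚᵘ-* (ℚᵘ.mkℚᵘ (+ suc n) 0) (ℚᵘ.mkℚᵘ (+ 1) n)))
  (ℚ.fromℚᵘ-cong {ℚᵘ.mkℚᵘ (+ suc n) 0 ℚᵘ.* ℚᵘ.mkℚᵘ (+ 1) n} {ℚᵘ.mkℚᵘ (+ 1) 0} (ℚᵘ.*≡* (trans (ℤ.*-identityʳ _) (trans (ℤ.*-identityʳ (+ suc n))
    (trans (cong (+_ ∘ suc) (sym (ℕ.+-identityʳ n))) (sym (ℤ.*-identityˡ _)))))))

ℝ-algebra : ℤ-Algebra
ℝ-algebra = record
  { commutativeRing = ℝ-commutativeRing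
  ; ι     = fromℤ
  ; ι-+   = λ a b → pointwise {fromℤ (a ℤ.+ b)} {fromℤ a + fromℤ b} (λ _ → /1-+ a b)
  ; ι-*   = λ a b → pointwise {fromℤ (a ℤ.* b)} {fromℤ a * fromℤ b} (λ _ → /1-* a b)
  ; ι-neg = λ a → pointwise {fromℤ (ℤ.- a)} { -ℝ fromℤ a} (λ _ →
      trans (cong (ℚ._/ 1) (sym (ℤ.-1*i≡-i a))) (/1-* -[1+ 0 ] a))
  ; ι-0   = ≈-refl {0ℝ}
  ; ι-1   = ≈-refl {1ℝ}
  ; ι-injective = λ eq → /1-injective (fromℚ-injective eq)
  ; ι-cancel    = cancel
  }
  where
  cancel : ∀ n {x y} → fromℤ (+ suc n) * x ≈ fromℤ (+ suc n) * y → x ≈ y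
  cancel n {x} {y} eq = ≈-trans {x} {n⁻¹ * (fromℤ (+ suc n) * x)} {y}
    (≈-sym {n⁻¹ * (fromℤ (+ suc n) * x)} {x} (undo x))
    (≈-trans {n⁻¹ * (fromℤ (+ suc n) * x)} {n⁻¹ * (fromℤ (+ suc n) * y)} {y}
      (*-cong {n⁻¹} {n⁻¹} {fromℤ (+ suc n) * x} {fromℤ (+ suc n) * y} (≈-refl {n⁻¹}) eq) (undo y))
    where
    n⁻¹ = fromℚ (+ 1 ℚ./ suc n)
    undo : ∀ x → n⁻¹ * (fromℤ (+ suc n) * x) ≈ x
    undo x = pointwise {n⁻¹ * (fromℤ (+ suc n) * x)} {x} (λ k → trans (sym (ℚ.*-assoc (+ 1 ℚ./ suc n) ((+ suc n) ℚ./ 1) (seq x k)))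
      (trans (cong (ℚ._* seq x k) (trans (ℚ.*-comm (+ 1 ℚ./ suc n) ((+ suc n) ℚ./ 1)) (inverse n))) (ℚ.*-identityˡ (seq x k))))

open Geometry ℝ-algebra hiding (inner)
open LatticeGeometry ℝ-algebra
open Generation ℝ-algebra
open Represents
open IntegerEntries
open IsRoot

-- The lattice L

parts : {A : Set} → (Fin 3 → Vector A 6) → (Fin 3 → Vector A 2) → Vector A 2 → Vector A 26
parts X p e = X 0F F.++ X 1F F.++ X 2F F.++ p 0F F.++ p 1F F.++ p 2F F.++ e

module _ {A : Set} (X : Fin 3 → Vector A 6) (p : Fin 3 → Vector A 2) (e : Vector A 2) where

  private
    skip₃ : ∀ (i : Fin 8) → parts X p e (6 ↑ʳ (6 ↑ʳ (6 ↑ʳ i))) ≡ (p 0F F.++ p 1F F.++ p 2F F.++ e) i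
    skip₃ i = trans (F.lookup-++ʳ (X 0F) (X 1F F.++ X 2F F.++ p 0F F.++ p 1F F.++ p 2F F.++ e) (6 ↑ʳ (6 ↑ʳ i)))
      (trans (F.lookup-++ʳ (X 1F) (X 2F F.++ p 0F F.++ p 1F F.++ p 2F F.++ e) (6 ↑ʳ i)) (F.lookup-++ʳ (X 2F) (p 0F F.++ p 1F F.++ p 2F F.++ e) i))

  parts-blk : ∀ j k → parts X p e (blk j k) ≡ X j k
  parts-blk 0F k = F.lookup-++ˡ (X 0F) (X 1F F.++ X 2F F.++ p 0F F.++ p 1F F.++ p 2F F.++ e) k
  parts-blk 1F k = trans (F.lookup-++ʳ (X 0F) (X 1F F.++ X 2F F.++ p 0F F.++ p 1F F.++ p 2F F.++ e) (k ↑ˡ 14))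
    (F.lookup-++ˡ (X 1F) (X 2F F.++ p 0F F.++ p 1F F.++ p 2F F.++ e) k)
  parts-blk 2F k = trans (F.lookup-++ʳ (X 0F) (X 1F F.++ X 2F F.++ p 0F F.++ p 1F F.++ p 2F F.++ e) (6 ↑ʳ (k ↑ˡ 8)))
    (trans (F.lookup-++ʳ (X 1F) (X 2F F.++ p 0F F.++ p 1F F.++ p 2F F.++ e) (k ↑ˡ 8)) (F.lookup-++ˡ (X 2F) (p 0F F.++ p 1F F.++ p 2F F.++ e) k))

  parts-pr : ∀ h i → parts X p e (pr h i) ≡ p h i
  parts-pr 0F i = trans (skip₃ (i ↑ˡ 6)) (F.lookup-++ˡ (p 0F) (p 1F F.++ p 2F F.++ e) i)
  parts-pr 1F i = trans (skip₃ (2 ↑ʳ (i ↑ˡ 4))) (trans (F.lookup-++ʳ (p 0F) (p 1F F.++ p 2F F.++ e) (i ↑ˡ 4)) (F.lookup-++ˡ (p 1F) (p 2F F.++ e) i))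
  parts-pr 2F i = trans (skip₃ (2 ↑ʳ (2 ↑ʳ (i ↑ˡ 2)))) (trans (F.lookup-++ʳ (p 0F) (p 1F F.++ p 2F F.++ e) (2 ↑ʳ (i ↑ˡ 2)))
    (trans (F.lookup-++ʳ (p 1F) (p 2F F.++ e) (i ↑ˡ 2)) (F.lookup-++ˡ (p 2F) e i)))

  parts-end : ∀ i → parts X p e (end i) ≡ e i
  parts-end i = trans (skip₃ (2 ↑ʳ (2 ↑ʳ (2 ↑ʳ i)))) (trans (F.lookup-++ʳ (p 0F) (p 1F F.++ p 2F F.++ e) (2 ↑ʳ (2 ↑ʳ i)))
    (trans (F.lookup-++ʳ (p 1F) (p 2F F.++ e) (2 ↑ʳ i)) (F.lookup-++ʳ (p 2F) e i)))

fromℚ-cong : ∀ {p q} → p ≡ q → fromℚ p ≈ fromℚ q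
fromℚ-cong {p} refl = ≈-refl {fromℚ p}

six-sixths : ∀ z → ((+ 6) ℚ./ 1) ℚ.* (z ℚ./ 6) ≡ z ℚ./ 1
six-sixths z = trans (sym (fromℚᵘ-* (ℚᵘ.mkℚᵘ (+ 6) 0) (ℚᵘ.mkℚᵘ z 5)))
  (ℚ.fromℚᵘ-cong {ℚᵘ.mkℚᵘ (+ 6) 0 ℚᵘ.* ℚᵘ.mkℚᵘ z 5} {ℚᵘ.mkℚᵘ z 0} (ℚᵘ.*≡* (trans (ℤ.*-identityʳ _) (ℤ.*-comm (+ 6) z))))

pairVec : ℤ → Vector ℤ 2
pairVec a = + 3 ℤ.* a F.∷ ℤ.- + 3 ℤ.* a F.∷ F.[]

scaledVec : Index → Vector ℤ 26
scaledVec i = parts (blocks i) (pairVec ∘ pairs i) (pairVec (+ 1))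

vec : Index → Vector ℝ 26
vec i = F.map (λ z → fromℚ (z ℚ./ 6)) (scaledVec i)

vec-represents : ∀ i → RepresentsIndex (vec i) i
vec-represents i = record
  { rep-block = λ j k → entry (blk j k) (parts-blk (blocks i) (pairVec ∘ pairs i) (pairVec (+ 1)) j k)
  ; rep-pair₀ = λ h → entry (pr h 0F) (parts-pr (blocks i) (pairVec ∘ pairs i) (pairVec (+ 1)) h 0F)
  ; rep-pair₁ = λ h → entry (pr h 1F) (parts-pr (blocks i) (pairVec ∘ pairs i) (pairVec (+ 1)) h 1F)
  ; rep-end₀  = entry (end 0F) (parts-end (blocks i) (pairVec ∘ pairs i) (pairVec (+ 1)) 0F)
  ; rep-end₁  = entry (end 1F) (parts-end (blocks i) (pairVec ∘ pairs i) (pairVec (+ 1)) 1F)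
  }
  where
  entry : ∀ k {z} → scaledVec i k ≡ z → fromℤ (+ 6) * vec i k ≈ fromℤ z
  entry k refl = pointwise {fromℤ (+ 6) * vec i k} {fromℤ (scaledVec i k)} (λ _ → six-sixths (scaledVec i k))

A₁-second : ∀ (y : Vector ℤ 2) → y ∈ A 1 → y 1F ≡ ℤ.- + 1 ℤ.* y 0F
A₁-second y Σy≡0 = trans (ring (y 0F) (y 1F)) (trans (cong (λ s → s ℤ.+ ℤ.- + 1 ℤ.* y 0F) Σy≡0) (ℤ.+-identityˡ _))
  where
  ring : ∀ a b → b ≡ (a ℤ.+ (b ℤ.+ 0ℤ)) ℤ.+ ℤ.- + 1 ℤ.* a
  ring = solve-∀

integer-entries : ∀ {v : Vector ℝ 26} X p e → v ≋ F.map fromℤ (parts X p e) → (∀ h → p h ∈ A 1) → e ∈ A 1 →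
  IntegerEntries v X (λ h → p h 0F) (e 0F)
integer-entries {v} X p e v≋ p∈A e∈A = record
  { int-block = λ j k → entry (blk j k) (parts-blk X p e j k)
  ; int-pair₀ = λ h → entry (pr h 0F) (parts-pr X p e h 0F)
  ; int-pair₁ = λ h → entry (pr h 1F) (trans (parts-pr X p e h 1F) (A₁-second (p h) (p∈A h)))
  ; int-end₀  = entry (end 0F) (parts-end X p e 0F)
  ; int-end₁  = entry (end 1F) (trans (parts-end X p e 1F) (A₁-second e e∈A))
  }
  where
  entry : ∀ k {z} → parts X p e k ≡ z → v k ≈ fromℤ z
  entry k refl = v≋ k

Λ-lattice : ∀ {v} → v ∈ Λ → InLattice v
Λ-lattice {v} (x₁ , x₂ , x₃ , y₁ , y₂ , y₃ , y₄ , x₁∈ , x₂∈ , x₃∈ , y₁∈ , y₂∈ , y₃∈ , y₄∈ , v≋) =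
  integer-lattice (integer-entries {v} (x₁ F.∷ x₂ F.∷ x₃ F.∷ F.[]) (y₁ F.∷ y₂ F.∷ y₃ F.∷ F.[]) y₄ v≋
    (λ { 0F → y₁∈ ; 1F → y₂∈ ; 2F → y₃∈ }) y₄∈) (λ { 0F → x₁∈ ; 1F → x₂∈ ; 2F → x₃∈ })

β-represents : ∀ t → Represents (F.map fromℚ (β t)) (glue-block t) (glue-pair t) (+ 1)
β-represents t = record
  { rep-block = λ j k → entry (blk j k) (glue-block t j k) (from-yes (all? λ t → all? λ j → all? λ k →
      ((+ 6) ℚ./ 1) ℚ.* β t (blk j k) ℚ.≟ glue-block t j k ℚ./ 1) t j k)
  ; rep-pair₀ = λ h → entry (pr h 0F) (+ 3 ℤ.* glue-pair t h) (from-yes (all? λ t → all? λ h →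
      ((+ 6) ℚ./ 1) ℚ.* β t (pr h 0F) ℚ.≟ (+ 3 ℤ.* glue-pair t h) ℚ./ 1) t h)
  ; rep-pair₁ = λ h → entry (pr h 1F) (ℤ.- + 3 ℤ.* glue-pair t h) (from-yes (all? λ t → all? λ h →
      ((+ 6) ℚ./ 1) ℚ.* β t (pr h 1F) ℚ.≟ (ℤ.- + 3 ℤ.* glue-pair t h) ℚ./ 1) t h)
  ; rep-end₀  = entry (end 0F) (+ 3) (from-yes (all? λ t → ((+ 6) ℚ./ 1) ℚ.* β t (end 0F) ℚ.≟ (+ 3) ℚ./ 1) t)
  ; rep-end₁  = entry (end 1F) -[1+ 2 ] (from-yes (all? λ t → ((+ 6) ℚ./ 1) ℚ.* β t (end 1F) ℚ.≟ -[1+ 2 ] ℚ./ 1) t)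
  }
  where
  entry : ∀ k z → ((+ 6) ℚ./ 1) ℚ.* β t k ≡ z ℚ./ 1 → fromℤ (+ 6) * fromℚ (β t k) ≈ fromℤ z
  entry k z eq = pointwise {fromℤ (+ 6) * fromℚ (β t k)} {fromℤ z} (λ _ → eq)

≋-sym : ∀ {u v : Vector ℝ 26} → u ≋ v → v ≋ u
≋-sym {u} {v} u≋v k = ≈-sym {u k} {v k} (u≋v k)

≋-trans : ∀ {u v w : Vector ℝ 26} → u ≋ v → v ≋ w → u ≋ w
≋-trans {u} {v} {w} u≋v v≋w k = ≈-trans {u k} {v k} {w k} (u≋v k) (v≋w k)

L⊆InLattice : ∀ {v} → v ∈ L → InLattice v
L⊆InLattice (generator (inj₁ v∈Λ)) = Λ-lattice v∈Λ
L⊆InLattice (generator {v} (inj₂ (t , v≋β))) = lattice-resp {F.map fromℚ (β t)} {v}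
  (≋-sym {v} {F.map fromℚ (β t)} v≋β) (inLattice (β-represents t) (glue-point t))
L⊆InLattice zeroᵛ = lattice-0
L⊆InLattice (add {u} {v} p q) = lattice-+ {u} {v} (L⊆InLattice p) (L⊆InLattice q) (λ k → ≈-refl {u k + v k})
L⊆InLattice (scale z {v} p) = lattice-* {v} z (L⊆InLattice p) (λ k → ≈-refl {fromℤ z * v k})
L⊆InLattice (resp u≋v p) = lattice-resp u≋v (L⊆InLattice p)

ℝL⊆ZeroSums : ∀ {v} → v ∈ ℝL → ZeroSums v
ℝL⊆ZeroSums (generator v∈L) = lattice-zero-sums (L⊆InLattice v∈L)
ℝL⊆ZeroSums zeroᵛ = lattice-zero-sums lattice-0
ℝL⊆ZeroSums (add {u} {v} p q) = zero-sums-+ {u} {v} (ℝL⊆ZeroSums p) (ℝL⊆ZeroSums q) (λ k → ≈-refl {u k + v k})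
ℝL⊆ZeroSums (scale z {v} p) = zero-sums-* {v} z (ℝL⊆ZeroSums p) (λ k → ≈-refl {z * v k})
-- Passing to an equal vector is treated as scaling by 1.
ℝL⊆ZeroSums (resp {u} {v} u≋v p) = zero-sums-* {u} {v} 1ℝ (ℝL⊆ZeroSums p) (λ k → ≈-trans {v k} {u k} {1ℝ * u k}
  (≈-sym {u k} {v k} (u≋v k)) (pointwise {u k} {1ℝ * u k} (λ n → sym (ℚ.*-identityˡ (seq (u k) n)))))

ρ-root : IsRoot ρ
ρ-root = record
  { root-block = λ j k → fromℚ-cong (from-yes (all? λ j → all? λ k → ρℚ (blk j k) ℚ.≟ 0ℚ) j k)
  ; root-pair  = λ h e → fromℚ-cong (from-yes (all? λ h → all? λ e → ρℚ (pr h e) ℚ.≟ 0ℚ) h e)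
  ; root-end₀  = fromℚ-cong {ρℚ (end 0F)} refl
  ; root-end₁  = fromℚ-cong {ρℚ (end 1F)} refl
  }
  where
  ρℚ : Vector ℚ 26
  ρℚ = 0₅ F.++ 0₅ F.++ 0₅ F.++ 0₁ F.++ 0₁ F.++ 0₁ F.++ 2α₁

point-in-L : ∀ {v U a a₃} → Represents v U a a₃ → LatticePoint U a a₃ → v ∈ L
point-in-L {v} rep p = resp {u = combined} {v = v} (generated {l = l} {b = b} rep p
    (integer-entries {l} x (λ h → w h F.∷ ℤ.- + 1 ℤ.* w h F.∷ F.[]) (w₃ F.∷ ℤ.- + 1 ℤ.* w₃ F.∷ F.[]) (λ k → ≈-refl {l k})
      (λ h → ring (w h)) (ring w₃)) β-represents)
  combined∈L
  where
  open LatticePoint p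
  ring : ∀ a → a ℤ.+ (ℤ.- + 1 ℤ.* a ℤ.+ 0ℤ) ≡ 0ℤ
  ring = solve-∀
  l : Vector ℝ 26
  l = F.map fromℤ (parts x (λ h → w h F.∷ ℤ.- + 1 ℤ.* w h F.∷ F.[]) (w₃ F.∷ ℤ.- + 1 ℤ.* w₃ F.∷ F.[]))
  l∈Λ : l ∈ Λ
  l∈Λ = x 0F , x 1F , x 2F , (w 0F F.∷ ℤ.- + 1 ℤ.* w 0F F.∷ F.[]) , (w 1F F.∷ ℤ.- + 1 ℤ.* w 1F F.∷ F.[]) , (w 2F F.∷ ℤ.- + 1 ℤ.* w 2F F.∷ F.[])
    , (w₃ F.∷ ℤ.- + 1 ℤ.* w₃ F.∷ F.[]) , Σx 0F , Σx 1F , Σx 2F , ring (w 0F) , ring (w 1F) , ring (w 2F) , ring w₃ , (λ k → ≈-refl {l k})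
  gen : ∀ t → F.map fromℚ (β t) ∈ L
  gen t = generator (inj₂ (t , λ k → ≈-refl {fromℚ (β t k)}))
  b : Fin 4 → Vector ℝ 26
  b t = F.map fromℚ (β t)
  combined : Vector ℝ 26
  combined = l +ᵛ (fromℤ c₀ *ᵛ b 0F +ᵛ (fromℤ (c 0F) *ᵛ b 1F +ᵛ (fromℤ (c 1F) *ᵛ b 2F +ᵛ fromℤ (c 2F) *ᵛ b 3F)))
  combined∈L : combined ∈ L
  combined∈L = add {u = l} (generator (inj₁ l∈Λ)) (add {u = fromℤ c₀ *ᵛ b 0F} (scale c₀ (gen 0F))
    (add {u = fromℤ (c 0F) *ᵛ b 1F} (scale (c 0F) (gen 1F)) (add {u = fromℤ (c 1F) *ᵛ b 2F} (scale (c 1F) (gen 2F)) (scale (c 2F) (gen 3F)))))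

open Descent ℝ-algebra using (Meetsᴬ; triple-cell)
open Extension ℝ-algebra using (module FromCells)
open Angles ℝ-algebra
open IsAffineEquiangular
open IsAffineEquiangularIn

-- Maximum sets

-- The value at a triple is a dummy; `toIndex-toCut` concerns cuts only.
toCut : Index → Cut
toCut (triple _ _ _ _) = mkCut (Vec.replicate 6 true) true true
toCut (cut _ x y z)    = mkCut x y z

toIndex-toCut : ∀ {j} i → kind i ≡ suc j → toIndex j (toCut i) ≡ i
toIndex-toCut (cut _ _ _ _) refl = refl

bools : List Bool
bools = true ∷ false ∷ []

∈-bools : ∀ b → b ∈ˡ bools
∈-bools true  = here refl
∈-bools false = there (here refl)

bit-vectors : ∀ n → List (Vec Bool n)
bit-vectors ℕ.zero  = Vec.[] ∷ []
bit-vectors (suc n) = List.cartesianProductWith Vec._∷_ bools (bit-vectors n)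

∈-bit-vectors : ∀ {n} (x : Vec Bool n) → x ∈ˡ bit-vectors n
∈-bit-vectors Vec.[]      = here refl
∈-bit-vectors (b Vec.∷ x) = ∈-cartesianProductWith⁺ Vec._∷_ (∈-bools b) (∈-bit-vectors x)

-- Unbalanced cuts are included; `Valid` sorts them out while a set is being listed.
indices : List Index
indices =
  List.cartesianProductWith (λ { (σ , i) (j , l) → triple σ i j l })
    (List.cartesianProduct bools (List.allFin 6)) (List.cartesianProduct (List.allFin 6) (List.allFin 6))
  List.++ List.cartesianProductWith (λ { (j , x) (y , z) → cut j x y z })
    (List.cartesianProduct (List.allFin 3) (bit-vectors 6)) (List.cartesianProduct bools bools)

∈-indices : ∀ i → i ∈ˡ indices
∈-indices (triple σ i j l) = ∈-++⁺ˡ (∈-cartesianProductWith⁺ (λ { (σ , i) (j , l) → triple σ i j l })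
  (∈-cartesianProductWith⁺ _,_ (∈-bools σ) (∈-allFin i)) (∈-cartesianProductWith⁺ _,_ (∈-allFin j) (∈-allFin l)))
∈-indices (cut j x y z) = ∈-++⁺ʳ (List.cartesianProductWith (λ { (σ , i) (j , l) → triple σ i j l })
    (List.cartesianProduct bools (List.allFin 6)) (List.cartesianProduct (List.allFin 6) (List.allFin 6)))
  (∈-cartesianProductWith⁺ (λ { (j , x) (y , z) → cut j x y z })
    (∈-cartesianProductWith⁺ _,_ (∈-allFin j) (∈-bit-vectors x)) (∈-cartesianProductWith⁺ _,_ (∈-bools y) (∈-bools z)))

all-from-lookup : ∀ {A : Set} {P : A → Set} (xs : List A) → (∀ k → P (List.lookup xs k)) → All P xs
all-from-lookup []       p = []
all-from-lookup (x ∷ xs) p = p zero ∷ all-from-lookup xs (p ∘ suc)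

L-indexed : ∀ {u} → u ∈ L → ⟨ u , ρ ⟩ ≈ 1ℝ → ⟨ u , u ⟩ ≈ 3ℝ → ∃[ i ] Valid i × RepresentsIndex u i
L-indexed {u} u∈L u-root u-norm = lattice-indexed u∈ (rooted {u} {ρ} (lattice-zero-sums u∈) ρ-root u-root) u-norm
  where u∈ = L⊆InLattice u∈L

represented≋vec : ∀ {u} i → RepresentsIndex u i → u ≋ vec i
represented≋vec {u} i rep = represents-unique {u} {vec i} rep (vec-represents i)

-- A consequence of `one-index`; it makes the length of a clique a faithful count of vectors.
clique-position : ∀ {u xs} → All Valid xs → AllPairs Compatible xs → ∀ {k k′} →
  RepresentsIndex u (List.lookup xs k) → RepresentsIndex u (List.lookup xs k′) → k ≡ k′
clique-position {u} {xs} valid clique {k} {k′} p q with k Fin.≟ k′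
... | yes k≡k′ = k≡k′
... | no  k≢k′ = contradiction (allPairs-lookup compatible-sym clique k≢k′)
  (one-index {u} (List.lookup xs k) (List.lookup xs k′) (All.lookup valid (∈-lookup k)) p q)

-- Listing the members of a set by indices

record Listing (ω : Subset 26) : Set where
  field
    list    : List Index
    valid   : All Valid list
    clique  : AllPairs Compatible list
    members : All (λ i → vec i ∈ member ω) list
    cover   : ∀ {u} → u ∈ member ω → ∃[ k ] RepresentsIndex u (List.lookup list k)

module _ (ω : Subset 26) (ω-AE : IsAffineEquiangularIn ρ L ω) where

  private
    ω-inner : ∀ {i x} → Valid i → vec i ∈ member ω → vec x ∈ member ω → ¬ (vec i ≋ vec x) → Compatible i x
    ω-inner {i} {x} valid i∈ω x∈ω i≢x = angle⇒compatible {vec i} {vec x} i x valid (vec-represents i) (vec-represents x)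
      (inner (isAffineEquiangular ω-AE) i∈ω x∈ω i≢x)

    record PartialListing (es : List Index) : Set where
      field
        list    : List Index
        valid   : All Valid list
        clique  : AllPairs Compatible list
        members : All (λ i → vec i ∈ member ω) list
        cover   : ∀ {i} → i ∈ˡ es → Valid i → vec i ∈ member ω → ∃[ k ] vec i ≋ vec (List.lookup list k)

    -- The two decisions are arguments because they are available only under a double negation. A
    -- negative answer to the second is the distinctness from all listed vectors that `inner` asks
    -- for.
    extend : ∀ {e es} → (p : PartialListing es) → let open PartialListing p in
      Dec (Valid e × vec e ∈ member ω) → Dec (∃[ k ] vec e ≋ vec (List.lookup list k)) → PartialListing (e ∷ es)
    extend p (no  e∉) _ = record { PartialListing p ; cover = λ where
        (here refl) v i∈ω → contradiction (v , i∈ω) e∉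
        (there i∈)  v i∈ω → PartialListing.cover p i∈ v i∈ω }
    extend p (yes _) (yes found) = record { PartialListing p ; cover = λ where
        (here refl) v i∈ω → found
        (there i∈)  v i∈ω → PartialListing.cover p i∈ v i∈ω }
    extend {e} p (yes (e-valid , e∈ω)) (no new) = record
      { list    = e ∷ list
      ; valid   = e-valid ∷ valid
      ; clique  = all-from-lookup list (λ k → ω-inner e-valid e∈ω (All.lookup members (∈-lookup k)) (λ e≋ → new (k , e≋))) ∷ clique
      ; members = e∈ω ∷ members
      ; cover   = λ where
          (here refl) v i∈ω → zero , λ k → ≈-refl {vec e k}
          (there i∈)  v i∈ω → suc (proj₁ (cover i∈ v i∈ω)) , proj₂ (cover i∈ v i∈ω)
      }
      where open PartialListing p

    -- Each index raises two undecided questions. As there are finitely many indices, excluded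
    -- middle can be invoked for all of them inside one double negation.
    partial : ∀ es → ¬ ¬ PartialListing es
    partial []       ¬p = ¬p (record { list = [] ; valid = [] ; clique = [] ; members = [] ; cover = λ () })
    partial (e ∷ es) ¬p = partial es (λ p → ¬¬-excluded-middle (λ e∈? → ¬¬-excluded-middle (λ new? → ¬p (extend p e∈? new?))))

  listing : ¬ ¬ Listing ω
  listing ¬l = partial indices (λ p → ¬l (complete p))
    where
    complete : PartialListing indices → Listing ω
    complete p = record { PartialListing p ; cover = covered }
      where
      open PartialListing p
      covered : ∀ {u} → u ∈ member ω → ∃[ k ] RepresentsIndex u (List.lookup list k)
      covered {u} u∈ω = found (L-indexed {u} (contained ω-AE u∈ω) (root (isAffineEquiangular ω-AE) u∈ω) (norm (isAffineEquiangular ω-AE) u∈ω))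
        where
        found : (∃[ i ] Valid i × RepresentsIndex u i) → ∃[ k ] RepresentsIndex u (List.lookup list k)
        found (i , i-valid , rep) = k , represents-resp {vec (List.lookup list k)} {u}
            (≋-sym {u} {vec (List.lookup list k)} (≋-trans {u} {vec i} {vec (List.lookup list k)} u≋i (proj₂ i-cover)))
            (vec-represents (List.lookup list k))
          where
          u≋i : u ≋ vec i
          u≋i = represented≋vec {u} i rep
          i-cover = cover (∈-indices i) i-valid (respects ω u≋i u∈ω)
          k = proj₁ i-cover

indexed-set : List Index → Subset 26
indexed-set ys = record
  { member   = λ u → ∃[ k ] RepresentsIndex u (List.lookup ys k)
  ; respects = λ {u} {v} u≋v (k , rep) → k , represents-resp {u} {v} u≋v rep
  }

indexed-set-AE : ∀ {ys} → All Valid ys → AllPairs Compatible ys → IsAffineEquiangularIn ρ L (indexed-set ys)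
indexed-set-AE {ys} valid clique = record
  { isAffineEquiangular = record
    { root  = λ {u} (k , p) → index-root {u} {ρ} (at k) (at-valid k) p ρ-root
    ; norm  = λ {u} (k , p) → index-norm {u} (at k) (at-valid k) p
    ; inner = λ {u} {v} (k , p) (k′ , q) u≢v → angle {u} {v} p q u≢v (k Fin.≟ k′)
    }
  ; contained = λ {u} (k , p) → point-in-L {u} p (index-point (at k) (at-valid k))
  }
  where
  at : Fin (length ys) → Index
  at = List.lookup ys
  at-valid : ∀ k → Valid (at k)
  at-valid k = All.lookup valid (∈-lookup k)
  angle : ∀ {u v k k′} → RepresentsIndex u (at k) → RepresentsIndex v (at k′) → ¬ (u ≋ v) → Dec (k ≡ k′) →
    ⟨ u , v ⟩ ≈ 0ℝ ⊎ ⟨ u , v ⟩ ≈ 1ℝ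
  angle {u} {v} p q u≢v (yes refl) = contradiction (represents-unique {u} {v} p q) u≢v
  angle {u} {v} {k} {k′} p q u≢v (no k≢k′) =
    compatible⇒angle {u} {v} (at k) (at k′) (at-valid k) p q (allPairs-lookup compatible-sym clique k≢k′)

-- Consequences of maximum cardinality

module Maximum {ω : Subset 26} (ω-max : IsMaximumIn ρ L ω) (ℓ : Listing ω) where
  open Listing ℓ

  -- A longer clique would define a set of lattice vectors into which `ω` injects, position by
  -- position, while an injection back would squeeze `length ys` positions into fewer. This is where
  -- the maximality of the cardinality is applied.
  clique-bound : ∀ {ys} → All Valid ys → AllPairs Compatible ys → length ys ℕ.≤ length list
  clique-bound {ys} ys-valid ys-clique = ℕ.≮⇒≥ (λ small →
    proj₂ ω-max (indexed-set ys) (indexed-set-AE ys-valid ys-clique) (into (ℕ.<⇒≤ small) , no-back small))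
    where
    position : ∀ {u} → u ∈ member ω → Fin (length list)
    position u∈ = proj₁ (cover u∈)
    same-position : ∀ {u v} (u∈ : u ∈ member ω) (v∈ : v ∈ member ω) → u ≋ v → position u∈ ≡ position v∈
    same-position {u} {v} u∈ v∈ u≋v = clique-position {v} valid clique
      (represents-resp {u} {v} u≋v (proj₂ (cover u∈))) (proj₂ (cover v∈))
    image : length list ℕ.≤ length ys → ∀ {u} → u ∈ member ω → Index
    image ≤ u∈ = List.lookup ys (inject≤ (position u∈) ≤)
    into : length list ℕ.≤ length ys → Injection (elements ω) (elements (indexed-set ys))
    into ≤ = record
      { to        = λ (u , u∈) → vec (image ≤ u∈) , inject≤ (position u∈) ≤ , vec-represents (image ≤ u∈)
      ; cong      = λ { {u , u∈} {v , v∈} u≋v k → ≡⇒≈ (cong (λ p → vec (List.lookup ys (inject≤ p ≤)) k) (same-position u∈ v∈ u≋v)) }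
      ; injective = λ { {u , u∈} {v , v∈} eq → back u∈ v∈ (Fin.inject≤-injective ≤ ≤ (position u∈) (position v∈)
          (clique-position {vec (image ≤ v∈)} ys-valid ys-clique
            (represents-resp {vec (image ≤ u∈)} {vec (image ≤ v∈)} eq (vec-represents (image ≤ u∈))) (vec-represents (image ≤ v∈)))) }
      }
      where
      ≡⇒≈ : ∀ {x y : ℝ} → x ≡ y → x ≈ y
      ≡⇒≈ {x} refl = ≈-refl {x}
      back : ∀ {u v} (u∈ : u ∈ member ω) (v∈ : v ∈ member ω) → position u∈ ≡ position v∈ → u ≋ v
      back {u} {v} u∈ v∈ eq = represents-unique {u} {v} (subst (λ k → RepresentsIndex u (List.lookup list k)) eq (proj₂ (cover u∈))) (proj₂ (cover v∈))
    no-back : length list ℕ.< length ys → ¬ Injection (elements (indexed-set ys)) (elements ω)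
    no-back small f = ℕ.<⇒≱ small (Fin.injective⇒≤ {f = λ k → position (proj₂ (f-at k))} injective)
      where
      element : Fin (length ys) → Σ (Vector ℝ 26) (member (indexed-set ys))
      element k = vec (List.lookup ys k) , k , vec-represents (List.lookup ys k)
      f-at : Fin (length ys) → Σ (Vector ℝ 26) (member ω)
      f-at k = Injection.to f (element k)
      injective : ∀ {k k′} → position (proj₂ (f-at k)) ≡ position (proj₂ (f-at k′)) → k ≡ k′
      injective {k} {k′} eq = clique-position {vec (List.lookup ys k′)} ys-valid ys-clique
        (represents-resp {vec (List.lookup ys k)} {vec (List.lookup ys k′)}
          (Injection.injective f {element k} {element k′}
            (represents-unique {proj₁ (f-at k)} {proj₁ (f-at k′)}
              (subst (λ p → RepresentsIndex (proj₁ (f-at k)) (List.lookup list p)) eq (proj₂ (cover (proj₂ (f-at k)))))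
              (proj₂ (cover (proj₂ (f-at k′))))))
          (vec-represents (List.lookup ys k)))
        (vec-represents (List.lookup ys k′))

  hasKind? : ∀ k i → Dec (kind i ≡ k)
  hasKind? k i = kind i Fin.≟ k

  ofKind others : Fin 4 → List Index
  ofKind k = List.filter (hasKind? k) list
  others k = List.filter (¬? ∘ hasKind? k) list

  -- A clique of one kind can be exchanged for another, as different kinds are compatible.
  kind-bound : ∀ k {zs} → All (λ i → kind i ≡ k) zs → All Valid zs → AllPairs Compatible zs → length zs ℕ.≤ length (ofKind k)
  kind-bound k {zs} zs-kind zs-valid zs-clique = ℕ.+-cancelʳ-≤ (length (others k)) (length zs) (length (ofKind k)) (begin
    length zs ℕ.+ length (others k)             ≡⟨ sym (List.length-++ zs) ⟩
    length (zs List.++ others k)                ≤⟨ clique-bound (All.++⁺ zs-valid others-valid)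
                                                     (AllPairs.++⁺ zs-clique (AllPairs.filter⁺ (¬? ∘ hasKind? k) clique) across) ⟩
    length list                                 ≡⟨ sym (length-filter-split (hasKind? k) list) ⟩
    length (ofKind k) ℕ.+ length (others k)     ∎)
    where
    open ℕ.≤-Reasoning
    others-valid : All Valid (others k)
    others-valid = All.filter⁺ (¬? ∘ hasKind? k) valid
    across : All (λ i → All (Compatible i) (others k)) zs
    across = All.zipWith (λ { {i} (i-kind , i-valid) → All.zipWith (λ { {x} (x-kind , x-valid) →
        compatible-kinds i x i-valid x-valid (λ eq → x-kind (trans (sym eq) i-kind)) })
      (All.all-filter (¬? ∘ hasKind? k) list , others-valid) }) (zs-kind , zs-valid)

  triples-large : 36 ℕ.≤ length (ofKind 0F)
  triples-large = kind-bound 0F (from-yes (All.all? (hasKind? 0F) cyclic-triples)) cyclic-triples-valid cyclic-triples-clique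

  cuts-large : ∀ j → 7 ℕ.≤ length (ofKind (suc j))
  cuts-large j = kind-bound (suc j) (refl ∷ refl ∷ refl ∷ refl ∷ refl ∷ refl ∷ refl ∷ []) (seven-cuts-valid j) (seven-cuts-clique j)

  cuts : Fin 3 → List Cut
  cuts j = List.map toCut (ofKind (suc j))

  cuts-indices : ∀ j → List.map (toIndex j) (cuts j) ≡ ofKind (suc j)
  cuts-indices j = recovered (ofKind (suc j)) (All.all-filter (hasKind? (suc j)) list)
    where
    recovered : ∀ xs → All (λ i → kind i ≡ suc j) xs → List.map (toIndex j) (List.map toCut xs) ≡ xs
    recovered []       []       = refl
    recovered (x ∷ xs) (p ∷ ps) = trans (cong (_∷ _) (toIndex-toCut x p)) (cong (x ∷_) (recovered xs ps))

  cuts-all : ∀ {Q : Index → Set} → All Q list → ∀ j → All (λ c → Q (toIndex j c)) (cuts j)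
  cuts-all {Q} qs j = All.map⁻ (subst (All Q) (sym (cuts-indices j)) (All.filter⁺ (hasKind? (suc j)) qs))

  cuts-clique : ∀ j → AllPairs (λ c c′ → Compatible (toIndex j c) (toIndex j c′)) (cuts j)
  cuts-clique j = AllPairs.map⁻ (subst (AllPairs Compatible) (sym (cuts-indices j)) (AllPairs.filter⁺ (hasKind? (suc j)) clique))

  module Extended {v : Vector ℝ 26} (v∈ℝL : v ∈ ℝL) (v-ρ : ⟨ v , ρ ⟩ ≈ 1ℝ) (v-norm : ⟨ v , v ⟩ ≈ 3ℝ)
    (v-inner : All (λ i → ⟨ v , vec i ⟩ ∈0,1) list) where

    v-zero : ZeroSums v
    v-zero = ℝL⊆ZeroSums v∈ℝL

    v-root : Rooted v
    v-root = rooted {v} {ρ} v-zero ρ-root v-ρ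

    v-meets : All (Meetsᴬ (blockPart v) (pairPart v)) list
    v-meets = All.map (λ {i} → angle⇒meets {v} {vec i} i v-zero v-root (vec-represents i)) v-inner

    open Triples (ofKind 0F) (All.all-filter (hasKind? 0F) list) (AllPairs.filter⁺ (hasKind? 0F) clique) triples-large
      using (square; cells)

    v-indexed : ∃[ i ] Valid i × RepresentsIndex v i
    v-indexed = represent (FromCells.extension-is-indexed (blockPart v) (pairPart v) blocks-zero
        (norm-equation {v} v-zero v-root v-norm) square
        (λ i j → triple-cell (blockPart v) (pairPart v) blocks-zero (proj₂ (cells (All.filter⁺ (hasKind? 0F) v-meets) i j)))
        cuts (λ j → cuts-all valid j) cuts-clique
        (λ j → subst (7 ℕ.≤_) (sym (List.length-map toCut (ofKind (suc j)))) (cuts-large j))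
        (λ j → cuts-all v-meets j))
      where
      blocks-zero : ∀ j → _
      blocks-zero = block-part-sum v-zero
      represent : (∃[ i ] Valid i × (∀ h k → blockPart v h k ≈ fromℤ (blocks i h k)) × (∀ h → pairPart v h ≈ fromℤ (+ 6 ℤ.* pairs i h))) →
        ∃[ i ] Valid i × RepresentsIndex v i
      represent (i , i-valid , P≈ , g≈) = i , i-valid , represents-from-parts {v} v-zero v-root P≈ g≈

    -- The index of `v` could be put in front of the listing, giving a clique longer than
    -- `clique-bound` allows.
    impossible : ⊥
    impossible = too-large v-indexed
      where
      too-large : ¬ (∃[ i ] Valid i × RepresentsIndex v i)
      too-large (i , i-valid , rep) = ℕ.<-irrefl refl (clique-bound (i-valid ∷ valid)
        (All.map (λ {x} → angle⇒compatible {v} {vec x} i x i-valid rep (vec-represents x)) v-inner ∷ clique))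

theorem7p5 : ∀ (ω : Subset 26) → IsMaximumIn ρ L ω → IsMaximalIn ρ ℝL ω
theorem7p5 ω ω-max@(ω-AE , _) =
    record { isAffineEquiangular = isAffineEquiangular ω-AE ; contained = λ u∈ω → generator (contained ω-AE u∈ω) }
  -- The goal here is `⊥`, so the doubly negated listing can be used as if it were given. The new
  -- `v` differs from every listed member because `ω` respects equality of vectors.
  , λ { ω′ ω′-AE (ω⊆ω′ , v , v∈ω′ , v∉ω) → listing ω ω-AE (λ ℓ →
      Maximum.Extended.impossible ω-max ℓ {v} (contained ω′-AE v∈ω′)
        (root (isAffineEquiangular ω′-AE) v∈ω′) (norm (isAffineEquiangular ω′-AE) v∈ω′)
        (All.map (λ {i} i∈ω → inner (isAffineEquiangular ω′-AE) v∈ω′ (ω⊆ω′ i∈ω)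
            (λ v≋i → v∉ω (respects ω (≋-sym {v} {vec i} v≋i) i∈ω)))
          (Listing.members ℓ))) }
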